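{- Let $n \ge 3$ be an integer with canonical prime factorization $n = p_1^{e_1}\cdots p_l^{e_l}$, and let $D = \gcd(p_1 - 1, \ldots, p_l - 1)$. There exists a rotational first-kind Frobenius circulant with kernel $\mathbb{Z}_n$ and degree $d$ if and only if $n$ is odd and $d$ is an even divisor of $D$. Moreover, if $n$ is odd and $d$ is an even divisor of $D$, then there are precisely $\varphi(d)^{l-1}$ pairwise non-isomorphic rotational first-kind Frobenius circulants of degree $d$ with kernel $\mathbb{Z}_n$ (where $\varphi$ is Euler's totient function). Each of these circulants is isomorphic to $\mathrm{Cay}(\mathbb{Z}_n, \langle [h] \rangle)$ for some $[h] \in \mathbb{Z}_n^*$ of the form $$h = \sum_{i=1}^l \frac{n}{p_i^{e_i}}\, b_i h_i,$$ where $b_i$ and $h_i$ are integers satisfying $b_i (n/p_i^{e_i}) \equiv 1 \pmod{p_i^{e_i}}$ and $h_i \equiv \eta_i^{m_i \varphi(p_i^{e_i})/d} \pmod{p_i^{e_i}}$, for a fixed primitive root $\eta_i$ modulo $p_i^{e_i}$ and an integer $m_i$ coprime to $d$. Furthermore, each such circulant is a first-kind $\mathbb{Z}_n \rtimes \mathbb{Z}_d$-Frobenius graph that admits $[h]$ as a complete rotation.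
   Context: $\mathbb{Z}_n$ is the additive group of integers mod $n$, and $\mathbb{Z}_n^* \cong \mathrm{Aut}(\mathbb{Z}_n)$ is its group of units, acting on $\mathbb{Z}_n$ by multiplication; $\langle [h]\rangle$ is the cyclic subgroup of $\mathbb{Z}_n^*$ generated by $[h]$, viewed as a subset of $\mathbb{Z}_n$. For a group $G$ and $S \subseteq G$ with $1 \notin S$, $S = S^{ -1}$, the Cayley graph $\mathrm{Cay}(G,S)$ has vertex set $G$, with $g,h$ adjacent iff $gh^{ -1} \in S$; a circulant is a Cayley graph on a cyclic group. A complete rotation of $\mathrm{Cay}(G,S)$ is an automorphism $\omega$ of the group $G$ with $S^\omega = S$ such that $\omega$ permutes $S$ cyclically, i.e. $\{s, s^\omega, \ldots, s^{\omega^{|S|-1}}\} = S$ for some (equivalently every) $s \in S$; the graph is rotational if it admits a complete rotation. A Frobenius group is a transitive, non-regular permutation group in which only the identity fixes two points. For a subgroup $H \le \mathbb{Z}_n^*$ such that $\mathbb{Z}_n \rtimes H$ (acting on $\mathbb{Z}_n$ by $[x]^{([y],[u])} = [(x+y)u]$) is a Frobenius group, a first-kind $\mathbb{Z}_n \rtimes H$-Frobenius graph is a connected circulant $\mathrm{Cay}(\mathbb{Z}_n, S)$ with $S = a^H$ (the $H$-orbit of some $a \in \mathbb{Z}_n$) and $\langle a^H\rangle = \mathbb{Z}_n$, where $|H|$ is even or $a$ is an involution; such a graph is called a first-kind Frobenius circulant with kernel $\mathbb{Z}_n$ and complement $H$. (Equivalently: a connected $\mathrm{Cay}(\mathbb{Z}_n,S)$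 together with $H \le \mathbb{Z}_n^*$ regular on $S$ and semiregular on $\mathbb{Z}_n\setminus\{[0]\}$.) The notation $\mathbb{Z}_n \rtimes \mathbb{Z}_d$ means $\mathbb{Z}_n \rtimes H$ with $H$ cyclic of order $d$. -}

module Defs where

open import Data.Nat as ℕ using (ℕ; zero; suc; _<_; NonZero)
open import Data.Nat.DivMod using (_mod_; _/_)
open import Data.Nat.Divisibility using (_∣_)
open import Data.Nat.GCD using (gcd)
open import Data.Nat.Coprimality using (Coprime; coprime?)
open import Data.Integer as ℤ using (ℤ; +_; _%ℕ_)
open import Data.Integer.Divisibility as ℤD using ()
open import Data.Fin as F using (Fin; toℕ)
open import Data.Fin.Subset using (Subset; _∈_; _∉_; ∣_∣)
open import Data.List using (List; length; filter; upTo)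
open import Data.Product using (Σ; ∃; _×_; _,_)
open import Data.Sum using (_⊎_)
open import Function.Bundles using (_⇔_)
open import Function.Definitions using (Bijective)
open import Relation.Binary.PropositionalEquality using (_≡_; _≢_)
open import Relation.Nullary using (¬_)

-- Total natural-number division; divN a 0 = 0 (only ever used with
-- nonzero divisors that divide exactly).
divN : ℕ → ℕ → ℕ
divN a zero    = 0
divN a (suc d) = a / suc d

totient : ℕ → ℕ
totient d = length (filter (λ k → coprime? k d) (upTo d))

prodF : (l : ℕ) → (Fin l → ℕ) → ℕ
prodF zero    f = 1
prodF (suc l) f = f F.zero ℕ.* prodF l (λ i → f (F.suc i))

gcdF : (l : ℕ) → (Fin l → ℕ) → ℕ
gcdF zero    f = 0
gcdF (suc l) f = gcd (f F.zero) (gcdF l (λ i → f (F.suc i)))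

sumZ : (l : ℕ) → (Fin l → ℤ) → ℤ
sumZ zero    f = + 0
sumZ (suc l) f = f F.zero ℤ.+ sumZ l (λ i → f (F.suc i))

CongZ : ℕ → ℤ → ℤ → Set
CongZ q a b = (+ q) ℤD.∣ (a ℤ.- b)

PrimitiveRoot : ℕ → ℤ → Set
PrimitiveRoot q η =
  CongZ q (η ℤ.^ totient q) (+ 1) ×
  (∀ k → 0 < k → k < totient q → ¬ CongZ q (η ℤ.^ k) (+ 1))

iter : {A : Set} → (A → A) → ℕ → A → A
iter f zero    x = x
iter f (suc k) x = f (iter f k x)

module _ {n : ℕ} .{{_ : NonZero n}} where

  [_] : ℕ → Fin n
  [ m ] = m mod n

  [_]ᶻ : ℤ → Fin n
  [ z ]ᶻ = (z %ℕ n) mod n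

  infixl 6 _+ₙ_ _-ₙ_
  infixl 7 _*ₙ_

  _+ₙ_ : Fin n → Fin n → Fin n
  x +ₙ y = [ toℕ x ℕ.+ toℕ y ]

  -ₙ_ : Fin n → Fin n
  -ₙ x = [ n ℕ.∸ toℕ x ]

  _-ₙ_ : Fin n → Fin n → Fin n
  x -ₙ y = x +ₙ (-ₙ y)

  _*ₙ_ : Fin n → Fin n → Fin n
  x *ₙ y = [ toℕ x ℕ.* toℕ y ]

  _^ₙ_ : Fin n → ℕ → Fin n
  g ^ₙ k = iter (_*ₙ g) k [ 1 ]

  IsUnit : Fin n → Set
  IsUnit x = Coprime (toℕ x) n

  IsUnitSubgroup : Subset n → Set
  IsUnitSubgroup H =
    (∀ u → u ∈ H → IsUnit u) ×
    [ 1 ] ∈ H ×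
    (∀ u v → u ∈ H → v ∈ H → (u *ₙ v) ∈ H) ×
    (∀ u → u ∈ H → ∃ λ v → v ∈ H × u *ₙ v ≡ [ 1 ])

  -- action of ([y],[u]) ∈ ℤ_n ⋊ H on ℤ_n : [x] ↦ [(x+y)u]
  aff : Fin n → Fin n → Fin n → Fin n
  aff y u x = (x +ₙ y) *ₙ u

  -- ℤ_n ⋊ H (elements: pairs (y,u), u ∈ H; identity ([0],[1])) is a
  -- Frobenius group: transitive, non-regular, and only the identity
  -- fixes two points.
  IsFrobeniusSemidirect : Subset n → Set
  IsFrobeniusSemidirect H =
    (∀ x z → ∃ λ y → ∃ λ u → u ∈ H × aff y u x ≡ z) ×
    (∃ λ y → ∃ λ u → ∃ λ x → u ∈ H × aff y u x ≡ x × ¬ (y ≡ [ 0 ] × u ≡ [ 1 ])) ×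
    (∀ y u → u ∈ H → ∀ x₁ x₂ → x₁ ≢ x₂ → aff y u x₁ ≡ x₁ → aff y u x₂ ≡ x₂ →
       y ≡ [ 0 ] × u ≡ [ 1 ])

  IsConnectionSet : Subset n → Set
  IsConnectionSet S = [ 0 ] ∉ S × (∀ x → x ∈ S → (-ₙ x) ∈ S)

  data Gen (S : Subset n) : Fin n → Set where
    gen-zero : Gen S [ 0 ]
    gen-mem  : ∀ {x} → x ∈ S → Gen S x
    gen-add  : ∀ {x y} → Gen S x → Gen S y → Gen S (x +ₙ y)
    gen-neg  : ∀ {x} → Gen S x → Gen S (-ₙ x)

  -- ⟨S⟩ = ℤ_n (equivalently Cay(ℤ_n,S) is connected)
  Generates : Subset n → Set
  Generates S = ∀ x → Gen S x

  IsOrbit : Subset n → Subset n → Fin n → Set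
  IsOrbit S H a = ∀ x → (x ∈ S ⇔ (∃ λ u → u ∈ H × x ≡ a *ₙ u))

  IsInvolution : Fin n → Set
  IsInvolution a = a ≢ [ 0 ] × a +ₙ a ≡ [ 0 ]

  IsFirstKindFrobenius : Subset n → Subset n → Set
  IsFirstKindFrobenius S H =
    IsUnitSubgroup H ×
    IsFrobeniusSemidirect H ×
    IsConnectionSet S ×
    Generates S ×
    (∃ λ a → IsOrbit S H a × (2 ∣ ∣ H ∣ ⊎ IsInvolution a))

  IsFirstKindFrobeniusCirculant : Subset n → Set
  IsFirstKindFrobeniusCirculant S = ∃ λ H → IsFirstKindFrobenius S H

  IsAutomorphism : (Fin n → Fin n) → Set
  IsAutomorphism f = Bijective _≡_ _≡_ f × (∀ x y → f (x +ₙ y) ≡ f x +ₙ f y)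

  -- ω is a complete rotation of Cay(ℤ_n,S) (ω assumed an automorphism)
  IsCompleteRotation : (Fin n → Fin n) → Subset n → Set
  IsCompleteRotation ω S =
    (∀ x → x ∈ S → ω x ∈ S) ×
    (∀ t → t ∈ S → ∃ λ x → x ∈ S × ω x ≡ t) ×
    (∃ λ s → s ∈ S × (∀ t → t ∈ S → ∃ λ k → k < ∣ S ∣ × iter ω k s ≡ t))

  IsRotational : Subset n → Set
  IsRotational S = ∃ λ ω → IsAutomorphism ω × IsCompleteRotation ω S

  IsRFFC : ℕ → Subset n → Set
  IsRFFC d S = IsFirstKindFrobeniusCirculant S × IsRotational S × ∣ S ∣ ≡ d

  CayIso : Subset n → Subset n → Set
  CayIso S T = ∃ λ f → Bijective _≡_ _≡_ f ×
    (∀ x y → ((x -ₙ y) ∈ S ⇔ (f x -ₙ f y) ∈ T))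

  ExactlyRFFCClasses : ℕ → ℕ → Set
  ExactlyRFFCClasses d k =
    ∃ λ (Ss : Fin k → Subset n) →
      (∀ i → IsRFFC d (Ss i)) ×
      (∀ i j → i ≢ j → ¬ CayIso (Ss i) (Ss j)) ×
      (∀ S → IsRFFC d S → ∃ λ i → CayIso S (Ss i))

  IsCyclicSubgroupOf : Subset n → Fin n → Set
  IsCyclicSubgroupOf T g = ∀ x → (x ∈ T ⇔ (∃ λ k → x ≡ g ^ₙ k))

-- h = Σ_i (n / q_i) b_i h_i   with q_i = p_i^{e_i}
hSum : ℕ → (l : ℕ) → (q : Fin l → ℕ) → (b hh : Fin l → ℤ) → ℤ
hSum n l q b hh = sumZ l (λ i → + divN n (q i) ℤ.* b i ℤ.* hh i)

ValidHData : ℕ → (l : ℕ) → (q : Fin l → ℕ) → ℕ → (η b hh : Fin l → ℤ) → (m : Fin l → ℕ) → Set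
ValidHData n l q d η b hh m = ∀ i →
  CongZ (q i) (b i ℤ.* + divN n (q i)) (+ 1) ×
  CongZ (q i) (hh i) (η i ℤ.^ divN (m i ℕ.* totient (q i)) d) ×
  Coprime (m i) d

{-# OPTIONS --safe #-}
-- A complete rotation of Cay(Z_n, S) is multiplication by a unit g, and if Cay(Z_n, S) is first-kind
-- Frobenius then S = s⟨g⟩ for a unit s, where g^d = 1 and g^k - 1 is a unit for 0 < k < d = |S|.
-- Modulo each p_i such a g has order exactly d, so d divides p_i - 1 by Fermat; conversely an element
-- of order d modulo p_i has a unique d-th root of unity z_i above it modulo q_i = p_i^e_i, and by the
-- Chinese remainder theorem the admissible g are the tuples (z_i^m_i) with all m_i coprime to d.
-- Each group ⟨g⟩ contains exactly one such tuple with m_1 = 1, which gives φ(d)^(l-1) groups.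
--
-- Different groups H, K give non-isomorphic graphs.  For a prime q, the q-th power of the adjacency
-- operator of Cay(Z_n, S) is congruent modulo q to that of Cay(Z_n, qS), so an isomorphism f from
-- Cay(Z_n, H) to Cay(Z_n, K) also maps Cay(Z_n, mH) to Cay(Z_n, mK) for every m not divisible by n:
-- f(x) - f(y) ∈ (x - y)K for all x, y.  If f(0) = 0 then f(x) = x k(x) with k(x) ∈ K, and k(x) can be
-- read off modulo any prime factor of n not dividing x; comparing 1 and h ∈ H with a point that is
-- 1 modulo q_1 and h modulo another q_i gives k(h) = k(1), hence h ∈ K.
module Submission where

open import Defs
open import Data.Nat as ℕ using (ℕ; zero; suc; _≤_; _<_; _∸_; _^_; NonZero; z≤n; s≤s)
open import Data.Nat.Base using (_!)
open import Data.Nat.Combinatorics using (_C_; nCk≡n!/k![n-k]!; k![n∸k]!∣n!; nCn≡1)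
open import Data.Nat.Coprimality as Coprimality using (Coprime; coprime?)
import Data.Nat.DivMod as ℕ÷
open import Data.Nat.Divisibility as ℕ∣ using (_∣_; divides; _∣?_)
import Data.Nat.GCD as GCD
open import Data.Nat.Induction using (<-rec)
import Data.Nat.ListAction as ListAction
open import Data.Nat.Primality using (Prime; euclidsLemma; prime⇒nonZero; prime⇒nonTrivial; prime⇒irreducible)
open import Data.Nat.Primality.Factorisation using (factorise; PrimeFactorisation)
open import Data.Nat.Properties as ℕₚ using (_!*_!≢0)
open import Data.Integer as ℤ using (ℤ; +_; -[1+_]; _+_; _*_; _-_; -_) renaming (_^_ to _^ᶻ_)
import Data.Integer.DivMod as ℤ÷
import Data.Integer.Divisibility.Signed as Signed
import Data.Integer.Properties as ℤₚ
open import Data.Integer.Tactic.RingSolver using (solve-∀)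
open import Data.Fin as F using (Fin; toℕ; fromℕ<; finToFun; funToFin) renaming (_<_ to _<ᶠ_)
open import Data.Fin.Patterns using (0F)
open import Data.Fin.Permutation using (permutation)
import Data.Fin.Properties as Fₚ
open import Data.Fin.Subset using (Subset; ∣_∣; _∈_; inside; outside)
open import Data.List using (List; _∷_; []; length; filter; upTo; lookup)
import Data.List.Membership.Propositional as List∈
import Data.List.Membership.Propositional.Properties as List∈ₚ
import Data.List.Properties as Listₚ
import Data.List.Relation.Unary.All as All
open import Data.List.Relation.Unary.AllPairs using (AllPairs)
open import Data.List.Relation.Unary.Any using (index)
open import Data.List.Relation.Unary.Any.Properties using (lookup-index)
open import Data.List.Relation.Unary.Unique.Propositional using (Unique)
import Data.List.Relation.Unary.Unique.Propositional.Properties as Uniqueₚ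
open import Data.Vec using (_∷_; []; here; there; tabulate)
import Data.Vec.Properties as Vecₚ
open import Data.Product using (∃; _×_; _,_; proj₁; proj₂)
open import Data.Sum using (_⊎_; inj₁; inj₂)
open import Algebra.Bundles using (Semiring)
import Algebra.Properties.CommutativeMonoid.Mult as CommutativeMonoidMult
import Algebra.Properties.CommutativeMonoid.Sum as CommutativeMonoidSum
import Algebra.Properties.Semiring.Binomial as Binomial
import Algebra.Properties.Semiring.Exp as SemiringExp
import Algebra.Properties.Semiring.Mult as SemiringMult
import Algebra.Properties.Semiring.Sum as SemiringSum
open import Function.Base using (_∘_; id)
open import Function.Bundles using (_⇔_; mk⇔; Equivalence)
open import Relation.Binary.Bundles using (Setoid)
open import Relation.Binary.Definitions using (tri<; tri≈; tri>)
open import Relation.Binary.PropositionalEquality using (_≡_; _≢_; refl; sym; trans; cong; cong₂; subst; subst₂; module ≡-Reasoning)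
import Relation.Binary.Reasoning.Setoid as SetoidReasoning
open import Relation.Nullary using (¬_; yes; no; Dec; does; contradiction)
open import Relation.Nullary.Decidable using (dec-true)
open import Level using (Level)

-- Congruences

-- The multiplier `m` of the rigidity argument is an arbitrary nonzero difference `x - y`, so it may
-- share factors with `n`, and multiplication by it need not be an automorphism of Z_n. What rescues
-- the argument is that differences of distinct elements of H, and of K, are units: `mH` keeps its d
-- elements unless n divides m. Multiplying by the prime factors of `m` one at a time therefore
-- never creates a repeated neighbour, whose multiplicity could vanish modulo the prime.
--
-- Rigidity uses two coprime factors of n. With a single prime all the groups ⟨g⟩ of order d
-- coincide, in agreement with φ(d)^0 = 1.
--
-- The normalisation m_1 = 1 is available because replacing g by g^k multiplies every m_i by k. The
-- counting clause supplies no primitive roots, so elements of order d modulo p are assembled from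
-- prime-power orders and the bound on the number of roots of a polynomial.
--
-- Evenness of d puts -1 among the powers of g, which closes ⟨g⟩ under negation; conversely -1 = g^k
-- makes -2 = g^k - 1 a unit, which is why n is odd.

infix 4 _≈_[mod_] _≈?_[mod_]

-- An explicit quotient, unlike the divisibility in `CongZ`, can be matched against `refl`, which
-- turns each compatibility property into a single ring identity.
record _≈_[mod_] (a b : ℤ) (n : ℕ) : Set where
  constructor mod-by
  field
    quotient : ℤ
    equality : a ≡ b + quotient * + n

≈-reflexive : ∀ {n a b} → a ≡ b → a ≈ b [mod n ]
≈-reflexive {n} {a} refl = mod-by (+ 0) (lem a (+ n))
  where
  lem : ∀ a n → a ≡ a + + 0 * n
  lem = solve-∀

≈-refl : ∀ {n a} → a ≈ a [mod n ]
≈-refl = ≈-reflexive refl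

≈-sym : ∀ {n a b} → a ≈ b [mod n ] → b ≈ a [mod n ]
≈-sym {n} {a} {b} (mod-by q refl) = mod-by (- q) (lem q b (+ n))
  where
  lem : ∀ q b n → b ≡ b + q * n + - q * n
  lem = solve-∀

≈-trans : ∀ {n a b c} → a ≈ b [mod n ] → b ≈ c [mod n ] → a ≈ c [mod n ]
≈-trans {n} {c = c} (mod-by q refl) (mod-by r refl) = mod-by (r + q) (lem q r c (+ n))
  where
  lem : ∀ q r c n → c + r * n + q * n ≡ c + (r + q) * n
  lem = solve-∀

modSetoid : ℕ → Setoid _ _
modSetoid n = record
  { Carrier = ℤ
  ; _≈_ = _≈_[mod n ]
  ; isEquivalence = record { refl = ≈-refl ; sym = ≈-sym ; trans = ≈-trans }
  }

module ≈-Reasoning (n : ℕ) = SetoidReasoning (modSetoid n)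

+-cong : ∀ {n a b c d} → a ≈ b [mod n ] → c ≈ d [mod n ] → a + c ≈ b + d [mod n ]
+-cong {n} {b = b} {d = d} (mod-by q refl) (mod-by r refl) =
  mod-by (q + r) (lem q r b d (+ n))
  where
  lem : ∀ q r b d n → b + q * n + (d + r * n) ≡ b + d + (q + r) * n
  lem = solve-∀

*-cong : ∀ {n a b c d} → a ≈ b [mod n ] → c ≈ d [mod n ] → a * c ≈ b * d [mod n ]
*-cong {n} {b = b} {d = d} (mod-by q refl) (mod-by r refl) =
  mod-by (q * d + b * r + q * r * + n) (lem q r b d (+ n))
  where
  lem : ∀ q r b d n → (b + q * n) * (d + r * n) ≡ b * d + (q * d + b * r + q * r * n) * n
  lem = solve-∀

-‿cong : ∀ {n a b} → a ≈ b [mod n ] → - a ≈ - b [mod n ]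
-‿cong {n} {b = b} (mod-by q refl) = mod-by (- q) (lem q b (+ n))
  where
  lem : ∀ q b n → - (b + q * n) ≡ - b + - q * n
  lem = solve-∀

minus-cong : ∀ {n a b c d} → a ≈ b [mod n ] → c ≈ d [mod n ] → a - c ≈ b - d [mod n ]
minus-cong p q = +-cong p (-‿cong q)

^-cong : ∀ {n a b} k → a ≈ b [mod n ] → a ^ᶻ k ≈ b ^ᶻ k [mod n ]
^-cong zero p = ≈-refl
^-cong (suc k) p = *-cong p (^-cong k p)

≈⇒-≈0 : ∀ {n a b} → a ≈ b [mod n ] → a - b ≈ + 0 [mod n ]
≈⇒-≈0 {n} {b = b} (mod-by q refl) = mod-by q (lem q b (+ n))
  where
  lem : ∀ q b n → b + q * n - b ≡ + 0 + q * n
  lem = solve-∀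

-≈0⇒≈ : ∀ {n a b} → a - b ≈ + 0 [mod n ] → a ≈ b [mod n ]
-≈0⇒≈ {n} {a} {b} (mod-by q eq) = mod-by q (begin
  a                    ≡⟨ lem a b ⟩
  b + (a - b)          ≡⟨ cong (_+_ b) eq ⟩
  b + (+ 0 + q * + n)  ≡⟨ cong (_+_ b) (ℤₚ.+-identityˡ (q * + n)) ⟩
  b + q * + n          ∎)
  where
  open ≡-Reasoning
  lem : ∀ a b → a ≡ b + (a - b)
  lem = solve-∀

≈0⇒∣ : ∀ {n a} → a ≈ + 0 [mod n ] → n ∣ ℤ.∣ a ∣
≈0⇒∣ {n} (mod-by q refl) = Signed.∣⇒∣ᵤ (Signed.divides q (ℤₚ.+-identityˡ (q * + n)))

∣⇒≈0 : ∀ {n a} → n ∣ ℤ.∣ a ∣ → a ≈ + 0 [mod n ]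
∣⇒≈0 {n} {a} n∣a with Signed.∣ᵤ⇒∣ {+ n} {a} n∣a
... | Signed.divides q refl = mod-by q (sym (ℤₚ.+-identityˡ (q * + n)))

CongZ⇒≈ : ∀ {n a b} → CongZ n a b → a ≈ b [mod n ]
CongZ⇒≈ = -≈0⇒≈ ∘ ∣⇒≈0

≈⇒CongZ : ∀ {n a b} → a ≈ b [mod n ] → CongZ n a b
≈⇒CongZ = ≈0⇒∣ ∘ ≈⇒-≈0

_≈?_[mod_] : ∀ a b n → Dec (a ≈ b [mod n ])
a ≈? b [mod n ] with n ∣? ℤ.∣ a - b ∣
... | yes p = yes (CongZ⇒≈ p)
... | no ¬p = no (¬p ∘ ≈⇒CongZ)

≈-weaken : ∀ {m n a b} → m ∣ n → a ≈ b [mod n ] → a ≈ b [mod m ]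
≈-weaken m∣n = CongZ⇒≈ ∘ ℕ∣.∣-trans m∣n ∘ ≈⇒CongZ

n≈0 : ∀ {n} → + n ≈ + 0 [mod n ]
n≈0 = ∣⇒≈0 ℕ∣.∣-refl

*-zeroʳ : ∀ {n b} a → b ≈ + 0 [mod n ] → a * b ≈ + 0 [mod n ]
*-zeroʳ a p = ≈-trans (*-cong (≈-refl {a = a}) p) (≈-reflexive (ℤₚ.*-zeroʳ a))

pos-∣⇒≈0 : ∀ {n k} → n ∣ k → + k ≈ + 0 [mod n ]
pos-∣⇒≈0 = ∣⇒≈0

pos-cong-≤ : ∀ {n a b} → a ≤ b → b < n → + b ≈ + a [mod n ] → b ≡ a
pos-cong-≤ {n} {a} {b} a≤b b<n p with b ∸ a in eq
... | zero  = ℕₚ.≤-antisym (ℕₚ.m∸n≡0⇒m≤n eq) a≤b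
... | suc c = contradiction (ℕₚ.≤-trans (ℕ∣.∣⇒≤ n∣1+c) (subst (_≤ b) eq (ℕₚ.m∸n≤m b a))) (ℕₚ.<⇒≱ b<n)
  where
  n∣1+c : n ∣ suc c
  n∣1+c = subst (n ∣_) (trans (cong ℤ.∣_∣ (trans (ℤₚ.m-n≡m⊖n b a) (ℤₚ.⊖-≥ a≤b))) eq) (≈0⇒∣ (≈⇒-≈0 p))

pos-cong : ∀ {n a b} → + a ≈ + b [mod n ] → a < n → b < n → a ≡ b
pos-cong {a = a} {b} p a<n b<n with ℕₚ.≤-total a b
... | inj₁ a≤b = sym (pos-cong-≤ a≤b b<n (≈-sym p))
... | inj₂ b≤a = pos-cong-≤ b≤a a<n p

^-distribˡ-* : ∀ a b k → (a * b) ^ᶻ k ≡ a ^ᶻ k * b ^ᶻ k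
^-distribˡ-* a b zero = refl
^-distribˡ-* a b (suc k) = trans (cong (a * b *_) (^-distribˡ-* a b k)) (lem a b (a ^ᶻ k) (b ^ᶻ k))
  where
  lem : ∀ a b c d → a * b * (c * d) ≡ a * c * (b * d)
  lem = solve-∀

Invertible : ℕ → ℤ → Set
Invertible n a = ∃ λ b → b * a ≈ + 1 [mod n ]

*-cancelˡ-≈ : ∀ {n a b c} → Invertible n a → a * b ≈ a * c [mod n ] → b ≈ c [mod n ]
*-cancelˡ-≈ {n} {a} {b} {c} (u , ua≈1) ab≈ac = begin
  b            ≡⟨ sym (ℤₚ.*-identityˡ b) ⟩
  + 1 * b      ≈⟨ *-cong (≈-sym ua≈1) ≈-refl ⟩
  u * a * b    ≡⟨ ℤₚ.*-assoc u a b ⟩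
  u * (a * b)  ≈⟨ *-cong (≈-refl {a = u}) ab≈ac ⟩
  u * (a * c)  ≡⟨ sym (ℤₚ.*-assoc u a c) ⟩
  u * a * c    ≈⟨ *-cong ua≈1 ≈-refl ⟩
  + 1 * c      ≡⟨ ℤₚ.*-identityˡ c ⟩
  c            ∎
  where open ≈-Reasoning n

invertible-resp : ∀ {n a b} → a ≈ b [mod n ] → Invertible n a → Invertible n b
invertible-resp p (u , q) = u , ≈-trans (*-cong (≈-refl {a = u}) (≈-sym p)) q

invertible-1 : ∀ {n} → Invertible n (+ 1)
invertible-1 = + 1 , ≈-refl

invertible-* : ∀ {n a b} → Invertible n a → Invertible n b → Invertible n (a * b)
invertible-* {n} {a} {b} (u , p) (v , q) =
  u * v , ≈-trans (≈-reflexive (lem u v a b)) (*-cong p q)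
  where
  lem : ∀ u v a b → u * v * (a * b) ≡ u * a * (v * b)
  lem = solve-∀

invertible-^ : ∀ {n a} k → Invertible n a → Invertible n (a ^ᶻ k)
invertible-^ zero i = invertible-1
invertible-^ (suc k) i = invertible-* i (invertible-^ k i)

invertible-factorˡ : ∀ {n} a b → Invertible n (a * b) → Invertible n a
invertible-factorˡ {n} a b (u , p) = u * b , ≈-trans (≈-reflexive (lem u a b)) p
  where
  lem : ∀ u a b → u * b * a ≡ u * (a * b)
  lem = solve-∀

^≈1⇒invertible : ∀ {n a} k → 0 < k → a ^ᶻ k ≈ + 1 [mod n ] → Invertible n a
^≈1⇒invertible {a = a} (suc k) _ p =
  invertible-factorˡ a (a ^ᶻ k) (invertible-resp (≈-sym p) invertible-1)

coprime⇒invertible-pos : ∀ {m n} → Coprime m n → Invertible n (+ m)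
coprime⇒invertible-pos {m} {n} c with Coprimality.coprime-Bézout c
... | GCD.Bézout.+- x y eq = + x , mod-by (+ y)
  (trans (sym (ℤₚ.pos-* x m)) (trans (cong +_ (sym eq)) (trans (ℤₚ.pos-+ 1 (y ℕ.* n)) (cong (_+_ (+ 1)) (ℤₚ.pos-* y n)))))
... | GCD.Bézout.-+ x y eq = - (+ x) , mod-by (- (+ y))
  (begin
    - (+ x) * + m                          ≡⟨ lem (+ x) (+ m) ⟩
    + 1 - (+ 1 + + x * + m)                ≡⟨ cong (λ t → + 1 - t) (sym (trans (ℤₚ.pos-+ 1 (x ℕ.* m)) (cong (_+_ (+ 1)) (ℤₚ.pos-* x m)))) ⟩
    + 1 - + (1 ℕ.+ x ℕ.* m)                ≡⟨ cong (λ t → + 1 - + t) eq ⟩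
    + 1 - + (y ℕ.* n)                      ≡⟨ cong (λ t → + 1 - t) (ℤₚ.pos-* y n) ⟩
    + 1 - + y * + n                        ≡⟨ cong (_+_ (+ 1)) (ℤₚ.neg-distribˡ-* (+ y) (+ n)) ⟩
    + 1 + - (+ y) * + n                    ∎)
  where
  open ≡-Reasoning
  lem : ∀ x m → - x * m ≡ + 1 - (+ 1 + x * m)
  lem = solve-∀

coprime⇒invertible : ∀ {n} a → Coprime ℤ.∣ a ∣ n → Invertible n a
coprime⇒invertible (+ m) c = coprime⇒invertible-pos c
coprime⇒invertible {n} -[1+ m ] c with coprime⇒invertible-pos {suc m} c
... | u , p = - u , ≈-trans (≈-reflexive (lem u (+ suc m))) p
  where
  lem : ∀ u a → - u * - a ≡ u * a
  lem = solve-∀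

invertible⇒coprime : ∀ {n} a → Invertible n a → Coprime ℤ.∣ a ∣ n
invertible⇒coprime {n} a (u , p) {c} (c∣a , c∣n) = ℕ∣.∣1⇒≡1 (≈0⇒∣ (begin
  + 1     ≈⟨ ≈-weaken c∣n (≈-sym p) ⟩
  u * a   ≈⟨ *-zeroʳ u (∣⇒≈0 c∣a) ⟩
  + 0     ∎))
  where open ≈-Reasoning c

invertible-weaken : ∀ {m n a} → m ∣ n → Invertible n a → Invertible m a
invertible-weaken m∣n (u , p) = u , ≈-weaken m∣n p

coprime-*ʳ : ∀ {a m n} → Coprime a m → Coprime a n → Coprime a (m ℕ.* n)
coprime-*ʳ {a} {m} {n} c₁ c₂ {d} (d∣a , d∣mn) =
  c₂ (d∣a , Coprimality.coprime-divisor (λ {e} (e∣d , e∣m) → c₁ (ℕ∣.∣-trans e∣d d∣a , e∣m)) d∣mn)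

coprime-^ʳ : ∀ {a m} k → Coprime a m → Coprime a (m ^ k)
coprime-^ʳ zero c (_ , d∣1) = ℕ∣.∣1⇒≡1 d∣1
coprime-^ʳ (suc k) c = coprime-*ʳ c (coprime-^ʳ k c)

prime∤⇒coprime : ∀ {p} → Prime p → ∀ {a} → ¬ p ∣ a → Coprime a p
prime∤⇒coprime pp p∤a {d} (d∣a , d∣p) with prime⇒irreducible pp d∣p
... | inj₁ d≡1 = d≡1
... | inj₂ refl = contradiction d∣a p∤a

≈-crt : ∀ {m n a b} → Coprime m n → a ≈ b [mod m ] → a ≈ b [mod n ] → a ≈ b [mod m ℕ.* n ]
≈-crt {m} {n} {a} {b} c p q with ≈⇒CongZ p
... | divides k eq = CongZ⇒≈ (divides j (trans eq (trans (cong (ℕ._* m) k≡jn) (trans (ℕₚ.*-assoc j n m) (cong (j ℕ.*_) (ℕₚ.*-comm n m))))))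
  where
  n∣k : n ∣ k
  n∣k = Coprimality.coprime-divisor (Coprimality.sym c) (subst (n ∣_) (trans eq (ℕₚ.*-comm k m)) (≈⇒CongZ q))
  j = ℕ∣.quotient n∣k
  k≡jn : k ≡ j ℕ.* n
  k≡jn = ℕ∣._∣_.equality n∣k

-- The Frobenius congruence and Fermat's theorem

prime∤! : ∀ {p} → Prime p → ∀ {k} → k < p → ¬ p ∣ k !
prime∤! pp {zero} _ p∣1 = ℕₚ.<⇒≢ (ℕ.nonTrivial⇒n>1 _ {{prime⇒nonTrivial pp}}) (sym (ℕ∣.∣1⇒≡1 p∣1))
prime∤! pp {suc k} k<p p∣ with euclidsLemma (suc k) (k !) pp p∣
... | inj₁ p∣1+k = ℕₚ.<⇒≱ k<p (ℕ∣.∣⇒≤ p∣1+k)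
... | inj₂ p∣k!  = prime∤! pp (ℕₚ.<-trans (ℕₚ.n<1+n k) k<p) p∣k!

prime∣C : ∀ {p} → Prime p → ∀ {k} → 0 < k → k < p → p ∣ p C k
prime∣C {p@(suc p-1)} pp {k} 0<k k<p with euclidsLemma (p C k) (k ! ℕ.* (p ∸ k) !) pp p∣product
  where
  instance _ = k !* (p ∸ k) !≢0
  p∣product : p ∣ (p C k) ℕ.* (k ! ℕ.* (p ∸ k) !)
  p∣product = subst (p ∣_)
    (trans (sym (ℕ÷.m/n*n≡m (k![n∸k]!∣n! (ℕₚ.<⇒≤ k<p))))
           (cong (ℕ._* (k ! ℕ.* (p ∸ k) !)) (sym (nCk≡n!/k![n-k]! (ℕₚ.<⇒≤ k<p)))))
    (ℕ∣.m∣m*n (p-1 !))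
... | inj₁ p∣C = p∣C
... | inj₂ p∣k!*[p∸k]! with euclidsLemma (k !) ((p ∸ k) !) pp p∣k!*[p∸k]!
...   | inj₁ p∣k!     = contradiction p∣k! (prime∤! pp k<p)
...   | inj₂ p∣[p∸k]! = contradiction p∣[p∸k]! (prime∤! pp (ℕₚ.∸-monoʳ-< 0<k (ℕₚ.<⇒≤ k<p)))

-- Stated for commuting elements of any semiring because it has two uses: in ℤ it gives Fermat's
-- theorem, and in the semiring of operators on functions on Z_n it gives the congruence between
-- adjacency operators.
module Frobenius {a ℓ} (S : Semiring a ℓ) where
  open Semiring S using (setoid; Carrier; 0#; 1#; +-congˡ; +-congʳ; +-assoc; +-identityʳ; *-identityˡ; *-identityʳ; *-congˡ; reflexive)
    renaming (_+_ to _⊕_; _*_ to _⊗_; _≈_ to _≋_; refl to ≋-refl; sym to ≋-sym; trans to ≋-trans; +-cong to ⊕-cong; +-comm to ⊕-comm)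
  open SemiringSum S using (sum; sum-cong-≋; sum-init-last)
  open SemiringMult S using (×-homo-1; ×-congʳ; ×-assocˡ; ×-congˡ) renaming (_×_ to _·_)
  open SemiringExp S using () renaming (_^_ to _^ˢ_)
  open CommutativeMonoidMult (Semiring.+-commutativeMonoid S) using (×-distrib-+)
  open SetoidReasoning setoid

  sum-multiple : ∀ p {n} (t : Fin n → Carrier) → (∀ k → ∃ λ w → t k ≋ p · w) → ∃ λ w → sum t ≋ p · w
  sum-multiple p {zero} t mult = 0# , ≋-sym (p·0 p)
    where
    p·0 : ∀ p → p · 0# ≋ 0#
    p·0 zero = ≋-refl
    p·0 (suc p) = ≋-trans (+-congˡ (p·0 p)) (+-identityʳ 0#)
  sum-multiple p {suc n} t mult with mult 0F | sum-multiple p (t ∘ F.suc) (mult ∘ F.suc)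
  ... | w , eq | v , eq′ = w ⊕ v , ≋-trans (⊕-cong eq eq′) (≋-sym (×-distrib-+ w v p))

  -- The binomial coefficients strictly between the two ends are divisible by p.
  ^-+-prime : ∀ {p} → Prime p → ∀ x y → x ⊗ y ≋ y ⊗ x →
              ∃ λ w → (x ⊕ y) ^ˢ p ≋ (x ^ˢ p ⊕ y ^ˢ p) ⊕ p · w
  ^-+-prime {p@(suc p-1)} pp x y comm with sum-multiple p (λ k → term (F.suc (F.inject₁ k))) mult
    where
    term = Binomial.binomialTerm S x y p
    mult : ∀ k → ∃ λ w → term (F.suc (F.inject₁ k)) ≋ p · w
    mult k with prime∣C pp {suc (toℕ (F.inject₁ k))} (s≤s z≤n)
                  (s≤s (subst (_< p-1) (sym (Fₚ.toℕ-inject₁ k)) (Fₚ.toℕ<n k)))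
    ... | divides q eq = q · b , ≋-trans (×-congˡ (trans eq (ℕₚ.*-comm q p))) (≋-sym (×-assocˡ b p q))
      where b = Binomial.binomial S x y p (F.suc (F.inject₁ k))
  ... | w , eq = w , (begin
    (x ⊕ y) ^ˢ p
      ≈⟨ Binomial.theorem S x y comm p ⟩
    term 0F ⊕ sum (term ∘ F.suc)
      ≈⟨ +-congˡ (sum-init-last (term ∘ F.suc)) ⟩
    term 0F ⊕ (sum (λ k → term (F.suc (F.inject₁ k))) ⊕ term (F.fromℕ p))
      ≈⟨ ⊕-cong first (⊕-cong eq last) ⟩
    y ^ˢ p ⊕ (p · w ⊕ x ^ˢ p)
      ≈⟨ +-congˡ (⊕-comm (p · w) (x ^ˢ p)) ⟩
    y ^ˢ p ⊕ (x ^ˢ p ⊕ p · w)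
      ≈⟨ ≋-sym (+-assoc _ _ _) ⟩
    (y ^ˢ p ⊕ x ^ˢ p) ⊕ p · w
      ≈⟨ +-congʳ (⊕-comm _ _) ⟩
    (x ^ˢ p ⊕ y ^ˢ p) ⊕ p · w ∎)
    where
    term = Binomial.binomialTerm S x y p
    first : term 0F ≋ y ^ˢ p
    first = ≋-trans (×-homo-1 _) (*-identityˡ _)
    last : term (F.fromℕ p) ≋ x ^ˢ p
    last = last′ (Fₚ.toℕ-fromℕ p)
      where
      last′ : ∀ {k} → k ≡ p → (p C k) · (x ^ˢ k ⊗ y ^ˢ (p ∸ k)) ≋ x ^ˢ p
      last′ refl = ≋-trans (×-congˡ (nCn≡1 p)) (≋-trans (×-homo-1 _)
        (≋-trans (*-congˡ (reflexive (cong (y ^ˢ_) (ℕₚ.n∸n≡0 p)))) (*-identityʳ _)))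

fermat-ℕ : ∀ {p} → Prime p → ∀ a → (+ a) ^ᶻ p ≈ + a [mod p ]
fermat-ℕ {suc p-1} pp zero = ≈-reflexive (ℤₚ.*-zeroˡ ((+ 0) ^ᶻ p-1))
fermat-ℕ {p} pp (suc a) with Frobenius.^-+-prime ℤₚ.+-*-semiring pp (+ 1) (+ a) (ℤₚ.*-comm (+ 1) (+ a))
... | w , eq = begin
  (+ suc a) ^ᶻ p                   ≡⟨ ^ᶻ-exp (+ suc a) p ⟩
  (+ 1 + + a) ^ˢ p                 ≡⟨ eq ⟩
  (+ 1) ^ˢ p + (+ a) ^ˢ p + p · w  ≡⟨ cong₂ _+_ (cong₂ _+_ (sym (^ᶻ-exp (+ 1) p)) (sym (^ᶻ-exp (+ a) p))) (·-* p w) ⟩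
  (+ 1) ^ᶻ p + (+ a) ^ᶻ p + + p * w  ≈⟨ +-cong (+-cong (≈-reflexive (ℤₚ.^-zeroˡ p)) (fermat-ℕ pp a)) (*-cong n≈0 ≈-refl) ⟩
  + 1 + + a + + 0 * w              ≡⟨ cong (_+_ (+ suc a)) (ℤₚ.*-zeroˡ w) ⟩
  + suc a + + 0                    ≡⟨ ℤₚ.+-identityʳ _ ⟩
  + suc a                          ∎
  where
  open ≈-Reasoning p
  open SemiringExp ℤₚ.+-*-semiring using () renaming (_^_ to _^ˢ_)
  open SemiringMult ℤₚ.+-*-semiring using () renaming (_×_ to _·_)
  ^ᶻ-exp : ∀ a k → a ^ᶻ k ≡ a ^ˢ k
  ^ᶻ-exp a zero = refl
  ^ᶻ-exp a (suc k) = cong (a *_) (^ᶻ-exp a k)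
  ·-* : ∀ k w → k · w ≡ + k * w
  ·-* zero w = sym (ℤₚ.*-zeroˡ w)
  ·-* (suc k) w = trans (cong (_+_ w) (·-* k w)) (lem w (+ k))
    where
    lem : ∀ w k → w + k * w ≡ (+ 1 + k) * w
    lem = solve-∀

residue : ∀ n .{{_ : NonZero n}} a → ∃ λ r → r < n × a ≈ + r [mod n ]
residue n a = a ℤ.%ℕ n , ℤ÷.n%ℕd<d a n , mod-by (a ℤ./ℕ n) (ℤ÷.a≡a%ℕn+[a/ℕn]*n a n)

fermat : ∀ {p} → Prime p → ∀ a → a ^ᶻ p ≈ a [mod p ]
fermat {p} pp a with residue p {{prime⇒nonZero pp}} a
... | r , _ , a≈r = ≈-trans (^-cong p a≈r) (≈-trans (fermat-ℕ pp r) (≈-sym a≈r))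

prime∤⇒invertible : ∀ {p} → Prime p → ∀ {a} → ¬ a ≈ + 0 [mod p ] → Invertible p a
prime∤⇒invertible pp {a} a≉0 = coprime⇒invertible a (prime∤⇒coprime pp (a≉0 ∘ ∣⇒≈0))

fermat-unit : ∀ {p} → Prime p → ∀ {a} → ¬ a ≈ + 0 [mod p ] → a ^ᶻ (p ∸ 1) ≈ + 1 [mod p ]
fermat-unit {suc p-1} pp {a} a≉0 =
  *-cancelˡ-≈ (prime∤⇒invertible pp a≉0) (≈-trans (fermat pp a) (≈-reflexive (sym (ℤₚ.*-identityʳ a))))

≈0-product : ∀ {p} → Prime p → ∀ a b → a * b ≈ + 0 [mod p ] → a ≈ + 0 [mod p ] ⊎ b ≈ + 0 [mod p ]
≈0-product {p} pp a b ab≈0 with euclidsLemma ℤ.∣ a ∣ ℤ.∣ b ∣ pp (subst (p ∣_) (ℤₚ.abs-* a b) (≈0⇒∣ ab≈0))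
... | inj₁ p∣a = inj₁ (∣⇒≈0 p∣a)
... | inj₂ p∣b = inj₂ (∣⇒≈0 p∣b)

-- The sum of `a^(m-1-i) b^i` over `i < m`, the cofactor of `a - b` in `a^m - b^m`.
geometric : ℕ → ℤ → ℤ → ℤ
geometric zero    a b = + 0
geometric (suc m) a b = a ^ᶻ m + b * geometric m a b

^-difference : ∀ m a b → a ^ᶻ m - b ^ᶻ m ≡ (a - b) * geometric m a b
^-difference zero a b = sym (ℤₚ.*-zeroʳ (a - b))
^-difference (suc m) a b = begin
  a * A - b * B                            ≡⟨ lem₁ a b A B ⟩
  (a - b) * A + b * (A - B)                ≡⟨ cong (λ t → (a - b) * A + b * t) (^-difference m a b) ⟩
  (a - b) * A + b * ((a - b) * geometric m a b)  ≡⟨ lem₂ a b A (geometric m a b) ⟩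
  (a - b) * (A + b * geometric m a b)      ∎
  where
  open ≡-Reasoning
  A = a ^ᶻ m
  B = b ^ᶻ m
  lem₁ : ∀ a b A B → a * A - b * B ≡ (a - b) * A + b * (A - B)
  lem₁ = solve-∀
  lem₂ : ∀ a b A G → (a - b) * A + b * ((a - b) * G) ≡ (a - b) * (A + b * G)
  lem₂ = solve-∀

geometric-≈ : ∀ {n a b} m → a ≈ b [mod n ] → geometric (suc m) a b ≈ + suc m * a ^ᶻ m [mod n ]
geometric-≈ {b = b} zero p = ≈-reflexive (lem b)
  where
  lem : ∀ b → + 1 + b * + 0 ≡ + 1 * + 1
  lem = solve-∀
geometric-≈ {n} {a} {b} (suc m) p = begin
  a ^ᶻ suc m + b * geometric (suc m) a b  ≈⟨ +-cong (≈-refl {a = a ^ᶻ suc m}) (*-cong (≈-sym p) (geometric-≈ m p)) ⟩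
  a * a ^ᶻ m + a * (+ suc m * a ^ᶻ m)     ≡⟨ lem a (a ^ᶻ m) (+ suc m) ⟩
  (+ 1 + + suc m) * (a * a ^ᶻ m)          ∎
  where
  open ≈-Reasoning n
  lem : ∀ a A m → a * A + a * (m * A) ≡ (+ 1 + m) * (a * A)
  lem = solve-∀

*-≈0 : ∀ {m n a b} → a ≈ + 0 [mod m ] → b ≈ + 0 [mod n ] → a * b ≈ + 0 [mod m ℕ.* n ]
*-≈0 {m} {n} (mod-by q refl) (mod-by r refl) =
  mod-by (q * r) (trans (lem q r (+ m) (+ n)) (cong (λ t → + 0 + q * r * t) (sym (ℤₚ.pos-* m n))))
  where
  lem : ∀ q r m n → (+ 0 + q * m) * (+ 0 + r * n) ≡ + 0 + q * r * (m * n)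
  lem = solve-∀

-- Every further p-th power gains one factor `p`: if `A ≡ B` modulo `p`, the cofactor of `A - B` in
-- `A^p - B^p` is congruent to `p A^(p-1)`, hence to 0, modulo `p`.
^-lift : ∀ {p} k {a b} → a ≈ b [mod p ] → a ^ᶻ (p ^ k) ≈ b ^ᶻ (p ^ k) [mod p ^ suc k ]
^-lift {p} zero {a} {b} a≈b = subst₂ (λ x y → x ≈ y [mod p ^ 1 ])
  (sym (ℤₚ.^-identityʳ a)) (sym (ℤₚ.^-identityʳ b))
  (subst (a ≈ b [mod_]) (sym (ℕₚ.*-identityʳ p)) a≈b)
-- `p` is arbitrary here; for `p = 0` the exponent `p ^ suc k` is 0 on both sides.
^-lift {zero} (suc k) a≈b = ≈-refl
^-lift {p@(suc p-1)} (suc k) {a} {b} a≈b = -≈0⇒≈ (begin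
  a ^ᶻ (p ^ suc k) - b ^ᶻ (p ^ suc k)  ≡⟨ cong₂ _-_ (pow a) (pow b) ⟩
  A ^ᶻ p - B ^ᶻ p                      ≡⟨ ^-difference p A B ⟩
  (A - B) * geometric p A B            ≡⟨ ℤₚ.*-comm (A - B) _ ⟩
  geometric p A B * (A - B)            ≈⟨ *-≈0 g≈0 (≈⇒-≈0 (^-lift k a≈b)) ⟩
  + 0                                  ∎)
  where
  open ≈-Reasoning (p ^ suc (suc k))
  A = a ^ᶻ (p ^ k)
  B = b ^ᶻ (p ^ k)
  pow : ∀ x → x ^ᶻ (p ^ suc k) ≡ (x ^ᶻ (p ^ k)) ^ᶻ p
  pow x = trans (cong (x ^ᶻ_) (ℕₚ.*-comm p (p ^ k))) (sym (ℤₚ.^-*-assoc x (p ^ k) p))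
  g≈0 : geometric p A B ≈ + 0 [mod p ]
  g≈0 = ≈-trans (geometric-≈ p-1 (^-cong (p ^ k) a≈b))
                (≈-trans (*-cong n≈0 ≈-refl) (≈-reflexive (ℤₚ.*-zeroˡ (A ^ᶻ p-1))))

-- Roots modulo a prime and orders of units

-- f is a monic polynomial function of the given degree, presented by Horner's scheme.
data Monic : ℕ → (ℤ → ℤ) → Set where
  constant : ∀ {f} → (∀ x → f x ≡ + 1) → Monic 0 f
  horner   : ∀ {m f g} c → Monic m g → (∀ x → f x ≡ c + x * g x) → Monic (suc m) f

monic-^-1 : ∀ m → Monic (suc m) (λ x → x ^ᶻ suc m - + 1)
monic-^-1 m = horner (- (+ 1)) (power m) (λ x → ℤₚ.+-comm (x * x ^ᶻ m) (- (+ 1)))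
  where
  power : ∀ m → Monic m (_^ᶻ m)
  power zero = constant (λ _ → refl)
  power (suc m) = horner (+ 0) (power m) (λ x → sym (ℤₚ.+-identityˡ (x * x ^ᶻ m)))

monic-+-* : ∀ {m f g} a → Monic (suc m) f → Monic m g → Monic (suc m) (λ x → f x + a * g x)
monic-+-* a (horner c (constant h≡1) f≡) (constant g≡1) =
  horner (c + a) (constant (λ _ → refl)) λ x →
    trans (cong₂ (λ s t → s + a * t) (trans (f≡ x) (cong (λ t → c + x * t) (h≡1 x))) (g≡1 x)) (lem c x a)
  where
  lem : ∀ c x a → c + x * + 1 + a * + 1 ≡ c + a + x * + 1
  lem = solve-∀
monic-+-* a (horner {g = f′} c hf@(horner _ _ _) f≡) (horner {g = g′} c′ hg g≡) =
  horner (c + a * c′) (monic-+-* a hf hg) λ x →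
    trans (cong₂ (λ s t → s + a * t) (f≡ x) (g≡ x)) (lem c x a c′ (f′ x) (g′ x))
  where
  lem : ∀ c x a c′ f g → c + x * f + a * (c′ + x * g) ≡ c + a * c′ + x * (f + a * g)
  lem = solve-∀

-- Synthetic division. With `f = c + x g`, the difference `f x - f a` is
-- `(x - a) g x + a (g x - g a)`; dividing the last bracket by induction gives the quotient
-- `g + a h`. The degree of `h` is below that of `g`, so `monic-+-*` keeps the sum monic.
monic-quotient : ∀ {m f} → Monic (suc m) f → ∀ a →
                 ∃ λ g → Monic m g × (∀ x → f x - f a ≡ (x - a) * g x)
monic-quotient {f = f} (horner {g = g} c hg@(constant g≡1) f≡) a = g , hg , λ x → begin
  f x - f a                      ≡⟨ cong₂ _-_ (f≡ x) (f≡ a) ⟩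
  c + x * g x - (c + a * g a)    ≡⟨ cong (λ t → c + x * g x - (c + a * t)) (trans (g≡1 a) (sym (g≡1 x))) ⟩
  c + x * g x - (c + a * g x)    ≡⟨ lem c x a (g x) ⟩
  (x - a) * g x                  ∎
  where
  open ≡-Reasoning
  lem : ∀ c x a g → c + x * g - (c + a * g) ≡ (x - a) * g
  lem = solve-∀
monic-quotient {f = f} (horner {g = g} c hg@(horner _ _ _) f≡) a with monic-quotient hg a
... | h , hh , g≡ = (λ x → g x + a * h x) , monic-+-* a hg hh , λ x → begin
  f x - f a                                ≡⟨ cong₂ _-_ (f≡ x) (f≡ a) ⟩
  c + x * g x - (c + a * g a)              ≡⟨ lem₁ c x a (g x) (g a) ⟩
  (x - a) * g x + a * (g x - g a)          ≡⟨ cong (λ t → (x - a) * g x + a * t) (g≡ x) ⟩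
  (x - a) * g x + a * ((x - a) * h x)      ≡⟨ lem₂ x a (g x) (h x) ⟩
  (x - a) * (g x + a * h x)                ∎
  where
  open ≡-Reasoning
  lem₁ : ∀ c x a g g′ → c + x * g - (c + a * g′) ≡ (x - a) * g + a * (g - g′)
  lem₁ = solve-∀
  lem₂ : ∀ x a g h → (x - a) * g + a * ((x - a) * h) ≡ (x - a) * (g + a * h)
  lem₂ = solve-∀

-- Lagrange's bound: divide out the first root; at every other root the factor `x - r 0F` is nonzero
-- modulo `p`, so the quotient vanishes there. At degree 0 the function is the constant 1, which has
-- no root.
monic-roots : ∀ {p} → Prime p → ∀ {m f} → Monic m f → (r : Fin (suc m) → ℤ) →
              (∀ i j → r i ≈ r j [mod p ] → i ≡ j) → ¬ (∀ i → f (r i) ≈ + 0 [mod p ])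
monic-roots pp (constant f≡1) r r-inj root =
  ℕₚ.<⇒≢ (ℕ.nonTrivial⇒n>1 _ {{prime⇒nonTrivial pp}})
    (sym (ℕ∣.∣1⇒≡1 (≈0⇒∣ (≈-trans (≈-reflexive (sym (f≡1 (r 0F)))) (root 0F)))))
monic-roots {p} pp {suc m} {f} hf@(horner _ _ _) r r-inj root with monic-quotient hf (r 0F)
... | g , hg , f≡ = monic-roots pp hg (r ∘ F.suc) (λ i j eq → Fₚ.suc-injective (r-inj _ _ eq)) g-root
  where
  g-root : ∀ i → g (r (F.suc i)) ≈ + 0 [mod p ]
  g-root i with ≈0-product pp (r (F.suc i) - r 0F) (g (r (F.suc i)))
                  (≈-trans (≈-reflexive (sym (f≡ _))) (≈⇒-≈0 (≈-trans (root _) (≈-sym (root _)))))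
  ... | inj₁ eq = contradiction (r-inj _ _ (-≈0⇒≈ eq)) λ ()
  ... | inj₂ eq = eq

-- Divisibility in place of minimality, because orders get combined through gcds and coprime
-- factors; `hasOrder` and `hasOrder-minimal` convert.
HasOrder : ℕ → ℤ → ℕ → Set
HasOrder n a d = a ^ᶻ d ≈ + 1 [mod n ] × (∀ k → a ^ᶻ k ≈ + 1 [mod n ] → d ∣ k)

^-*≈1 : ∀ {n a} j k → a ^ᶻ j ≈ + 1 [mod n ] → a ^ᶻ (j ℕ.* k) ≈ + 1 [mod n ]
^-*≈1 {a = a} j k a^j≈1 = ≈-trans (≈-reflexive (sym (ℤₚ.^-*-assoc a j k)))
  (≈-trans (^-cong k a^j≈1) (≈-reflexive (ℤₚ.^-zeroˡ k)))

^-*≈1ʳ : ∀ {n a} j k → a ^ᶻ j ≈ + 1 [mod n ] → a ^ᶻ (k ℕ.* j) ≈ + 1 [mod n ]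
^-*≈1ʳ {n} {a} j k a^j≈1 = subst (λ t → a ^ᶻ t ≈ + 1 [mod n ]) (ℕₚ.*-comm j k) (^-*≈1 j k a^j≈1)

^-∣≈1 : ∀ {n a j k} → j ∣ k → a ^ᶻ j ≈ + 1 [mod n ] → a ^ᶻ k ≈ + 1 [mod n ]
^-∣≈1 {j = j} (divides q refl) = ^-*≈1ʳ j q

^-+-cancel : ∀ {n a} j k → a ^ᶻ k ≈ + 1 [mod n ] → a ^ᶻ (j ℕ.+ k) ≈ a ^ᶻ j [mod n ]
^-+-cancel {n} {a} j k a^k≈1 = begin
  a ^ᶻ (j ℕ.+ k)      ≡⟨ ℤₚ.^-distribˡ-+-* a j k ⟩
  a ^ᶻ j * a ^ᶻ k     ≈⟨ *-cong (≈-refl {a = a ^ᶻ j}) a^k≈1 ⟩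
  a ^ᶻ j * + 1        ≡⟨ ℤₚ.*-identityʳ _ ⟩
  a ^ᶻ j              ∎
  where open ≈-Reasoning n

-- By Bézout's identity over ℕ some multiple of one exponent exceeds a multiple of the other by the
-- gcd, so no negative powers of `a` occur.
^-gcd≈1 : ∀ {n a} j k → a ^ᶻ j ≈ + 1 [mod n ] → a ^ᶻ k ≈ + 1 [mod n ] → a ^ᶻ GCD.gcd j k ≈ + 1 [mod n ]
^-gcd≈1 {n} {a} j k a^j≈1 a^k≈1 with GCD.Bézout.identity (GCD.gcd-GCD j k)
... | GCD.Bézout.+- x y eq = ≈-trans (≈-sym (^-+-cancel (GCD.gcd j k) (y ℕ.* k) (^-*≈1ʳ k y a^k≈1)))
  (subst (λ t → a ^ᶻ t ≈ + 1 [mod n ]) (sym eq) (^-*≈1ʳ j x a^j≈1))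
... | GCD.Bézout.-+ x y eq = ≈-trans (≈-sym (^-+-cancel (GCD.gcd j k) (x ℕ.* j) (^-*≈1ʳ j x a^j≈1)))
  (subst (λ t → a ^ᶻ t ≈ + 1 [mod n ]) (sym eq) (^-*≈1ʳ k y a^k≈1))

^-% : ∀ {n a} d .{{_ : NonZero d}} → a ^ᶻ d ≈ + 1 [mod n ] → ∀ k → a ^ᶻ k ≈ a ^ᶻ (k ℕ.% d) [mod n ]
^-% {n} {a} d a^d≈1 k = subst (λ t → a ^ᶻ t ≈ a ^ᶻ (k ℕ.% d) [mod n ]) (sym (ℕ÷.m≡m%n+[m/n]*n k d))
  (^-+-cancel (k ℕ.% d) (k ℕ./ d ℕ.* d) (^-*≈1ʳ d (k ℕ./ d) a^d≈1))

hasOrder : ∀ {n a} d → 0 < d → a ^ᶻ d ≈ + 1 [mod n ] →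
           (∀ k → 0 < k → k < d → ¬ a ^ᶻ k ≈ + 1 [mod n ]) → HasOrder n a d
hasOrder {n} {a} d@(suc _) 0<d a^d≈1 minimal = a^d≈1 , λ k a^k≈1 → ℕ∣.m%n≡0⇒n∣m k d (zero-remainder k a^k≈1)
  where
  zero-remainder : ∀ k → a ^ᶻ k ≈ + 1 [mod n ] → k ℕ.% d ≡ 0
  zero-remainder k a^k≈1 with k ℕ.% d in eq
  ... | zero  = refl
  ... | suc r = contradiction
    (subst (λ t → a ^ᶻ t ≈ + 1 [mod n ]) eq (≈-trans (≈-sym (^-% d a^d≈1 k)) a^k≈1))
    (minimal (suc r) (s≤s z≤n) (subst (_< d) eq (ℕ÷.m%n<n k d)))

hasOrder-minimal : ∀ {n a d} → HasOrder n a d → ∀ k → 0 < k → k < d → ¬ a ^ᶻ k ≈ + 1 [mod n ]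
hasOrder-minimal (_ , order) k@(suc _) _ k<d a^k≈1 = ℕₚ.<⇒≱ k<d (ℕ∣.∣⇒≤ (order k a^k≈1))

hasOrder-resp : ∀ {n a b d} → a ≈ b [mod n ] → HasOrder n a d → HasOrder n b d
hasOrder-resp {d = d} a≈b (a^d≈1 , order) =
  ≈-trans (^-cong d (≈-sym a≈b)) a^d≈1 , λ k b^k≈1 → order k (≈-trans (^-cong k a≈b) b^k≈1)

coprime-*-∣ : ∀ {a b k} → Coprime a b → a ∣ k → b ∣ k → a ℕ.* b ∣ k
coprime-*-∣ {a} {b} c (divides q refl) b∣qa
  with Coprimality.coprime-divisor (Coprimality.sym c) (subst (b ∣_) (ℕₚ.*-comm q a) b∣qa)
... | divides r refl = divides r (trans (ℕₚ.*-assoc r b a) (cong (r ℕ.*_) (ℕₚ.*-comm b a)))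

-- Raising `(a b)^k = 1` to the power `c` removes `a` and leaves `b^(c k) = 1`, so `d` divides `c k`
-- and, by coprimality, `k`; symmetrically for `c`.
hasOrder-* : ∀ {n a b c d} → Coprime c d → HasOrder n a c → HasOrder n b d → HasOrder n (a * b) (c ℕ.* d)
hasOrder-* {n} {a} {b} {c} {d} coprime (a^c≈1 , a-order) (b^d≈1 , b-order) =
  ≈-trans (≈-reflexive (^-distribˡ-* a b (c ℕ.* d)))
    (≈-trans (*-cong (^-*≈1 c d a^c≈1) (^-*≈1ʳ d c b^d≈1)) ≈-refl) ,
  λ k ab^k≈1 → coprime-*-∣ coprime (c∣ k ab^k≈1) (d∣ k ab^k≈1)
  where
  open ≈-Reasoning n
  d∣ : ∀ k → (a * b) ^ᶻ k ≈ + 1 [mod n ] → d ∣ k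
  d∣ k ab^k≈1 = Coprimality.coprime-divisor (Coprimality.sym coprime) (b-order (c ℕ.* k) (begin
    b ^ᶻ (c ℕ.* k)                        ≡⟨ sym (ℤₚ.*-identityˡ _) ⟩
    + 1 * b ^ᶻ (c ℕ.* k)                  ≈⟨ *-cong (≈-sym (^-*≈1 c k a^c≈1)) ≈-refl ⟩
    a ^ᶻ (c ℕ.* k) * b ^ᶻ (c ℕ.* k)       ≡⟨ sym (^-distribˡ-* a b (c ℕ.* k)) ⟩
    (a * b) ^ᶻ (c ℕ.* k)                  ≈⟨ ^-*≈1ʳ k c ab^k≈1 ⟩
    + 1                                   ∎))
  c∣ : ∀ k → (a * b) ^ᶻ k ≈ + 1 [mod n ] → c ∣ k
  c∣ k ab^k≈1 = Coprimality.coprime-divisor coprime (a-order (d ℕ.* k) (begin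
    a ^ᶻ (d ℕ.* k)                        ≡⟨ sym (ℤₚ.*-identityʳ _) ⟩
    a ^ᶻ (d ℕ.* k) * + 1                  ≈⟨ *-cong (≈-refl {a = a ^ᶻ (d ℕ.* k)}) (≈-sym (^-*≈1 d k b^d≈1)) ⟩
    a ^ᶻ (d ℕ.* k) * b ^ᶻ (d ℕ.* k)       ≡⟨ sym (^-distribˡ-* a b (d ℕ.* k)) ⟩
    (a * b) ^ᶻ (d ℕ.* k)                  ≈⟨ ^-*≈1ʳ k d ab^k≈1 ⟩
    + 1                                   ∎))

-- Decided by the cofactor of `g`: if `r` divides it, one factor `r` cancels; otherwise it is
-- coprime to `r` and divides a power of `r`, so it is 1.
∣-prime-power : ∀ {r} → Prime r → ∀ k {g} → g ∣ r ^ suc k → g ≡ r ^ suc k ⊎ g ∣ r ^ k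
∣-prime-power {r} pr k {g} (divides h eq) with r ∣? h
... | yes (divides h′ refl) = inj₂ (divides h′ (ℕₚ.*-cancelˡ-≡ (r ^ k) (h′ ℕ.* g) r {{prime⇒nonZero pr}}
        (trans eq (trans (cong (ℕ._* g) (ℕₚ.*-comm h′ r)) (ℕₚ.*-assoc r h′ g)))))
... | no r∤h = inj₁ (sym (trans eq (trans (cong (ℕ._* g) h≡1) (ℕₚ.*-identityˡ g))))
  where
  h≡1 : h ≡ 1
  h≡1 = coprime-^ʳ (suc k) (prime∤⇒coprime pr r∤h) (ℕ∣.∣-refl , divides g (trans eq (ℕₚ.*-comm h g)))

-- If `a^j = 1`, the gcd of `j` and `r ^ suc k` is also an exponent sending `a` to 1; were it a
-- proper divisor, it would divide `r ^ k`.
hasOrder-prime-power : ∀ {n a r} → Prime r → ∀ k → a ^ᶻ (r ^ suc k) ≈ + 1 [mod n ] →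
                       ¬ a ^ᶻ (r ^ k) ≈ + 1 [mod n ] → HasOrder n a (r ^ suc k)
hasOrder-prime-power {r = r} pr k one ¬one = one , order
  where
  order : ∀ j → _ → r ^ suc k ∣ j
  order j a^j≈1 with ∣-prime-power pr k (GCD.gcd[m,n]∣n j (r ^ suc k))
  ... | inj₁ eq = subst (_∣ j) eq (GCD.gcd[m,n]∣m j (r ^ suc k))
  ... | inj₂ g∣ = contradiction (^-∣≈1 g∣ (^-gcd≈1 j (r ^ suc k) a^j≈1 one)) ¬one

-- The candidates 1, ..., m + 2 are distinct and nonzero modulo `p` because `m + 2 ≤ p - 1`, and
-- they outnumber the possible roots of `x^(m+1) - 1`.
∃-non-root : ∀ {p} → Prime p → ∀ m → suc m < p ∸ 1 →
             ∃ λ x → ¬ x ≈ + 0 [mod p ] × ¬ x ^ᶻ suc m ≈ + 1 [mod p ]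
∃-non-root {p@(suc p-1)} pp m 1+m<p-1
  with Fₚ.¬∀⟶∃¬ (suc (suc m)) _ (λ i → (+ suc (toℕ i)) ^ᶻ suc m ≈? + 1 [mod p ]) not-all
  where
  x<p : (i : Fin (suc (suc m))) → suc (toℕ i) < p
  x<p i = s≤s (ℕₚ.≤-trans (Fₚ.toℕ<n i) 1+m<p-1)
  not-all : ¬ (∀ (i : Fin (suc (suc m))) → (+ suc (toℕ i)) ^ᶻ suc m ≈ + 1 [mod p ])
  not-all all = monic-roots pp (monic-^-1 m) (λ i → + suc (toℕ i))
    (λ i j eq → Fₚ.toℕ-injective (ℕₚ.suc-injective (pos-cong eq (x<p i) (x<p j))))
    (λ i → ≈⇒-≈0 (all i))
... | i , ¬root = + suc (toℕ i) , (λ eq → ℕₚ.<⇒≱ (s≤s (ℕₚ.≤-trans (Fₚ.toℕ<n i) 1+m<p-1)) (ℕ∣.∣⇒≤ (≈0⇒∣ eq))) , ¬root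

-- Write `p - 1 = c r^(k+1)` and take a nonzero `x` with `x^(c r^k) ≢ 1`; here `c r^k = (p-1)/r` is
-- below `p - 1`. Then `x^c` raised to `r^(k+1)` is 1 by Fermat, and raised to `r^k` it is not.
∃-order-prime-power : ∀ {p r} → Prime p → Prime r → ∀ k → r ^ suc k ∣ p ∸ 1 → ∃ λ a → HasOrder p a (r ^ suc k)
∃-order-prime-power {p} {r} pp pr k (divides c eq) with c ℕ.* r ^ k in eq′
... | zero = contradiction
    (trans eq (trans (cong (c ℕ.*_) (ℕₚ.*-comm r (r ^ k))) (trans (sym (ℕₚ.*-assoc c (r ^ k) r)) (cong (ℕ._* r) eq′))))
    (ℕₚ.m>n⇒m∸n≢0 (ℕ.nonTrivial⇒n>1 p {{prime⇒nonTrivial pp}}))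
... | suc m with ∃-non-root pp m (subst (suc m <_) (sym p-1≡) (ℕₚ.m<m*n (suc m) r (ℕ.nonTrivial⇒n>1 r {{prime⇒nonTrivial pr}})))
  where
  p-1≡ : p ∸ 1 ≡ suc m ℕ.* r
  p-1≡ = trans eq (trans (cong (c ℕ.*_) (ℕₚ.*-comm r (r ^ k))) (trans (sym (ℕₚ.*-assoc c (r ^ k) r)) (cong (ℕ._* r) eq′)))
...   | x , x≉0 , ¬root = x ^ᶻ c , hasOrder-prime-power pr k
        (subst (_≈ + 1 [mod p ]) (sym (ℤₚ.^-*-assoc x c (r ^ suc k)))
          (subst (λ t → x ^ᶻ t ≈ + 1 [mod p ]) eq (fermat-unit pp x≉0)))
        (λ eq″ → ¬root (subst (λ t → x ^ᶻ t ≈ + 1 [mod p ]) eq′ (≈-trans (≈-reflexive (sym (ℤₚ.^-*-assoc x c (r ^ k)))) eq″)))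

prime-divisor : ∀ n → 1 < n → ∃ λ r → Prime r × r ∣ n
prime-divisor n 1<n with factorise n {{ℕ.>-nonZero (ℕₚ.<-trans (s≤s z≤n) 1<n)}}
... | record { factors = [] ; isFactorisation = eq } = contradiction (sym eq) (ℕₚ.<⇒≢ 1<n)
... | record { factors = r ∷ rs ; isFactorisation = refl ; factorsPrime = pr All.∷ _ } = r , pr , ℕ∣.m∣m*n _

split-prime-power : ∀ {r} → Prime r → ∀ n → 0 < n → ∃ λ k → ∃ λ c → n ≡ r ^ k ℕ.* c × ¬ r ∣ c
split-prime-power {r} pr = <-rec _ step
  where
  step : ∀ n → (∀ {m} → m < n → 0 < m → ∃ λ k → ∃ λ c → m ≡ r ^ k ℕ.* c × ¬ r ∣ c) →
         0 < n → ∃ λ k → ∃ λ c → n ≡ r ^ k ℕ.* c × ¬ r ∣ c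
  step n rec 0<n with r ∣? n
  ... | no r∤n = 0 , n , sym (ℕₚ.*-identityˡ n) , r∤n
  ... | yes (divides zero refl) = contradiction 0<n λ ()
  ... | yes (divides m@(suc _) refl) with rec (ℕₚ.m<m*n m r (ℕ.nonTrivial⇒n>1 r {{prime⇒nonTrivial pr}})) (s≤s z≤n)
  ...   | k , c , eq , r∤c = suc k , c , trans (cong (ℕ._* r) eq) (trans (ℕₚ.*-comm _ r) (sym (ℕₚ.*-assoc r (r ^ k) c))) , r∤c

-- Strong induction on `d`: the full power of one prime divisor and the complementary factor are
-- coprime, so elements realising these two orders can be multiplied.
∃-order : ∀ {p} → Prime p → ∀ d → 0 < d → d ∣ p ∸ 1 → ∃ λ a → HasOrder p a d
∃-order {p} pp = <-rec _ step
  where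
  step : ∀ d → (∀ {c} → c < d → 0 < c → c ∣ p ∸ 1 → ∃ λ a → HasOrder p a c) →
         0 < d → d ∣ p ∸ 1 → ∃ λ a → HasOrder p a d
  step 1 rec _ _ = + 1 , ≈-refl , λ k _ → ℕ∣.1∣ k
  step d@(suc (suc _)) rec 0<d d∣p-1 with prime-divisor d (s≤s (s≤s z≤n))
  ... | r , pr , r∣d with split-prime-power pr d 0<d
  ...   | zero , c , eq , r∤c = contradiction (subst (r ∣_) (trans eq (ℕₚ.*-identityˡ c)) r∣d) r∤c
  ...   | suc k , zero , eq , r∤c = contradiction (r ℕ∣.∣0) r∤c
  ...   | suc k , c@(suc c-1) , eq , r∤c = a * b , subst (HasOrder p (a * b)) (sym eq) (hasOrder-* coprime (proj₂ A) (proj₂ B))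
    where
    coprime : Coprime (r ^ suc k) c
    coprime = Coprimality.sym (coprime-^ʳ (suc k) (prime∤⇒coprime pr r∤c))
    1<r^k : 1 < r ^ suc k
    1<r^k = ℕₚ.<-≤-trans (ℕ.nonTrivial⇒n>1 r {{prime⇒nonTrivial pr}})
              (ℕₚ.m≤m*n r (r ^ k) {{ℕₚ.m^n≢0 r k {{prime⇒nonZero pr}}}})
    A : ∃ λ a → HasOrder p a (r ^ suc k)
    A = ∃-order-prime-power pp pr k (ℕ∣.∣-trans (subst (r ^ suc k ∣_) (sym eq) (ℕ∣.m∣m*n c)) d∣p-1)
    B : ∃ λ b → HasOrder p b c
    B = rec (subst (c <_) (sym (trans eq (ℕₚ.*-comm (r ^ suc k) c))) (ℕₚ.m<m*n c (r ^ suc k) 1<r^k)) (s≤s z≤n)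
            (ℕ∣.∣-trans (subst (c ∣_) (sym eq) (ℕ∣.n∣m*n (r ^ suc k))) d∣p-1)
    a = proj₁ A
    b = proj₁ B

-- Roots of unity modulo prime powers

module _ {p d : ℕ} (pp : Prime p) (0<d : 0 < d) (d∣p-1 : d ∣ p ∸ 1) where

  -- `p ≡ 1` modulo `d`, so taking p-th powers fixes every d-th root of unity, whatever the modulus
  -- `n`.
  ^-prime-power-fixed : ∀ {n z} → z ^ᶻ d ≈ + 1 [mod n ] → ∀ k → z ^ᶻ (p ^ k) ≈ z [mod n ]
  ^-prime-power-fixed {z = z} _ zero = ≈-reflexive (ℤₚ.^-identityʳ z)
  ^-prime-power-fixed {n} {z} z^d≈1 (suc k) = begin
    z ^ᶻ (p ^ suc k)         ≡⟨ cong (z ^ᶻ_) (ℕₚ.*-comm p (p ^ k)) ⟩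
    z ^ᶻ (p ^ k ℕ.* p)       ≡⟨ sym (ℤₚ.^-*-assoc z (p ^ k) p) ⟩
    (z ^ᶻ (p ^ k)) ^ᶻ p      ≈⟨ ^-cong p (^-prime-power-fixed z^d≈1 k) ⟩
    z ^ᶻ p                   ≡⟨ cong (z ^ᶻ_) (sym (ℕₚ.m+[n∸m]≡n (ℕₚ.<⇒≤ (ℕ.nonTrivial⇒n>1 p {{prime⇒nonTrivial pp}})))) ⟩
    z ^ᶻ (1 ℕ.+ (p ∸ 1))     ≈⟨ ^-+-cancel 1 (p ∸ 1) (^-∣≈1 d∣p-1 z^d≈1) ⟩
    z ^ᶻ 1                   ≡⟨ ℤₚ.^-identityʳ z ⟩
    z                        ∎
    where open ≈-Reasoning n

  -- Raising `z ≡ w` to the power `p^(e-1)` improves the modulus from `p` to `p^e` and changes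
  -- neither root of unity.
  root-of-unity-lift-unique : ∀ {e z w} → 1 ≤ e → z ^ᶻ d ≈ + 1 [mod p ^ e ] → w ^ᶻ d ≈ + 1 [mod p ^ e ] →
                              z ≈ w [mod p ] → z ≈ w [mod p ^ e ]
  root-of-unity-lift-unique {suc k} _ z^d≈1 w^d≈1 z≈w =
    ≈-trans (≈-sym (^-prime-power-fixed z^d≈1 k)) (≈-trans (^-lift k z≈w) (^-prime-power-fixed w^d≈1 k))

  -- The lift is the Teichmüller representative: `w^(p^(e-1))` is still `w` modulo `p`, and its d-th
  -- power is `(w^d)^(p^(e-1))`, which `^-lift` makes 1 modulo `p^e`.
  ∃-order-lift : ∀ {e} → 1 ≤ e → ∃ λ z → z ^ᶻ d ≈ + 1 [mod p ^ e ] × HasOrder p z d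
  ∃-order-lift {suc k} _ with ∃-order pp d 0<d d∣p-1
  ... | w , w-order@(w^d≈1 , _) = w ^ᶻ (p ^ k) ,
    ≈-trans (≈-reflexive (trans (ℤₚ.^-*-assoc w (p ^ k) d) (trans (cong (w ^ᶻ_) (ℕₚ.*-comm (p ^ k) d)) (sym (ℤₚ.^-*-assoc w d (p ^ k))))))
      (≈-trans (^-lift k w^d≈1) (≈-reflexive (ℤₚ.^-zeroˡ (p ^ k)))) ,
    hasOrder-resp (≈-sym (^-prime-power-fixed w^d≈1 k)) w-order

  -- Reduction modulo `p` is injective on the d-th roots of unity modulo `p^e`, so a power of `z`
  -- that becomes 1 modulo `p` was 1 already.
  hasOrder-prime-power⇒prime : ∀ {e z} → 1 ≤ e → HasOrder (p ^ e) z d → HasOrder p z d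
  hasOrder-prime-power⇒prime {suc k} {z} 1≤e (z^d≈1 , order) =
    ≈-weaken (ℕ∣.m∣m*n (p ^ k)) z^d≈1 ,
    λ j z^j≈1 → order j (root-of-unity-lift-unique 1≤e (z^jd≈1 j) (≈-reflexive (ℤₚ.^-zeroˡ d)) z^j≈1)
    where
    z^jd≈1 : ∀ j → (z ^ᶻ j) ^ᶻ d ≈ + 1 [mod p ^ suc k ]
    z^jd≈1 j = ≈-trans (≈-reflexive (ℤₚ.^-*-assoc z j d)) (^-*≈1ʳ d j z^d≈1)

hasOrder⇒invertible : ∀ {n z d} → HasOrder n z d → 0 < d → Invertible n z
hasOrder⇒invertible {d = d} (z^d≈1 , _) 0<d = ^≈1⇒invertible d 0<d z^d≈1

^-injective-≤ : ∀ {n z d} → HasOrder n z d → ∀ {i j} → i ≤ j → j < d → z ^ᶻ i ≈ z ^ᶻ j [mod n ] → i ≡ j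
^-injective-≤ {n} {z} {d} z-order {i} {j} i≤j j<d eq with j ∸ i in j∸i
... | zero  = ℕₚ.≤-antisym i≤j (ℕₚ.m∸n≡0⇒m≤n j∸i)
... | suc r = contradiction z^[1+r]≈1
  (hasOrder-minimal z-order (suc r) (s≤s z≤n) (ℕₚ.≤-<-trans (subst (_≤ j) j∸i (ℕₚ.m∸n≤m j i)) j<d))
  where
  z^[1+r]≈1 : z ^ᶻ suc r ≈ + 1 [mod n ]
  z^[1+r]≈1 = *-cancelˡ-≈ (invertible-^ i (hasOrder⇒invertible z-order (ℕₚ.≤-<-trans z≤n j<d))) (begin
    z ^ᶻ i * z ^ᶻ suc r      ≡⟨ sym (ℤₚ.^-distribˡ-+-* z i (suc r)) ⟩
    z ^ᶻ (i ℕ.+ suc r)       ≡⟨ cong (z ^ᶻ_) (trans (cong (i ℕ.+_) (sym j∸i)) (ℕₚ.m+[n∸m]≡n i≤j)) ⟩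
    z ^ᶻ j                   ≈⟨ ≈-sym eq ⟩
    z ^ᶻ i                   ≡⟨ sym (ℤₚ.*-identityʳ _) ⟩
    z ^ᶻ i * + 1             ∎)
    where open ≈-Reasoning n

^-injective : ∀ {n z d} → HasOrder n z d → ∀ {i j} → i < d → j < d → z ^ᶻ i ≈ z ^ᶻ j [mod n ] → i ≡ j
^-injective z-order {i} {j} i<d j<d eq with ℕₚ.≤-total i j
... | inj₁ i≤j = ^-injective-≤ z-order i≤j j<d eq
... | inj₂ j≤i = sym (^-injective-≤ z-order j≤i i<d (≈-sym eq))

-- The `d` powers of `z` together with a `g` outside them would be `d + 1` roots of `x^d - 1`.
root-of-unity-power : ∀ {p z d g} → Prime p → 0 < d → HasOrder p z d → g ^ᶻ d ≈ + 1 [mod p ] →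
                      ∃ λ j → j < d × g ≈ z ^ᶻ j [mod p ]
root-of-unity-power {p} {z} {d@(suc d-1)} {g} pp 0<d z-order g^d≈1
  with Fₚ.any? (λ (i : Fin d) → g ≈? z ^ᶻ toℕ i [mod p ])
... | yes (i , eq) = toℕ i , Fₚ.toℕ<n i , eq
... | no ¬power = contradiction root (monic-roots pp (monic-^-1 d-1) r r-injective)
  where
  r : Fin (suc d) → ℤ
  r F.zero    = g
  r (F.suc i) = z ^ᶻ toℕ i
  r-injective : ∀ i j → r i ≈ r j [mod p ] → i ≡ j
  r-injective F.zero    F.zero    _  = refl
  r-injective F.zero    (F.suc j) eq = contradiction (j , eq) ¬power
  r-injective (F.suc i) F.zero    eq = contradiction (i , ≈-sym eq) ¬power
  r-injective (F.suc i) (F.suc j) eq =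
    cong F.suc (Fₚ.toℕ-injective (^-injective z-order (Fₚ.toℕ<n i) (Fₚ.toℕ<n j) eq))
  root : ∀ i → r i ^ᶻ d - + 1 ≈ + 0 [mod p ]
  root F.zero    = ≈⇒-≈0 g^d≈1
  root (F.suc i) = ≈⇒-≈0 (≈-trans (≈-reflexive (ℤₚ.^-*-assoc z (toℕ i) d)) (^-*≈1ʳ d (toℕ i) (proj₁ z-order)))

hasOrder-^ : ∀ {n z d m} → HasOrder n z d → Coprime m d → HasOrder n (z ^ᶻ m) d
hasOrder-^ {n} {z} {d} {m} (z^d≈1 , order) c =
  ≈-trans (≈-reflexive (ℤₚ.^-*-assoc z m d)) (^-*≈1ʳ d m z^d≈1) ,
  λ k eq → Coprimality.coprime-divisor (Coprimality.sym c)
             (order (m ℕ.* k) (≈-trans (≈-reflexive (sym (ℤₚ.^-*-assoc z m k))) eq))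

-- If `c` divides `m` and `d = v c`, then `(z^m)^v = 1`, so the order `v c` divides `v`.
hasOrder-^⇒coprime : ∀ {n z d m} → 0 < d → z ^ᶻ d ≈ + 1 [mod n ] → HasOrder n (z ^ᶻ m) d → Coprime m d
hasOrder-^⇒coprime {n} {z} {d} {m} 0<d z^d≈1 (_ , order) {c} (divides u refl , divides v refl) =
  ℕ∣.∣1⇒≡1 (ℕ∣.*-cancelˡ-∣ v {{ℕ.≢-nonZero v≢0}}
    (subst (v ℕ.* c ∣_) (sym (ℕₚ.*-identityʳ v)) (order v (begin
      (z ^ᶻ (u ℕ.* c)) ^ᶻ v    ≡⟨ ℤₚ.^-*-assoc z (u ℕ.* c) v ⟩
      z ^ᶻ (u ℕ.* c ℕ.* v)     ≡⟨ cong (z ^ᶻ_) (trans (ℕₚ.*-assoc u c v) (cong (u ℕ.*_) (ℕₚ.*-comm c v))) ⟩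
      z ^ᶻ (u ℕ.* (v ℕ.* c))   ≈⟨ ^-*≈1ʳ (v ℕ.* c) u z^d≈1 ⟩
      + 1                      ∎))))
  where
  open ≈-Reasoning n
  v≢0 : v ≢ 0
  v≢0 refl = contradiction 0<d λ ()

-- Totients, Chinese remaindering and gcds

module _ {p : Level} {P : ℕ → Set p} (P? : ∀ k → Dec (P k)) where

  count : ℕ → ℕ
  count N = length (filter P? (upTo N))

  count-suc : ∀ N → count (suc N) ≡ count N ℕ.+ length (filter P? (N ∷ []))
  count-suc N = trans (cong (length ∘ filter P?) (sym (Listₚ.upTo-∷ʳ N)))
    (trans (cong length (Listₚ.filter-++ P? (upTo N) (N ∷ []))) (Listₚ.length-++ (filter P? (upTo N))))

  count-yes : ∀ {N} → P N → count (suc N) ≡ suc (count N)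
  count-yes {N} y = trans (count-suc N)
    (trans (cong (λ xs → count N ℕ.+ length xs) (Listₚ.filter-accept P? y)) (ℕₚ.+-comm (count N) 1))

  count-no : ∀ {N} → ¬ P N → count (suc N) ≡ count N
  count-no {N} ¬y = trans (count-suc N)
    (trans (cong (λ xs → count N ℕ.+ length xs) (Listₚ.filter-reject P? ¬y)) (ℕₚ.+-identityʳ (count N)))

-- The range below `p^e` is cut into `p^(e-1)` blocks of length `p`; each loses exactly its first
-- element, the multiple of `p`.
totient-prime-power : ∀ {p} → Prime p → ∀ {e} → 1 ≤ e → totient (p ^ e) ≡ p ^ (e ∸ 1) ℕ.* (p ∸ 1)
totient-prime-power {p@(suc p-1)} pp {suc e} _ = trans (cong #coprime (ℕₚ.*-comm p (p ^ e))) (blocks (p ^ e))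
  where
  q = p ^ suc e
  coprime-q? : ∀ k → Dec (Coprime k q)
  coprime-q? k = coprime? k q
  #coprime = count coprime-q?
  multiple : ∀ m → ¬ Coprime (m ℕ.* p) q
  multiple m c = ℕₚ.<⇒≢ (ℕ.nonTrivial⇒n>1 p {{prime⇒nonTrivial pp}}) (sym (c (ℕ∣.n∣m*n m , ℕ∣.m∣m*n (p ^ e))))
  non-multiple : ∀ m {k} → suc k < p → Coprime (m ℕ.* p ℕ.+ suc k) q
  non-multiple m k<p = coprime-^ʳ (suc e) (prime∤⇒coprime pp
    (λ p∣ → ℕₚ.<⇒≱ k<p (ℕ∣.∣⇒≤ (ℕ∣.∣m+n∣m⇒∣n p∣ (ℕ∣.n∣m*n m)))))
  in-block : ∀ m k → k < p → #coprime (m ℕ.* p ℕ.+ suc k) ≡ #coprime (m ℕ.* p) ℕ.+ k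
  in-block m zero _ = trans (cong #coprime (ℕₚ.+-comm (m ℕ.* p) 1))
    (trans (count-no coprime-q? {m ℕ.* p} (multiple m)) (sym (ℕₚ.+-identityʳ _)))
  in-block m (suc k) k<p = trans (cong #coprime (ℕₚ.+-suc (m ℕ.* p) (suc k)))
    (trans (count-yes coprime-q? {m ℕ.* p ℕ.+ suc k} (non-multiple m k<p))
      (trans (cong suc (in-block m k (ℕₚ.<-trans (ℕₚ.n<1+n k) k<p))) (sym (ℕₚ.+-suc _ k))))
  blocks : ∀ m → #coprime (m ℕ.* p) ≡ m ℕ.* p-1
  blocks zero = refl
  blocks (suc m) = trans (cong #coprime (ℕₚ.+-comm p (m ℕ.* p)))
    (trans (in-block m p-1 (ℕₚ.n<1+n p-1))
      (trans (cong (ℕ._+ p-1) (blocks m)) (ℕₚ.+-comm (m ℕ.* p-1) p-1)))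

coprime-prodF : ∀ l (f : Fin l → ℕ) {a} → (∀ j → Coprime a (f j)) → Coprime a (prodF l f)
coprime-prodF zero f _ (_ , d∣1) = ℕ∣.∣1⇒≡1 d∣1
coprime-prodF (suc l) f c = coprime-*ʳ (c F.zero) (coprime-prodF l (f ∘ F.suc) (c ∘ F.suc))

∣prodF : ∀ l (f : Fin l → ℕ) i → f i ∣ prodF l f
∣prodF (suc l) f F.zero = ℕ∣.m∣m*n _
∣prodF (suc l) f (F.suc i) = ℕ∣.∣-trans (∣prodF l (f ∘ F.suc) i) (ℕ∣.n∣m*n (f F.zero))

-- The product of the other `f j`, known only through what Chinese remaindering uses of it: those
-- factors divide it, and it inherits coprimality from them.
prodF-cofactor : ∀ l (f : Fin l → ℕ) i → ∃ λ c → prodF l f ≡ f i ℕ.* c ×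
                 (∀ j → j ≢ i → f j ∣ c) × (∀ {a} → (∀ j → j ≢ i → Coprime a (f j)) → Coprime a c)
prodF-cofactor (suc l) f F.zero = prodF l (f ∘ F.suc) , refl ,
  (λ { F.zero j≢i → contradiction refl j≢i ; (F.suc j) _ → ∣prodF l (f ∘ F.suc) j }) ,
  (λ c → coprime-prodF l (f ∘ F.suc) (λ j → c (F.suc j) λ ()))
prodF-cofactor (suc l) f (F.suc i) with prodF-cofactor l (f ∘ F.suc) i
... | c , eq , others , coprime = f F.zero ℕ.* c ,
  trans (cong (f F.zero ℕ.*_) eq) (trans (sym (ℕₚ.*-assoc (f F.zero) (f (F.suc i)) c))
    (trans (cong (ℕ._* c) (ℕₚ.*-comm (f F.zero) (f (F.suc i)))) (ℕₚ.*-assoc (f (F.suc i)) (f F.zero) c))) ,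
  (λ { F.zero _ → ℕ∣.m∣m*n c
     ; (F.suc j) j≢i → ℕ∣.∣-trans (others j (j≢i ∘ cong F.suc)) (ℕ∣.n∣m*n (f F.zero)) }) ,
  (λ c → coprime-*ʳ (c F.zero λ ()) (coprime (λ j j≢i → c (F.suc j) (j≢i ∘ Fₚ.suc-injective))))

≈-crt-prodF : ∀ l (q : Fin l → ℕ) → (∀ i j → i ≢ j → Coprime (q i) (q j)) → ∀ {a b} →
              (∀ i → a ≈ b [mod q i ]) → a ≈ b [mod prodF l q ]
≈-crt-prodF zero q _ {a} {b} _ = mod-by (a - b) (lem a b)
  where
  lem : ∀ a b → a ≡ b + (a - b) * + 1
  lem = solve-∀
≈-crt-prodF (suc l) q coprime eqs = ≈-crt (coprime-prodF l (q ∘ F.suc) (λ j → coprime F.zero (F.suc j) λ ()))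
  (eqs F.zero) (≈-crt-prodF l (q ∘ F.suc) (λ i j i≢j → coprime (F.suc i) (F.suc j) (i≢j ∘ Fₚ.suc-injective)) (eqs ∘ F.suc))

sumZ-≈0 : ∀ {n} l (f : Fin l → ℤ) → (∀ j → f j ≈ + 0 [mod n ]) → sumZ l f ≈ + 0 [mod n ]
sumZ-≈0 zero f _ = ≈-refl
sumZ-≈0 (suc l) f f≈0 = +-cong (f≈0 F.zero) (sumZ-≈0 l (f ∘ F.suc) (f≈0 ∘ F.suc))

sumZ-≈ : ∀ {n} l (f : Fin l → ℤ) i → (∀ j → j ≢ i → f j ≈ + 0 [mod n ]) → sumZ l f ≈ f i [mod n ]
sumZ-≈ (suc l) f F.zero others =
  ≈-trans (+-cong (≈-refl {a = f F.zero}) (sumZ-≈0 l (f ∘ F.suc) (λ j → others (F.suc j) λ ()))) (≈-reflexive (ℤₚ.+-identityʳ _))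
sumZ-≈ (suc l) f (F.suc i) others =
  ≈-trans (+-cong (others F.zero λ ()) (sumZ-≈ l (f ∘ F.suc) i (λ j j≢i → others (F.suc j) (j≢i ∘ Fₚ.suc-injective))))
    (≈-reflexive (ℤₚ.+-identityˡ _))

gcdF-∣ : ∀ l (f : Fin l → ℕ) i → gcdF l f ∣ f i
gcdF-∣ (suc l) f F.zero = GCD.gcd[m,n]∣m (f F.zero) _
gcdF-∣ (suc l) f (F.suc i) = ℕ∣.∣-trans (GCD.gcd[m,n]∣n (f F.zero) _) (gcdF-∣ l (f ∘ F.suc) i)

gcdF-greatest : ∀ l (f : Fin l → ℕ) {c} → (∀ i → c ∣ f i) → c ∣ gcdF l f
gcdF-greatest zero f {c} _ = c ℕ∣.∣0
gcdF-greatest (suc l) f c∣ = GCD.gcd-greatest (c∣ F.zero) (gcdF-greatest l (f ∘ F.suc) (c∣ ∘ F.suc))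

-- Z_n and its subsets

toℕ-mod : ∀ {n} .{{_ : NonZero n}} m → toℕ ([_] {n} m) ≡ m ℕ.% n
toℕ-mod {n} m = Fₚ.toℕ-fromℕ< (ℕ÷.m%n<n m n)

val : ∀ {n} → Fin n → ℤ
val x = + toℕ x

val-injective : ∀ {n} {x y : Fin n} → val x ≈ val y [mod n ] → x ≡ y
val-injective {x = x} {y} eq = Fₚ.toℕ-injective (pos-cong eq (Fₚ.toℕ<n x) (Fₚ.toℕ<n y))

module _ {n : ℕ} .{{_ : NonZero n}} where

  val-[] : ∀ m → val ([_] {n} m) ≈ + m [mod n ]
  val-[] m rewrite toℕ-mod {n} m = ≈-sym (mod-by (+ (m ℕ./ n))
    (trans (cong +_ (ℕ÷.m≡m%n+[m/n]*n m n)) (trans (ℤₚ.pos-+ (m ℕ.% n) _) (cong (_+_ (+ (m ℕ.% n))) (ℤₚ.pos-* (m ℕ./ n) n)))))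

  val-[]ᶻ : ∀ z → val ([_]ᶻ {n} z) ≈ z [mod n ]
  val-[]ᶻ z = ≈-trans (val-[] (z ℤ.%ℕ n)) (≈-sym (mod-by (z ℤ./ℕ n) (ℤ÷.a≡a%ℕn+[a/ℕn]*n z n)))

  val-+ : ∀ (x y : Fin n) → val (x +ₙ y) ≈ val x + val y [mod n ]
  val-+ x y = val-[] (toℕ x ℕ.+ toℕ y)

  val-* : ∀ (x y : Fin n) → val (x *ₙ y) ≈ val x * val y [mod n ]
  val-* x y = ≈-trans (val-[] (toℕ x ℕ.* toℕ y)) (≈-reflexive (ℤₚ.pos-* (toℕ x) (toℕ y)))

  val-neg : ∀ (x : Fin n) → val (-ₙ x) ≈ - val x [mod n ]
  val-neg x = begin
    val (-ₙ x)        ≈⟨ val-[] (n ∸ toℕ x) ⟩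
    + (n ∸ toℕ x)     ≡⟨ sym (trans (ℤₚ.m-n≡m⊖n n (toℕ x)) (ℤₚ.⊖-≥ (ℕₚ.<⇒≤ (Fₚ.toℕ<n x)))) ⟩
    + n - val x       ≈⟨ +-cong n≈0 (≈-refl {a = - val x}) ⟩
    + 0 - val x       ≡⟨ ℤₚ.+-identityˡ _ ⟩
    - val x           ∎
    where open ≈-Reasoning n

  val-minus : ∀ (x y : Fin n) → val (x -ₙ y) ≈ val x - val y [mod n ]
  val-minus x y = ≈-trans (val-+ x (-ₙ y)) (+-cong (≈-refl {a = val x}) (val-neg y))

  val-iter : ∀ (f : Fin n → Fin n) {g : ℤ} → (∀ x → val (f x) ≈ val x * g [mod n ]) →
             ∀ k x → val (iter f k x) ≈ val x * g ^ᶻ k [mod n ]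
  val-iter f f≈ zero x = ≈-reflexive (sym (ℤₚ.*-identityʳ (val x)))
  val-iter f {g} f≈ (suc k) x = begin
    val (f (iter f k x))     ≈⟨ f≈ (iter f k x) ⟩
    val (iter f k x) * g     ≈⟨ *-cong (val-iter f f≈ k x) ≈-refl ⟩
    val x * g ^ᶻ k * g       ≡⟨ lem (val x) (g ^ᶻ k) g ⟩
    val x * (g * g ^ᶻ k)     ∎
    where
    open ≈-Reasoning n
    lem : ∀ x p g → x * p * g ≡ x * (g * p)
    lem = solve-∀

  val-^ : ∀ (g : Fin n) k → val (g ^ₙ k) ≈ val g ^ᶻ k [mod n ]
  val-^ g k = ≈-trans (val-iter (_*ₙ g) (λ x → val-* x g) k [ 1 ])
    (≈-trans (*-cong (val-[] 1) ≈-refl) (≈-reflexive (ℤₚ.*-identityˡ (val g ^ᶻ k))))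

  from-≈ : ∀ {x y : Fin n} {a b} → val x ≈ a [mod n ] → val y ≈ b [mod n ] → a ≈ b [mod n ] → x ≡ y
  from-≈ x≈a y≈b a≈b = val-injective (≈-trans x≈a (≈-trans a≈b (≈-sym y≈b)))

  to-≈ : ∀ {x y : Fin n} {a b} → val x ≈ a [mod n ] → val y ≈ b [mod n ] → x ≡ y → a ≈ b [mod n ]
  to-≈ x≈a y≈b refl = ≈-trans (≈-sym x≈a) y≈b

comprehension : ∀ {n} {P : Fin n → Set} → (∀ x → Dec (P x)) → Subset n
comprehension P? = tabulate (does ∘ P?)

module _ {n} {P : Fin n → Set} (P? : ∀ x → Dec (P x)) where

  ∈-comprehension⁺ : ∀ {x} → P x → x ∈ comprehension P?
  ∈-comprehension⁺ {x} px = Vecₚ.lookup⇒[]= x _ (trans (Vecₚ.lookup∘tabulate (does ∘ P?) x) (dec-true (P? x) px))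

  ∈-comprehension⁻ : ∀ {x} → x ∈ comprehension P? → P x
  ∈-comprehension⁻ {x} x∈ with P? x | trans (sym (Vecₚ.lookup∘tabulate (does ∘ P?) x)) (Vecₚ.[]=⇒lookup x∈)
  ... | yes px | _ = px
  ... | no _   | ()

enumerate : ∀ {n} (T : Subset n) → Fin ∣ T ∣ → Fin n
enumerate (outside ∷ T) i = F.suc (enumerate T i)
enumerate (inside ∷ T) F.zero = F.zero
enumerate (inside ∷ T) (F.suc i) = F.suc (enumerate T i)

enumerate-∈ : ∀ {n} (T : Subset n) i → enumerate T i ∈ T
enumerate-∈ (outside ∷ T) i = there (enumerate-∈ T i)
enumerate-∈ (inside ∷ T) F.zero = here
enumerate-∈ (inside ∷ T) (F.suc i) = there (enumerate-∈ T i)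

enumerate-injective : ∀ {n} (T : Subset n) i j → enumerate T i ≡ enumerate T j → i ≡ j
enumerate-injective (outside ∷ T) i j eq = enumerate-injective T i j (Fₚ.suc-injective eq)
enumerate-injective (inside ∷ T) F.zero F.zero eq = refl
enumerate-injective (inside ∷ T) (F.suc i) (F.suc j) eq = cong F.suc (enumerate-injective T i j (Fₚ.suc-injective eq))

enumerate-surjective : ∀ {n} (T : Subset n) {x} → x ∈ T → ∃ λ i → enumerate T i ≡ x
enumerate-surjective (outside ∷ T) (there x∈T) with enumerate-surjective T x∈T
... | i , eq = i , cong F.suc eq
enumerate-surjective (inside ∷ T) here = F.zero , refl
enumerate-surjective (inside ∷ T) (there x∈T) with enumerate-surjective T x∈T
... | i , eq = F.suc i , cong F.suc eq

∣∣-≤ : ∀ {n d} (T : Subset n) (f : Fin d → Fin n) → (∀ {x} → x ∈ T → ∃ λ j → f j ≡ x) → ∣ T ∣ ≤ d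
∣∣-≤ T f onto = Fₚ.injective⇒≤ {f = λ i → proj₁ (onto (enumerate-∈ T i))} λ {i} {j} eq →
  enumerate-injective T i j (trans (sym (proj₂ (onto (enumerate-∈ T i)))) (trans (cong f eq) (proj₂ (onto (enumerate-∈ T j)))))

∣∣-≥ : ∀ {n d} (T : Subset n) (f : Fin d → Fin n) → (∀ i j → f i ≡ f j → i ≡ j) → (∀ j → f j ∈ T) → d ≤ ∣ T ∣
∣∣-≥ T f f-inj f∈T = Fₚ.injective⇒≤ {f = λ j → proj₁ (enumerate-surjective T (f∈T j))} λ {i} {j} eq →
  f-inj i j (trans (sym (proj₂ (enumerate-surjective T (f∈T i)))) (trans (cong (enumerate T) eq) (proj₂ (enumerate-surjective T (f∈T j)))))

-- Circulants of a fixed-point-free cyclic group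

-- g generates a cyclic group of order d modulo n whose nontrivial elements fix only 0.
Rotor : ℕ → ℕ → ℤ → Set
Rotor n d g = g ^ᶻ d ≈ + 1 [mod n ] × (∀ k → 0 < k → k < d → Invertible n (g ^ᶻ k - + 1))

0-not-invertible : ∀ {n a} → 1 < n → Invertible n a → ¬ a ≈ + 0 [mod n ]
0-not-invertible 1<n (u , ua≈1) a≈0 =
  ℕₚ.<⇒≢ 1<n (sym (ℕ∣.∣1⇒≡1 (≈0⇒∣ (≈-trans (≈-sym ua≈1) (*-zeroʳ u a≈0)))))

rotor-resp : ∀ {n d a b} → a ≈ b [mod n ] → Rotor n d a → Rotor n d b
rotor-resp {d = d} a≈b (a^d≈1 , inv) = ≈-trans (^-cong d (≈-sym a≈b)) a^d≈1 ,
  λ k 0<k k<d → invertible-resp (+-cong (^-cong k a≈b) ≈-refl) (inv k 0<k k<d)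

module _ {n d : ℕ} {g : ℤ} (1<n : 1 < n) (0<d : 0 < d) (rotor : Rotor n d g) where
  private
    instance
      d≢0 : NonZero d
      d≢0 = ℕ.>-nonZero 0<d

  rotor-hasOrder : HasOrder n g d
  rotor-hasOrder = hasOrder d 0<d (proj₁ rotor) λ k 0<k k<d g^k≈1 →
    0-not-invertible 1<n (proj₂ rotor k 0<k k<d) (≈⇒-≈0 g^k≈1)

  rotor-invertible : Invertible n g
  rotor-invertible = ^≈1⇒invertible d 0<d (proj₁ rotor)

  rotor-power : ∀ k → g ^ᶻ k ≈ + 1 [mod n ] ⊎ Invertible n (g ^ᶻ k - + 1)
  rotor-power k with k ℕ.% d in eq
  ... | zero  = inj₁ (≈-trans (^-% d (proj₁ rotor) k) (≈-reflexive (cong (g ^ᶻ_) eq)))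
  ... | suc r = inj₂ (invertible-resp (+-cong (≈-sym (^-% d (proj₁ rotor) k)) ≈-refl)
    (subst (λ t → Invertible n (g ^ᶻ t - + 1)) (sym eq) (proj₂ rotor (suc r) (s≤s z≤n) (subst (_< d) eq (ℕ÷.m%n<n k d)))))

  -- Exponents are natural numbers, so the inverse of `g^k` is written `g^(k (d - 1))`.
  rotor-inverse : ∀ k → g ^ᶻ k * g ^ᶻ (k ℕ.* (d ∸ 1)) ≈ + 1 [mod n ]
  rotor-inverse k = begin
    g ^ᶻ k * g ^ᶻ (k ℕ.* (d ∸ 1))   ≡⟨ sym (ℤₚ.^-distribˡ-+-* g k (k ℕ.* (d ∸ 1))) ⟩
    g ^ᶻ (k ℕ.+ k ℕ.* (d ∸ 1))      ≡⟨ cong (g ^ᶻ_) (trans (sym (ℕₚ.*-suc k (d ∸ 1))) (cong (k ℕ.*_) (ℕₚ.suc-pred d))) ⟩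
    g ^ᶻ (k ℕ.* d)                  ≈⟨ ^-*≈1ʳ d k (proj₁ rotor) ⟩
    + 1                             ∎
    where open ≈-Reasoning n

  -- `(g^c - 1)(g^c + 1) = g^d - 1 = 0`, and the first factor is a unit because `0 < c < d`.
  rotor-half : ∀ c → d ≡ c ℕ.* 2 → g ^ᶻ c ≈ - (+ 1) [mod n ]
  rotor-half c refl = -≈0⇒≈ (*-cancelˡ-≈ (proj₂ rotor c 0<c (ℕₚ.m<m*n c 2 {{ℕ.>-nonZero 0<c}} (s≤s (s≤s z≤n)))) (begin
    (g ^ᶻ c - + 1) * (g ^ᶻ c - - (+ 1))   ≡⟨ lem (g ^ᶻ c) ⟩
    (g ^ᶻ c) ^ᶻ 2 - + 1                   ≡⟨ cong (λ t → t - + 1) (ℤₚ.^-*-assoc g c 2) ⟩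
    g ^ᶻ (c ℕ.* 2) - + 1                  ≈⟨ ≈⇒-≈0 (proj₁ rotor) ⟩
    + 0                                   ≡⟨ sym (ℤₚ.*-zeroʳ (g ^ᶻ c - + 1)) ⟩
    (g ^ᶻ c - + 1) * + 0                  ∎))
    where
    open ≈-Reasoning n
    0<c : 0 < c
    0<c = ℕₚ.n≢0⇒n>0 λ { refl → contradiction 0<d λ () }
    lem : ∀ x → (x - + 1) * (x - - (+ 1)) ≡ x * (x * + 1) - + 1
    lem = solve-∀

gen-all : ∀ {n} .{{_ : NonZero n}} (S : Subset n) → Gen S [ 1 ] → Generates S
gen-all {n} S gen-1 x = subst (Gen S) (from-≈ (val-[] (toℕ x)) ≈-refl ≈-refl) (gen-[] (toℕ x))
  where
  gen-[] : ∀ m → Gen S [ m ]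
  gen-[] zero = gen-zero
  gen-[] (suc m) = subst (Gen S)
    (from-≈ (≈-trans (val-+ [ m ] [ 1 ]) (+-cong (val-[] m) (val-[] 1))) (val-[] (suc m)) (≈-reflexive (ℤₚ.+-comm (+ m) (+ 1))))
    (gen-add (gen-[] m) gen-1)

IsCyclicSubgroupOf⇔ : ∀ {n} .{{_ : NonZero n}} {T : Subset n} {g} → IsCyclicSubgroupOf T g →
                      ∀ {x} → (x ∈ T → ∃ λ k → val x ≈ val g ^ᶻ k [mod n ]) ×
                              (∀ k → val x ≈ val g ^ᶻ k [mod n ] → x ∈ T)
IsCyclicSubgroupOf⇔ {n} {T} {g} cyclic {x} =
  (λ x∈T → let k , eq = Equivalence.to (cyclic x) x∈T in k , ≈-trans (≈-reflexive (cong val eq)) (val-^ g k)) ,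
  (λ k eq → Equivalence.from (cyclic x) (k , from-≈ eq (val-^ g k) ≈-refl))

-- `T` is both the connection set and the complement, as the orbit of 1 under itself. Any `T` with
-- `IsCyclicSubgroupOf T g` is allowed, which covers the chosen class representatives and the last
-- clause of the theorem alike.
module RotorSubgroup {n d : ℕ} .{{_ : NonZero n}} (3≤n : 3 ≤ n) (0<d : 0 < d) (2∣d : 2 ∣ d)
                     {g : Fin n} (rotor : Rotor n d (val g)) {T : Subset n} (cyclic : IsCyclicSubgroupOf T g) where
  private
    G = val g
    1<n : 1 < n
    1<n = ℕₚ.<-trans (s≤s (s≤s z≤n)) 3≤n
    c = ℕ∣.quotient 2∣d
    G^c≈-1 : G ^ᶻ c ≈ - (+ 1) [mod n ]
    G^c≈-1 = rotor-half 1<n 0<d rotor c (ℕ∣._∣_.equality 2∣d)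
    G-inv : Invertible n G
    G-inv = rotor-invertible 1<n 0<d rotor
    mem⁻ : ∀ {x} → x ∈ T → ∃ λ k → val x ≈ G ^ᶻ k [mod n ]
    mem⁻ = proj₁ (IsCyclicSubgroupOf⇔ cyclic)
    mem⁺ : ∀ {x} k → val x ≈ G ^ᶻ k [mod n ] → x ∈ T
    mem⁺ = proj₂ (IsCyclicSubgroupOf⇔ cyclic)
    1∈T : [ 1 ] ∈ T
    1∈T = mem⁺ 0 (val-[] 1)
    g^∈T : ∀ k → (g ^ₙ k) ∈ T
    g^∈T k = mem⁺ k (val-^ g k)
    *g∈T : ∀ x → x ∈ T → (x *ₙ g) ∈ T
    *g∈T x x∈T with mem⁻ x∈T
    ... | k , eq = mem⁺ (suc k) (≈-trans (val-* x g) (≈-trans (*-cong eq ≈-refl) (≈-reflexive (ℤₚ.*-comm (G ^ᶻ k) G))))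

  isUnitSubgroup : IsUnitSubgroup T
  isUnitSubgroup = units , 1∈T , closed , inverses
    where
    units : ∀ u → u ∈ T → IsUnit u
    units u u∈T with mem⁻ u∈T
    ... | k , eq = invertible⇒coprime (val u) (invertible-resp (≈-sym eq) (invertible-^ k G-inv))
    closed : ∀ u v → u ∈ T → v ∈ T → (u *ₙ v) ∈ T
    closed u v u∈T v∈T with mem⁻ u∈T | mem⁻ v∈T
    ... | j , eq | k , eq′ = mem⁺ (j ℕ.+ k)
      (≈-trans (val-* u v) (≈-trans (*-cong eq eq′) (≈-reflexive (sym (ℤₚ.^-distribˡ-+-* G j k)))))
    inverses : ∀ u → u ∈ T → ∃ λ v → v ∈ T × u *ₙ v ≡ [ 1 ]
    inverses u u∈T with mem⁻ u∈T
    ... | k , eq = g ^ₙ (k ℕ.* (d ∸ 1)) , g^∈T (k ℕ.* (d ∸ 1)) ,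
      from-≈ (≈-trans (val-* u _) (*-cong eq (val-^ g (k ℕ.* (d ∸ 1))))) (val-[] 1) (rotor-inverse 1<n 0<d rotor k)

  isFrobenius : IsFrobeniusSemidirect T
  isFrobenius = transitive , non-regular , two-fixed-points
    where
    val-aff : ∀ y u x → val (aff y u x) ≈ (val x + val y) * val u [mod n ]
    val-aff y u x = ≈-trans (val-* (x +ₙ y) u) (*-cong (val-+ x y) ≈-refl)
    transitive : ∀ x z → ∃ λ y → ∃ λ u → u ∈ T × aff y u x ≡ z
    transitive x z = z -ₙ x , [ 1 ] , 1∈T ,
      from-≈ (≈-trans (val-aff (z -ₙ x) [ 1 ] x) (*-cong (+-cong (≈-refl {a = val x}) (val-minus z x)) (val-[] 1))) ≈-refl
        (≈-reflexive (lem (val x) (val z)))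
      where
      lem : ∀ x z → (x + (z - x)) * + 1 ≡ z
      lem = solve-∀
    non-regular : ∃ λ y → ∃ λ u → ∃ λ x → u ∈ T × aff y u x ≡ x × ¬ (y ≡ [ 0 ] × u ≡ [ 1 ])
    -- The point 0 is fixed by multiplication by `g^c = -1`, which differs from 1 because `3 ≤ n`.
    non-regular = [ 0 ] , g ^ₙ c , [ 0 ] , g^∈T c ,
      from-≈ (≈-trans (val-aff [ 0 ] (g ^ₙ c) [ 0 ]) (*-cong (+-cong (val-[] 0) (val-[] 0)) ≈-refl)) (val-[] 0)
        (≈-reflexive (ℤₚ.*-zeroˡ (val (g ^ₙ c)))) ,
      λ (_ , g^c≡1) → ℕₚ.<⇒≱ 3≤n (ℕ∣.∣⇒≤ (≈0⇒∣ (≈⇒-≈0 (to-≈ (val-[] 1) (≈-trans (val-^ g c) G^c≈-1) (sym g^c≡1)))))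
    two-fixed-points : ∀ y u → u ∈ T → ∀ x₁ x₂ → x₁ ≢ x₂ → aff y u x₁ ≡ x₁ → aff y u x₂ ≡ x₂ → y ≡ [ 0 ] × u ≡ [ 1 ]
    two-fixed-points y u u∈T x₁ x₂ x₁≢x₂ fix₁ fix₂ with mem⁻ u∈T
    ... | k , u≈ with rotor-power 1<n 0<d rotor k
    ...   | inj₁ G^k≈1 = from-≈ ≈-refl (val-[] 0) y≈0 , from-≈ (≈-trans u≈ G^k≈1) (val-[] 1) ≈-refl
      where
      open ≈-Reasoning n
      lem : ∀ x y → (x + y) * + 1 - x ≡ y
      lem = solve-∀
      y≈0 : val y ≈ + 0 [mod n ]
      y≈0 = begin
        val y                              ≡⟨ sym (lem (val x₁) (val y)) ⟩
        (val x₁ + val y) * + 1 - val x₁    ≈⟨ +-cong (*-cong (≈-refl {a = val x₁ + val y}) (≈-sym (≈-trans u≈ G^k≈1))) (≈-refl {a = - val x₁}) ⟩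
        (val x₁ + val y) * val u - val x₁  ≈⟨ ≈⇒-≈0 (to-≈ (val-aff y u x₁) ≈-refl fix₁) ⟩
        + 0                                ∎
    -- Subtracting the two fixed-point equations eliminates `y` and leaves `(u - 1)(x₁ - x₂) = 0`
    -- with `u - 1` a unit.
    ...   | inj₂ inv = contradiction (val-injective (-≈0⇒≈ (*-cancelˡ-≈ inv (begin
        (G ^ᶻ k - + 1) * (val x₁ - val x₂)
          ≈⟨ *-cong (+-cong (≈-sym u≈) ≈-refl) ≈-refl ⟩
        (val u - + 1) * (val x₁ - val x₂)
          ≡⟨ lem (val u) (val x₁) (val x₂) (val y) ⟩
        ((val x₁ + val y) * val u - val x₁) - ((val x₂ + val y) * val u - val x₂)
          ≈⟨ minus-cong (≈⇒-≈0 (to-≈ (val-aff y u x₁) ≈-refl fix₁)) (≈⇒-≈0 (to-≈ (val-aff y u x₂) ≈-refl fix₂)) ⟩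
        + 0
          ≡⟨ sym (ℤₚ.*-zeroʳ (G ^ᶻ k - + 1)) ⟩
        (G ^ᶻ k - + 1) * + 0 ∎)))) x₁≢x₂
      where
      open ≈-Reasoning n
      lem : ∀ u x₁ x₂ y → (u - + 1) * (x₁ - x₂) ≡ ((x₁ + y) * u - x₁) - ((x₂ + y) * u - x₂)
      lem = solve-∀

  isConnectionSet : IsConnectionSet T
  isConnectionSet = 0∉T , neg-closed
    where
    0∉T : ¬ [ 0 ] ∈ T
    0∉T 0∈T with mem⁻ 0∈T
    ... | k , eq = 0-not-invertible 1<n (invertible-^ k G-inv) (≈-trans (≈-sym eq) (val-[] 0))
    neg-closed : ∀ x → x ∈ T → (-ₙ x) ∈ T
    neg-closed x x∈T with mem⁻ x∈T
    ... | k , eq = mem⁺ (c ℕ.+ k) (begin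
      val (-ₙ x)           ≈⟨ val-neg x ⟩
      - val x              ≈⟨ -‿cong eq ⟩
      - G ^ᶻ k             ≡⟨ lem (G ^ᶻ k) ⟩
      - (+ 1) * G ^ᶻ k     ≈⟨ *-cong (≈-sym G^c≈-1) ≈-refl ⟩
      G ^ᶻ c * G ^ᶻ k      ≡⟨ sym (ℤₚ.^-distribˡ-+-* G c k) ⟩
      G ^ᶻ (c ℕ.+ k)       ∎)
      where
      open ≈-Reasoning n
      lem : ∀ x → - x ≡ - (+ 1) * x
      lem = solve-∀

  power : Fin d → Fin n
  power j = g ^ₙ toℕ j

  power-injective : ∀ i j → power i ≡ power j → i ≡ j
  power-injective i j eq = Fₚ.toℕ-injective
    (^-injective (rotor-hasOrder 1<n 0<d rotor) (Fₚ.toℕ<n i) (Fₚ.toℕ<n j) (to-≈ (val-^ g (toℕ i)) (val-^ g (toℕ j)) eq))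

  power-onto : ∀ {x} → x ∈ T → ∃ λ j → power j ≡ x
  power-onto {x} x∈T with mem⁻ x∈T
  ... | k , eq = fromℕ< k%d<d , from-≈ (val-^ g (toℕ (fromℕ< k%d<d))) (≈-trans eq (^-% d (proj₁ rotor) k))
                  (≈-reflexive (cong (G ^ᶻ_) (Fₚ.toℕ-fromℕ< k%d<d)))
    where
    instance _ = ℕ.>-nonZero 0<d
    k%d<d = ℕ÷.m%n<n k d

  ∣T∣≡d : ∣ T ∣ ≡ d
  ∣T∣≡d = ℕₚ.≤-antisym (∣∣-≤ T power power-onto) (∣∣-≥ T power power-injective (g^∈T ∘ toℕ))

  isFirstKindFrobenius : IsFirstKindFrobenius T T
  isFirstKindFrobenius = isUnitSubgroup , isFrobenius , isConnectionSet , gen-all T (gen-mem 1∈T) ,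
    [ 1 ] , orbit , inj₁ (subst (2 ∣_) (sym ∣T∣≡d) 2∣d)
    where
    1*≡ : ∀ u → u ≡ [ 1 ] *ₙ u
    1*≡ u = from-≈ ≈-refl (≈-trans (val-* [ 1 ] u) (*-cong (val-[] 1) ≈-refl)) (≈-reflexive (sym (ℤₚ.*-identityˡ (val u))))
    orbit : IsOrbit T T [ 1 ]
    orbit x = mk⇔ (λ x∈T → x , x∈T , 1*≡ x) (λ (u , u∈T , x≡) → subst (_∈ T) (trans (1*≡ u) (sym x≡)) u∈T)

  -- Multiplication by `g⁻¹`; the exponent is written `1 ℕ.* (d ∸ 1)` to be the one that
  -- `rotor-inverse` gives for `k = 1`.
  divide : Fin n → Fin n
  divide t = t *ₙ (g ^ₙ (1 ℕ.* (d ∸ 1)))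

  divide-*g : ∀ t → divide t *ₙ g ≡ t
  divide-*g t = from-≈ (≈-trans (val-* (divide t) g) (*-cong (≈-trans (val-* t _) (*-cong (≈-refl {a = val t}) (val-^ g (1 ℕ.* (d ∸ 1))))) ≈-refl))
    ≈-refl (begin
    val t * G⁻¹ * G          ≡⟨ lem (val t) G⁻¹ G ⟩
    val t * (G ^ᶻ 1 * G⁻¹)   ≈⟨ *-cong (≈-refl {a = val t}) (rotor-inverse 1<n 0<d rotor 1) ⟩
    val t * + 1              ≡⟨ ℤₚ.*-identityʳ (val t) ⟩
    val t                    ∎)
    where
    open ≈-Reasoning n
    G⁻¹ = G ^ᶻ (1 ℕ.* (d ∸ 1))
    lem : ∀ t h g → t * h * g ≡ t * (g * + 1 * h)
    lem = solve-∀

  isAutomorphism : IsAutomorphism (_*ₙ g)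
  isAutomorphism = (injective , λ t → divide t , λ { refl → divide-*g t }) , additive
    where
    injective : ∀ {x y} → x *ₙ g ≡ y *ₙ g → x ≡ y
    injective {x} {y} eq = val-injective (*-cancelˡ-≈ G-inv
      (≈-trans (≈-reflexive (ℤₚ.*-comm G (val x))) (≈-trans (to-≈ (val-* x g) (val-* y g) eq) (≈-reflexive (ℤₚ.*-comm (val y) G)))))
    additive : ∀ x y → (x +ₙ y) *ₙ g ≡ (x *ₙ g) +ₙ (y *ₙ g)
    additive x y = from-≈ (≈-trans (val-* (x +ₙ y) g) (*-cong (val-+ x y) ≈-refl))
      (≈-trans (val-+ (x *ₙ g) (y *ₙ g)) (+-cong (val-* x g) (val-* y g))) (≈-reflexive (ℤₚ.*-distribʳ-+ G (val x) (val y)))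

  isCompleteRotation : IsCompleteRotation (_*ₙ g) T
  isCompleteRotation = *g∈T , (λ t t∈T → divide t , divide∈T t t∈T , divide-*g t) , [ 1 ] , 1∈T , cycle
    where
    divide∈T : ∀ t → t ∈ T → divide t ∈ T
    divide∈T t t∈T = proj₁ (proj₂ (proj₂ isUnitSubgroup)) t _ t∈T (g^∈T (1 ℕ.* (d ∸ 1)))
    cycle : ∀ t → t ∈ T → ∃ λ k → k < ∣ T ∣ × iter (_*ₙ g) k [ 1 ] ≡ t
    cycle t t∈T with power-onto t∈T
    ... | j , eq = toℕ j , subst (toℕ j <_) (sym ∣T∣≡d) (Fₚ.toℕ<n j) , eq

  isRFFC : IsRFFC d T
  isRFFC = (T , isFirstKindFrobenius) , ((_*ₙ g) , isAutomorphism , isCompleteRotation) , ∣T∣≡d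

-- Rotational first-kind Frobenius circulants are cosets

record RotorCoset {n : ℕ} .{{_ : NonZero n}} (d : ℕ) (S : Subset n) : Set where
  field
    generator representative  : Fin n
    0<d                       : 0 < d
    2∣d                       : 2 ∣ d
    2∤n                       : ¬ 2 ∣ n
    rotor                     : Rotor n d (val generator)
    representative-invertible : Invertible n (val representative)
    ∈⇒coset : ∀ {x} → x ∈ S → ∃ λ k → k < d × val x ≈ val representative * val generator ^ᶻ k [mod n ]
    coset⇒∈ : ∀ {x} k → val x ≈ val representative * val generator ^ᶻ k [mod n ] → x ∈ S

additive⇒* : ∀ {n} .{{_ : NonZero n}} (ω : Fin n → Fin n) → (∀ x y → ω (x +ₙ y) ≡ ω x +ₙ ω y) →
             ∀ x → val (ω x) ≈ val x * val (ω [ 1 ]) [mod n ]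
additive⇒* {n} ω additive x = subst (λ y → val (ω y) ≈ val x * val (ω [ 1 ]) [mod n ])
  (from-≈ (val-[] (toℕ x)) ≈-refl ≈-refl) (multiple (toℕ x))
  where
  open ≈-Reasoning n
  lem : ∀ a → a ≡ a + a - a
  lem = solve-∀
  lem′ : ∀ m g → m * g + g ≡ (+ 1 + m) * g
  lem′ = solve-∀
  multiple : ∀ m → val (ω [ m ]) ≈ + m * val (ω [ 1 ]) [mod n ]
  multiple zero = begin
    val (ω [ 0 ])                                    ≡⟨ lem (val (ω [ 0 ])) ⟩
    val (ω [ 0 ]) + val (ω [ 0 ]) - val (ω [ 0 ])    ≈⟨ ≈⇒-≈0 (to-≈ (val-+ (ω [ 0 ]) (ω [ 0 ])) (≈-refl {a = val (ω [ 0 ])}) ω0+ω0≡ω0) ⟩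
    + 0                                              ≡⟨ sym (ℤₚ.*-zeroˡ (val (ω [ 1 ]))) ⟩
    + 0 * val (ω [ 1 ])                              ∎
    where
    ω0+ω0≡ω0 : ω [ 0 ] +ₙ ω [ 0 ] ≡ ω [ 0 ]
    ω0+ω0≡ω0 = trans (sym (additive [ 0 ] [ 0 ]))
      (cong ω (from-≈ (≈-trans (val-+ [ 0 ] [ 0 ]) (+-cong (val-[] 0) (val-[] 0))) (val-[] 0) ≈-refl))
  multiple (suc m) = begin
    val (ω [ suc m ])                       ≡⟨ cong (val ∘ ω) [1+m]≡[m]+[1] ⟩
    val (ω ([ m ] +ₙ [ 1 ]))                ≡⟨ cong val (additive [ m ] [ 1 ]) ⟩
    val (ω [ m ] +ₙ ω [ 1 ])                ≈⟨ val-+ (ω [ m ]) (ω [ 1 ]) ⟩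
    val (ω [ m ]) + val (ω [ 1 ])           ≈⟨ +-cong (multiple m) ≈-refl ⟩
    + m * val (ω [ 1 ]) + val (ω [ 1 ])     ≡⟨ lem′ (+ m) (val (ω [ 1 ])) ⟩
    + suc m * val (ω [ 1 ])                 ∎
    where
    [1+m]≡[m]+[1] : [ suc m ] ≡ [ m ] +ₙ [ 1 ]
    [1+m]≡[m]+[1] = from-≈ (val-[] (suc m)) (≈-trans (val-+ [ m ] [ 1 ]) (+-cong (val-[] m) (val-[] 1)))
      (≈-reflexive (ℤₚ.+-comm (+ 1) (+ m)))

module _ {n d : ℕ} .{{n≢0 : NonZero n}} (3≤n : 3 ≤ n) {S : Subset n} where

  -- The rotation describes `S` as `s⟨g⟩`, the Frobenius structure as `a H`. With `s = a u₀` these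
  -- force `H = ⟨g⟩`, and the fixed-point condition on `H` then applies to the powers of `g`.
  RFFC⇒rotorCoset : IsRFFC d S → RotorCoset d S
  RFFC⇒rotorCoset ((H , (units , 1∈H , closed , inverses) , (_ , _ , two-fixed-points) , (_ , neg-closed) , generates , a , orbit , even) ,
                   (ω , ((_ , ω-surj) , additive) , ω-closed , _ , s , s∈S , cycle) , ∣S∣≡d) = record
    { generator = g ; representative = s ; 0<d = 0<d ; 2∣d = 2∣d ; 2∤n = 2∤n ; rotor = G^d≈1 , nontrivial-invertible
    ; representative-invertible = s-inv ; ∈⇒coset = ∈⇒coset ; coset⇒∈ = coset⇒∈ }
    where
    open ≈-Reasoning n
    g = ω [ 1 ]
    G = val g

    G-inv : Invertible n G
    G-inv with ω-surj [ 1 ]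
    ... | x , ωx≡1 = val x , to-≈ (additive⇒* ω additive x) (val-[] 1) (ωx≡1 refl)

    val-ω^ : ∀ k x → val (iter ω k x) ≈ val x * G ^ᶻ k [mod n ]
    val-ω^ = val-iter ω (additive⇒* ω additive)

    ω^s∈S : ∀ k → iter ω k s ∈ S
    ω^s∈S zero = s∈S
    ω^s∈S (suc k) = ω-closed _ (ω^s∈S k)

    ∈⇒coset : ∀ {x} → x ∈ S → ∃ λ k → k < d × val x ≈ val s * G ^ᶻ k [mod n ]
    ∈⇒coset {x} x∈S with cycle x x∈S
    ... | k , k<∣S∣ , eq = k , subst (k <_) ∣S∣≡d k<∣S∣ , ≈-trans (≈-reflexive (cong val (sym eq))) (val-ω^ k s)

    coset⇒∈ : ∀ {x} k → val x ≈ val s * G ^ᶻ k [mod n ] → x ∈ S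
    coset⇒∈ k eq = subst (_∈ S) (sym (from-≈ eq (val-ω^ k s) ≈-refl)) (ω^s∈S k)

    orbit⁻ : ∀ {x} → x ∈ S → ∃ λ u → u ∈ H × val x ≈ val a * val u [mod n ]
    orbit⁻ {x} x∈S with Equivalence.to (orbit x) x∈S
    ... | u , u∈H , x≡ = u , u∈H , ≈-trans (≈-reflexive (cong val x≡)) (val-* a u)

    -- A common divisor of `a` and `n` divides every element generated by `S`, in particular 1.
    a-inv : Invertible n (val a)
    a-inv = coprime⇒invertible (val a) λ {c} (c∣a , c∣n) →
      ℕ∣.∣1⇒≡1 (≈0⇒∣ (≈-trans (≈-weaken c∣n (≈-sym (val-[] 1))) (gen≈0 c∣n (pos-∣⇒≈0 c∣a) (generates [ 1 ]))))
      where
      gen≈0 : ∀ {c} → c ∣ n → val a ≈ + 0 [mod c ] → ∀ {x} → Gen S x → val x ≈ + 0 [mod c ]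
      gen≈0 c∣n a≈0 gen-zero = ≈-weaken c∣n (val-[] 0)
      gen≈0 c∣n a≈0 (gen-mem x∈S) with orbit⁻ x∈S
      ... | u , _ , x≈au = ≈-trans (≈-weaken c∣n x≈au) (≈-trans (*-cong a≈0 ≈-refl) (≈-reflexive (ℤₚ.*-zeroˡ (val u))))
      gen≈0 c∣n a≈0 (gen-add {x} {y} p q) = ≈-trans (≈-weaken c∣n (val-+ x y)) (+-cong (gen≈0 c∣n a≈0 p) (gen≈0 c∣n a≈0 q))
      gen≈0 c∣n a≈0 (gen-neg {x} p) = ≈-trans (≈-weaken c∣n (val-neg x)) (-‿cong (gen≈0 c∣n a≈0 p))

    u₀ = proj₁ (orbit⁻ s∈S)
    u₀∈H = proj₁ (proj₂ (orbit⁻ s∈S))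
    s≈au₀ = proj₂ (proj₂ (orbit⁻ s∈S))

    u₀-inv : Invertible n (val u₀)
    u₀-inv = coprime⇒invertible (val u₀) (units u₀ u₀∈H)

    s-inv : Invertible n (val s)
    s-inv = invertible-resp (≈-sym s≈au₀) (invertible-* a-inv u₀-inv)

    0<d : 0 < d
    0<d with ∈⇒coset s∈S
    ... | k , k<d , _ = ℕₚ.≤-<-trans z≤n k<d

    -- If `g^k = 1`, the rotation reaches at most `k < d` elements of `S`.
    minimal : ∀ k → 0 < k → k < d → ¬ G ^ᶻ k ≈ + 1 [mod n ]
    minimal k@(suc _) 0<k k<d G^k≈1 = ℕₚ.<⇒≱ k<d (subst (_≤ k) ∣S∣≡d (∣∣-≤ S (λ j → iter ω (toℕ j) s) onto))
      where
      onto : ∀ {x} → x ∈ S → ∃ λ j → iter ω (toℕ j) s ≡ x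
      onto x∈S with ∈⇒coset x∈S
      ... | i , _ , x≈ = fromℕ< (ℕ÷.m%n<n i k) , from-≈ (val-ω^ (toℕ (fromℕ< (ℕ÷.m%n<n i k))) s) x≈
        (*-cong (≈-refl {a = val s}) (≈-trans (≈-reflexive (cong (G ^ᶻ_) (Fₚ.toℕ-fromℕ< (ℕ÷.m%n<n i k)))) (≈-sym (^-% k G^k≈1 i))))

    -- `ω^d s` lies in `S`, so it equals `ω^k s` for some `k < d`; a positive `k` would give
    -- `g^(d-k) = 1`, against minimality.
    G^d≈1 : G ^ᶻ d ≈ + 1 [mod n ]
    G^d≈1 with ∈⇒coset (ω^s∈S d)
    ... | k , k<d , eq = aux k k<d (*-cancelˡ-≈ s-inv (≈-trans (≈-sym (val-ω^ d s)) eq))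
      where
      aux : ∀ k → k < d → G ^ᶻ d ≈ G ^ᶻ k [mod n ] → G ^ᶻ d ≈ + 1 [mod n ]
      aux zero _ eq = eq
      aux k@(suc _) k<d eq = contradiction G^[d-k]≈1 (minimal (d ∸ k) (ℕₚ.m<n⇒0<n∸m k<d) (ℕₚ.∸-monoʳ-< {d} (s≤s z≤n) (ℕₚ.<⇒≤ k<d)))
        where
        G^[d-k]≈1 : G ^ᶻ (d ∸ k) ≈ + 1 [mod n ]
        G^[d-k]≈1 = *-cancelˡ-≈ (invertible-^ k G-inv) (begin
          G ^ᶻ k * G ^ᶻ (d ∸ k)    ≡⟨ sym (ℤₚ.^-distribˡ-+-* G k (d ∸ k)) ⟩
          G ^ᶻ (k ℕ.+ (d ∸ k))     ≡⟨ cong (G ^ᶻ_) (ℕₚ.m+[n∸m]≡n (ℕₚ.<⇒≤ k<d)) ⟩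
          G ^ᶻ d                   ≈⟨ eq ⟩
          G ^ᶻ k                   ≡⟨ sym (ℤₚ.*-identityʳ _) ⟩
          G ^ᶻ k * + 1             ∎)

    -- `s g^k = a u` with `u ∈ H`, and `s = a u₀`, so `g^k = u u₀⁻¹`.
    g^∈H : ∀ k → (g ^ₙ k) ∈ H
    g^∈H k with orbit⁻ (ω^s∈S k) | inverses u₀ u₀∈H
    ... | u , u∈H , ω^s≈au | v , v∈H , u₀v≡1 = subst (_∈ H) (from-≈ (val-* u v) (val-^ g k) (begin
      val u * val v                     ≈⟨ *-cong u≈ ≈-refl ⟩
      val u₀ * G ^ᶻ k * val v           ≡⟨ lem (val u₀) (G ^ᶻ k) (val v) ⟩
      val u₀ * val v * G ^ᶻ k           ≈⟨ *-cong (to-≈ (val-* u₀ v) (val-[] 1) u₀v≡1) ≈-refl ⟩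
      + 1 * G ^ᶻ k                      ≡⟨ ℤₚ.*-identityˡ _ ⟩
      G ^ᶻ k                            ∎)) (closed u v u∈H v∈H)
      where
      lem : ∀ u p v → u * p * v ≡ u * v * p
      lem = solve-∀
      u≈ : val u ≈ val u₀ * G ^ᶻ k [mod n ]
      u≈ = *-cancelˡ-≈ a-inv (begin
        val a * val u                 ≈⟨ ≈-sym ω^s≈au ⟩
        val (iter ω k s)              ≈⟨ val-ω^ k s ⟩
        val s * G ^ᶻ k                ≈⟨ *-cong s≈au₀ ≈-refl ⟩
        val a * val u₀ * G ^ᶻ k       ≡⟨ ℤₚ.*-assoc (val a) (val u₀) (G ^ᶻ k) ⟩
        val a * (val u₀ * G ^ᶻ k)     ∎)

    -- Conversely `a u₀ u = s u` lies in `S`, which makes `u` a power of `g`.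
    H-power : ∀ {u} → u ∈ H → ∃ λ (j : Fin d) → g ^ₙ toℕ j ≡ u
    H-power {u} u∈H with ∈⇒coset (Equivalence.from (orbit (a *ₙ (u₀ *ₙ u))) (u₀ *ₙ u , closed u₀ u u₀∈H u∈H , refl))
    ... | k , k<d , eq = fromℕ< k<d , from-≈ (val-^ g (toℕ (fromℕ< k<d))) ≈-refl
      (≈-trans (≈-reflexive (cong (G ^ᶻ_) (Fₚ.toℕ-fromℕ< k<d))) (≈-sym (*-cancelˡ-≈ s-inv (begin
        val s * val u                   ≈⟨ *-cong s≈au₀ ≈-refl ⟩
        val a * val u₀ * val u          ≡⟨ ℤₚ.*-assoc (val a) (val u₀) (val u) ⟩
        val a * (val u₀ * val u)        ≈⟨ ≈-sym (≈-trans (val-* a (u₀ *ₙ u)) (*-cong (≈-refl {a = val a}) (val-* u₀ u))) ⟩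
        val (a *ₙ (u₀ *ₙ u))            ≈⟨ eq ⟩
        val s * G ^ᶻ k                  ∎))))

    ∣H∣≡d : ∣ H ∣ ≡ d
    ∣H∣≡d = ℕₚ.≤-antisym (∣∣-≤ H (λ j → g ^ₙ toℕ j) H-power) (∣∣-≥ H (λ j → g ^ₙ toℕ j)
      (λ i j eq → Fₚ.toℕ-injective (^-injective (hasOrder d 0<d G^d≈1 minimal) (Fₚ.toℕ<n i) (Fₚ.toℕ<n j) (to-≈ (val-^ g (toℕ i)) (val-^ g (toℕ j)) eq)))
      (λ j → g^∈H (toℕ j)))

    n∤2 : ¬ + 2 ≈ + 0 [mod n ]
    n∤2 eq = ℕₚ.<⇒≱ 3≤n (ℕ∣.∣⇒≤ (≈0⇒∣ eq))

    2∣d : 2 ∣ d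
    2∣d = even-or-involution even
      where
      lem : ∀ a → a * + 2 ≡ a + a
      lem = solve-∀
      even-or-involution : 2 ∣ ∣ H ∣ ⊎ IsInvolution a → 2 ∣ d
      even-or-involution (inj₁ 2∣∣H∣) = subst (2 ∣_) ∣H∣≡d 2∣∣H∣
      -- `a` is a unit, so `2 a = 0` would give `n ∣ 2`, against `3 ≤ n`.
      even-or-involution (inj₂ (_ , a+a≡0)) = contradiction (*-cancelˡ-≈ a-inv (≈-trans (≈-reflexive (lem (val a)))
        (≈-trans (to-≈ (val-+ a a) (val-[] 0) a+a≡0) (≈-reflexive (sym (ℤₚ.*-zeroʳ (val a))))))) n∤2

    nontrivial-invertible : ∀ k → 0 < k → k < d → Invertible n (G ^ᶻ k - + 1)
    nontrivial-invertible k 0<k k<d = coprime⇒invertible (G ^ᶻ k - + 1) no-common-divisor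
      where
      -- If `c` divides `g^k - 1` and `n = m c`, multiplication by `g^k` fixes both `m` and 0. As
      -- `g^k ≠ 1`, the Frobenius condition gives `m ≡ 0` modulo `n`, that is `c = 1`.
      no-common-divisor : Coprime ℤ.∣ G ^ᶻ k - + 1 ∣ n
      no-common-divisor {c} (c∣ , divides m n≡mc) with [ m ] Fₚ.≟ [ 0 ]
      ... | yes [m]≡0 = c≡1 m c n≡mc (≈0⇒∣ (to-≈ (val-[] m) (val-[] 0) [m]≡0))
        where
        c≡1 : ∀ m c → n ≡ m ℕ.* c → n ∣ m → c ≡ 1
        c≡1 zero c eq _ = contradiction eq (ℕ.≢-nonZero⁻¹ n)
        c≡1 (suc m) zero eq _ = contradiction (trans eq (ℕₚ.*-zeroʳ m)) (ℕ.≢-nonZero⁻¹ n)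
        c≡1 (suc m) (suc zero) eq _ = refl
        c≡1 (suc m) (suc (suc c)) eq n∣m = contradiction (ℕ∣.∣⇒≤ n∣m)
          (ℕₚ.<⇒≱ (subst (suc m <_) (sym eq) (ℕₚ.m<m*n (suc m) (suc (suc c)) (s≤s (s≤s z≤n)))))
      ... | no [m]≢0 = contradiction (to-≈ (val-^ g k) (val-[] 1) (proj₂ (two-fixed-points [ 0 ] (g ^ₙ k) (g^∈H k) [ m ] [ 0 ] [m]≢0 fix-m fix-0)))
                         (minimal k 0<k k<d)
        where
        val-aff : ∀ m → val (aff [ 0 ] (g ^ₙ k) [ m ]) ≈ (+ m + + 0) * G ^ᶻ k [mod n ]
        val-aff m = ≈-trans (val-* ([ m ] +ₙ [ 0 ]) (g ^ₙ k)) (*-cong (≈-trans (val-+ [ m ] [ 0 ]) (+-cong (val-[] m) (val-[] 0))) (val-^ g k))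
        fix-0 : aff [ 0 ] (g ^ₙ k) [ 0 ] ≡ [ 0 ]
        fix-0 = from-≈ (val-aff 0) (val-[] 0) (≈-reflexive (ℤₚ.*-zeroˡ (G ^ᶻ k)))
        fix-m : aff [ 0 ] (g ^ₙ k) [ m ] ≡ [ m ]
        fix-m = from-≈ (val-aff m) (val-[] m) (-≈0⇒≈ (≈-trans (≈-reflexive (lem (+ m) (G ^ᶻ k)))
          (subst (λ t → + m * (G ^ᶻ k - + 1) ≈ + 0 [mod t ]) (sym n≡mc) (*-≈0 {m} {c} {+ m} {G ^ᶻ k - + 1} n≈0 (∣⇒≈0 c∣)))))
          where
          lem : ∀ m p → (m + + 0) * p - m ≡ m * (p - + 1)
          lem = solve-∀

    -- `- s ∈ S` makes `-1` a power `g^k` with `0 < k < d`, so `g^k - 1 = -2` would be a unit modulo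
    -- the divisor 2 of `n`.
    2∤n : ¬ 2 ∣ n
    2∤n 2∣n with ∈⇒coset (neg-closed s s∈S)
    ... | k , k<d , eq = aux k k<d (*-cancelˡ-≈ s-inv (≈-trans (≈-sym eq) (≈-trans (val-neg s) (≈-reflexive (lem (val s))))))
      where
      lem : ∀ x → - x ≡ x * - (+ 1)
      lem = solve-∀
      aux : ∀ k → k < d → ¬ G ^ᶻ k ≈ - (+ 1) [mod n ]
      aux zero _ 1≈-1 = n∤2 (≈⇒-≈0 1≈-1)
      aux k@(suc _) k<d G^k≈-1 = 0-not-invertible (s≤s (s≤s z≤n))
        (invertible-weaken 2∣n (invertible-resp (minus-cong G^k≈-1 ≈-refl) (nontrivial-invertible k (s≤s z≤n) k<d)))
        (∣⇒≈0 (divides 1 refl))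

-- Adjacency operators

sumZ-permute : ∀ {d} (f : Fin d → ℤ) (π ρ : Fin d → Fin d) → (∀ i → π (ρ i) ≡ i) → (∀ j → ρ (π j) ≡ j) →
               sumZ d f ≡ sumZ d (f ∘ π)
sumZ-permute f π ρ πρ ρπ = trans (sumZ≡sum f)
  (trans (sum-permute f (permutation π ρ πρ ρπ)) (sym (sumZ≡sum (f ∘ π))))
  where
  open CommutativeMonoidSum ℤₚ.+-0-commutativeMonoid using (sum; sum-permute)
  sumZ≡sum : ∀ {l} (f : Fin l → ℤ) → sumZ l f ≡ sum f
  sumZ≡sum {zero} f = refl
  sumZ≡sum {suc l} f = cong (_+_ (f F.zero)) (sumZ≡sum (f ∘ F.suc))

-- Additive maps on integer functions, with equality taken pointwise: `resp` makes composition
-- respect it, `additive` gives left distributivity, and `null` gives annihilation by zero on the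
-- right.
record Operator (X : Set) : Set where
  field
    apply    : (X → ℤ) → X → ℤ
    resp     : ∀ {u v} → (∀ x → u x ≡ v x) → ∀ x → apply u x ≡ apply v x
    additive : ∀ u v x → apply (λ y → u y + v y) x ≡ apply u x + apply v x
    null     : ∀ x → apply (λ _ → + 0) x ≡ + 0

open Operator

operatorSemiring : Set → Semiring _ _
operatorSemiring X = record
  { Carrier = Operator X
  ; _≈_ = λ f g → ∀ u x → apply f u x ≡ apply g u x
  ; _+_ = λ f g → record
      { apply = λ u x → apply f u x + apply g u x
      ; resp = λ u≗v x → cong₂ _+_ (resp f u≗v x) (resp g u≗v x)
      ; additive = λ u v x → trans (cong₂ _+_ (additive f u v x) (additive g u v x))
                               (interchange (apply f u x) (apply f v x) (apply g u x) (apply g v x))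
      ; null = λ x → cong₂ _+_ (null f x) (null g x)
      }
  ; _*_ = λ f g → record
      { apply = apply f ∘ apply g
      ; resp = resp f ∘ resp g
      ; additive = λ u v x → trans (resp f (additive g u v) x) (additive f (apply g u) (apply g v) x)
      ; null = λ x → trans (resp f (null g) x) (null f x)
      }
  ; 0# = record { apply = λ _ _ → + 0 ; resp = λ _ _ → refl ; additive = λ _ _ _ → refl ; null = λ _ → refl }
  ; 1# = record { apply = id ; resp = id ; additive = λ _ _ _ → refl ; null = λ _ → refl }
  ; isSemiring = record
    { isSemiringWithoutAnnihilatingZero = record
      { +-isCommutativeMonoid = record
        { isMonoid = record
          { isSemigroup = record
            { isMagma = record
              { isEquivalence = record
                { refl = λ _ _ → refl
                ; sym = λ f≈g u x → sym (f≈g u x)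
                ; trans = λ f≈g g≈h u x → trans (f≈g u x) (g≈h u x)
                }
              ; ∙-cong = λ f≈f′ g≈g′ u x → cong₂ _+_ (f≈f′ u x) (g≈g′ u x)
              }
            ; assoc = λ f g h u x → ℤₚ.+-assoc (apply f u x) (apply g u x) (apply h u x)
            }
          ; identity = (λ f u x → ℤₚ.+-identityˡ (apply f u x)) , (λ f u x → ℤₚ.+-identityʳ (apply f u x))
          }
        ; comm = λ f g u x → ℤₚ.+-comm (apply f u x) (apply g u x)
        }
      ; *-cong = λ {f} {f′} {g} {g′} f≈f′ g≈g′ u x → trans (resp f (g≈g′ u) x) (f≈f′ (apply g′ u) x)
      ; *-assoc = λ _ _ _ _ _ → refl
      ; *-identity = (λ _ _ _ → refl) , (λ _ _ _ → refl)
      ; distrib = (λ f g h u x → additive f (apply g u) (apply h u) x) , (λ _ _ _ _ _ → refl)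
      }
    ; zero = (λ _ _ _ → refl) , (λ f _ x → null f x)
    }
  }
  where
  interchange : ∀ a b c d → a + b + (c + d) ≡ a + c + (b + d)
  interchange = solve-∀

module _ {n : ℕ} .{{_ : NonZero n}} where

  scale : ℕ → Fin n → Fin n
  scale m x = [ m ℕ.* toℕ x ]

  val-scale : ∀ m x → val (scale m x) ≈ + m * val x [mod n ]
  val-scale m x = ≈-trans (val-[] (m ℕ.* toℕ x)) (≈-reflexive (ℤₚ.pos-* m (toℕ x)))

  scale-1 : ∀ x → scale 1 x ≡ x
  scale-1 x = from-≈ (val-scale 1 x) ≈-refl (≈-reflexive (ℤₚ.*-identityˡ (val x)))

  scale-scale : ∀ k m x → scale k (scale m x) ≡ scale (k ℕ.* m) x
  scale-scale k m x = from-≈ (≈-trans (val-scale k (scale m x)) (*-cong (≈-refl {a = + k}) (val-scale m x)))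
    (val-scale (k ℕ.* m) x) (≈-reflexive (trans (sym (ℤₚ.*-assoc (+ k) (+ m) (val x))) (cong (_* val x) (sym (ℤₚ.pos-* k m)))))

  x-[x-y]≡y : ∀ (x y : Fin n) → x -ₙ (x -ₙ y) ≡ y
  x-[x-y]≡y x y = from-≈ (≈-trans (val-minus x (x -ₙ y)) (+-cong (≈-refl {a = val x}) (-‿cong (val-minus x y)))) ≈-refl
    (≈-reflexive (lem (val x) (val y)))
    where
    lem : ∀ x y → x - (x - y) ≡ y
    lem = solve-∀

  x-y≡z⇒x-z≡y : ∀ {x y z : Fin n} → x -ₙ y ≡ z → x -ₙ z ≡ y
  x-y≡z⇒x-z≡y {x} {y} refl = x-[x-y]≡y x y

  -ₙ-cancelˡ : ∀ (x : Fin n) {y z} → x -ₙ y ≡ x -ₙ z → y ≡ z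
  -ₙ-cancelˡ x {y} {z} eq = trans (sym (x-[x-y]≡y x y)) (x-y≡z⇒x-z≡y (sym eq))

  private
    module S = Semiring (operatorSemiring (Fin n))
    open SemiringSum (operatorSemiring (Fin n)) using (sum)
    open SemiringExp (operatorSemiring (Fin n)) using () renaming (_^_ to _^ˢ_)
    open SemiringMult (operatorSemiring (Fin n)) using () renaming (_×_ to _·_)

  translation : Fin n → Operator (Fin n)
  translation a = record
    { apply = λ u x → u (x -ₙ a) ; resp = λ u≗v x → u≗v (x -ₙ a) ; additive = λ _ _ _ → refl ; null = λ _ → refl }

  -- The adjacency operator of Cay(Z_n, {s j}).
  adjacency : ∀ {d} → (Fin d → Fin n) → Operator (Fin n)
  adjacency s = sum (translation ∘ s)

  adjacency-sumZ : ∀ {d} (s : Fin d → Fin n) u x → apply (adjacency s) u x ≡ sumZ d (λ j → u (x -ₙ s j))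
  adjacency-sumZ {zero} s u x = refl
  adjacency-sumZ {suc d} s u x = cong (_+_ (u (x -ₙ s F.zero))) (adjacency-sumZ (s ∘ F.suc) u x)

  translation-comm : ∀ a b → translation a S.* translation b S.≈ translation b S.* translation a
  translation-comm a b u x = cong u (from-≈ (val-minus₂ a b) (val-minus₂ b a) (≈-reflexive (lem (val x) (val a) (val b))))
    where
    lem : ∀ x a b → x - a - b ≡ x - b - a
    lem = solve-∀
    val-minus₂ : ∀ a b → val (x -ₙ a -ₙ b) ≈ val x - val a - val b [mod n ]
    val-minus₂ a b = ≈-trans (val-minus (x -ₙ a) b) (+-cong (val-minus x a) (≈-refl {a = - val b}))

  translation-adjacency-comm : ∀ {d} a (s : Fin d → Fin n) →
    translation a S.* adjacency s S.≈ adjacency s S.* translation a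
  translation-adjacency-comm {zero} a s u x = refl
  translation-adjacency-comm {suc d} a s u x =
    cong₂ _+_ (translation-comm a (s F.zero) u x) (translation-adjacency-comm a (s ∘ F.suc) u x)

  translation-^ : ∀ a k → translation a ^ˢ k S.≈ translation (scale k a)
  translation-^ a zero u x = cong u (from-≈ ≈-refl (≈-trans (val-minus x (scale 0 a))
    (+-cong (≈-refl {a = val x}) (-‿cong (val-[] 0)))) (≈-reflexive (sym (ℤₚ.+-identityʳ (val x)))))
  translation-^ a (suc k) u x = trans (translation-^ a k u (x -ₙ a)) (cong u (from-≈
    (≈-trans (val-minus (x -ₙ a) (scale k a)) (+-cong (val-minus x a) (-‿cong (val-scale k a))))
    (≈-trans (val-minus x (scale (suc k) a)) (+-cong (≈-refl {a = val x}) (-‿cong (val-scale (suc k) a))))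
    (≈-reflexive (lem (val x) (val a) (+ k)))))
    where
    lem : ∀ x a k → x - a - k * a ≡ x - (+ 1 + k) * a
    lem = solve-∀

  -- Translations commute and the q-th power of translation by `a` is translation by `q a`, so
  -- splitting off one translation at a time with `^-+-prime` leaves only multiples of `q` as error.
  adjacency-^-prime : ∀ {q d} → Prime q → (s : Fin d → Fin n) →
    ∃ λ w → adjacency s ^ˢ q S.≈ adjacency (scale q ∘ s) S.+ q · w
  adjacency-^-prime {suc q-1} {zero} pq s = S.0# , λ u x → sym (trans (ℤₚ.+-identityˡ _) (·0 (suc q-1) u x))
    where
    ·0 : ∀ k u x → apply (k · S.0#) u x ≡ + 0
    ·0 zero u x = refl
    ·0 (suc k) u x = trans (ℤₚ.+-identityˡ _) (·0 k u x)
  adjacency-^-prime {q} {suc d} pq s = w S.+ w′ , λ u x → trans (proj₂ split u x)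
    (trans (cong₂ (λ a b → a + b + apply (q · w′) u x) (translation-^ (s F.zero) q u x) (proj₂ rest u x))
      (trans (lem (u (x -ₙ scale q (s F.zero))) (apply (adjacency (scale q ∘ s ∘ F.suc)) u x) (apply (q · w) u x) (apply (q · w′) u x))
        (cong (_+_ (u (x -ₙ scale q (s F.zero)) + apply (adjacency (scale q ∘ s ∘ F.suc)) u x))
          (sym (×-distrib-+ w w′ q u x)))))
    where
    open CommutativeMonoidMult (Semiring.+-commutativeMonoid (operatorSemiring (Fin n))) using (×-distrib-+)
    rest = adjacency-^-prime pq (s ∘ F.suc)
    split = Frobenius.^-+-prime (operatorSemiring (Fin n)) pq (translation (s F.zero)) (adjacency (s ∘ F.suc))
              (translation-adjacency-comm (s F.zero) (s ∘ F.suc))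
    w = proj₁ rest
    w′ = proj₁ split
    lem : ∀ t a w w′ → t + (a + w) + w′ ≡ t + a + (w + w′)
    lem = solve-∀

  adjacency-^-prime-≈ : ∀ {q d} → Prime q → (s : Fin d → Fin n) → ∀ u x →
    apply (adjacency s ^ˢ q) u x ≈ sumZ d (λ j → u (x -ₙ scale q (s j))) [mod q ]
  adjacency-^-prime-≈ {q} {d} pq s u x = mod-by (apply w u x) (trans (proj₂ (adjacency-^-prime pq s) u x)
    (cong₂ _+_ (adjacency-sumZ (scale q ∘ s) u x) (trans (·-* q) (ℤₚ.*-comm (+ q) _))))
    where
    w = proj₁ (adjacency-^-prime pq s)
    lem : ∀ w k → w + k * w ≡ (+ 1 + k) * w
    lem = solve-∀
    ·-* : ∀ k → apply (k · w) u x ≡ + k * apply w u x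
    ·-* zero = sym (ℤₚ.*-zeroˡ (apply w u x))
    ·-* (suc k) = trans (cong (_+_ (apply w u x)) (·-* k)) (lem (apply w u x) (+ k))

  -- Connection sets appear as indexed families: an adjacency operator is a sum over the indices,
  -- and multiplying the set by `m` is composition with `scale m`.
  Sends : (Fin n → Fin n) → ∀ {d} → (s t : Fin d → Fin n) → Set
  Sends f s t = ∀ {x y} → (∃ λ j → x -ₙ y ≡ s j) → ∃ λ j → f x -ₙ f y ≡ t j

  Distinct : ∀ {d} → (Fin d → Fin n) → Set
  Distinct s = ∀ i j → s i ≡ s j → i ≡ j

  module _ (f f⁻¹ : Fin n → Fin n) (f∘f⁻¹ : ∀ x → f (f⁻¹ x) ≡ x) (f⁻¹∘f : ∀ x → f⁻¹ (f x) ≡ x) where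

    -- `f` matches the neighbours `x - s j` of `x` with the neighbours `f x - t i` of `f x`. The
    -- index maps `π` and `ρ` are mutually inverse because neither family repeats an element, so the
    -- two sums have the same terms.
    adjacency-transport : ∀ {d} {s t : Fin d → Fin n} → Distinct s → Distinct t → Sends f s t → Sends f⁻¹ t s →
      ∀ u x → apply (adjacency s) (u ∘ f) x ≡ apply (adjacency t) u (f x)
    adjacency-transport {d} {s} {t} s-distinct t-distinct f-sends f⁻¹-sends u x = begin
      apply (adjacency s) (u ∘ f) x            ≡⟨ adjacency-sumZ s (u ∘ f) x ⟩
      sumZ d (λ j → u (f (x -ₙ s j)))          ≡⟨ sumZ-cong (λ j → cong u (sym (π-spec j))) ⟩
      sumZ d (λ j → u (f x -ₙ t (π j)))        ≡⟨ sym (sumZ-permute (λ i → u (f x -ₙ t i)) π ρ πρ ρπ) ⟩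
      sumZ d (λ i → u (f x -ₙ t i))            ≡⟨ sym (adjacency-sumZ t u (f x)) ⟩
      apply (adjacency t) u (f x)              ∎
      where
      open ≡-Reasoning
      sumZ-cong : ∀ {l} {g h : Fin l → ℤ} → (∀ j → g j ≡ h j) → sumZ l g ≡ sumZ l h
      sumZ-cong {zero} _ = refl
      sumZ-cong {suc l} eq = cong₂ _+_ (eq F.zero) (sumZ-cong (eq ∘ F.suc))
      image : ∀ j → ∃ λ i → f x -ₙ f (x -ₙ s j) ≡ t i
      image j = f-sends (j , x-[x-y]≡y x (s j))
      preimage : ∀ i → ∃ λ j → x -ₙ f⁻¹ (f x -ₙ t i) ≡ s j
      preimage i with f⁻¹-sends {f x} {f x -ₙ t i} (i , x-[x-y]≡y (f x) (t i))
      ... | j , eq = j , trans (cong (_-ₙ f⁻¹ (f x -ₙ t i)) (sym (f⁻¹∘f x))) eq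
      π ρ : Fin d → Fin d
      π j = proj₁ (image j)
      ρ i = proj₁ (preimage i)
      π-spec : ∀ j → f x -ₙ t (π j) ≡ f (x -ₙ s j)
      π-spec j = x-y≡z⇒x-z≡y (proj₂ (image j))
      ρ-spec : ∀ i → x -ₙ s (ρ i) ≡ f⁻¹ (f x -ₙ t i)
      ρ-spec i = x-y≡z⇒x-z≡y (proj₂ (preimage i))
      πρ : ∀ i → π (ρ i) ≡ i
      πρ i = t-distinct _ _ (-ₙ-cancelˡ (f x) (trans (π-spec (ρ i)) (trans (cong f (ρ-spec i)) (f∘f⁻¹ _))))
      ρπ : ∀ j → ρ (π j) ≡ j
      ρπ j = s-distinct _ _ (-ₙ-cancelˡ x (trans (ρ-spec (π j)) (trans (cong f⁻¹ (π-spec j)) (f⁻¹∘f _))))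

    adjacency-^-transport : ∀ {d} {s t : Fin d → Fin n} → Distinct s → Distinct t → Sends f s t → Sends f⁻¹ t s →
      ∀ k u x → apply (adjacency s ^ˢ k) (u ∘ f) x ≡ apply (adjacency t ^ˢ k) u (f x)
    adjacency-^-transport _ _ _ _ zero u x = refl
    adjacency-^-transport {s = s} {t} s-distinct t-distinct f-sends f⁻¹-sends (suc k) u x = trans
      (resp (adjacency s) (adjacency-^-transport s-distinct t-distinct f-sends f⁻¹-sends k u) x)
      (adjacency-transport s-distinct t-distinct f-sends f⁻¹-sends (apply (adjacency t ^ˢ k) u) x)

    -- Modulo q, the q-th power of the adjacency operator of Cay(Z_n, S) is that of Cay(Z_n, q S).
    sends-prime-multiple : ∀ {q d} → Prime q → {s t : Fin d → Fin n} → Distinct s → Distinct t →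
      Distinct (scale q ∘ s) → Sends f s t → Sends f⁻¹ t s → Sends f (scale q ∘ s) (scale q ∘ t)
    sends-prime-multiple {q} {d} pq {s} {t} s-distinct t-distinct qs-distinct f-sends f⁻¹-sends {x} {y} (j , x-y≡qsⱼ)
      with Fₚ.any? (λ i → f x -ₙ f y Fₚ.≟ scale q (t i))
    ... | yes found = found
    ... | no ¬found = contradiction 1≈0 (0-not-invertible (ℕ.nonTrivial⇒n>1 q {{prime⇒nonTrivial pq}}) invertible-1)
      where
      indicator : ∀ {A : Set} → Dec A → ℤ
      indicator (yes _) = + 1
      indicator (no _)  = + 0
      indicator-yes : ∀ {A : Set} (A? : Dec A) → A → indicator A? ≡ + 1
      indicator-yes (yes _) _ = refl
      indicator-yes (no ¬a) a = contradiction a ¬a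
      indicator-no : ∀ {A : Set} (A? : Dec A) → ¬ A → indicator A? ≡ + 0
      indicator-no (yes a) ¬a = contradiction a ¬a
      indicator-no (no _) _ = refl
      -- Test function: at `x` the operator for `q s` counts `j` alone, since `q s` has no
      -- repetitions, while at `f x` the one for `q t` counts nothing unless `f x - f y` is some
      -- `q t i`. The two values agree modulo `q`, so otherwise 1 would be 0.
      δ : Fin n → ℤ
      δ z = indicator (z Fₚ.≟ f y)
      x-qsⱼ≡y : x -ₙ scale q (s j) ≡ y
      x-qsⱼ≡y = x-y≡z⇒x-z≡y x-y≡qsⱼ
      δ-other : ∀ i → i ≢ j → δ (f (x -ₙ scale q (s i))) ≡ + 0
      δ-other i i≢j = indicator-no (_ Fₚ.≟ f y) λ eq → i≢j (qs-distinct i j (-ₙ-cancelˡ x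
        (trans (trans (sym (f⁻¹∘f _)) (trans (cong f⁻¹ eq) (f⁻¹∘f y))) (sym x-qsⱼ≡y))))
      open ≈-Reasoning q
      1≈0 : + 1 ≈ + 0 [mod q ]
      1≈0 = begin
        + 1                                               ≡⟨ sym (indicator-yes (f (x -ₙ scale q (s j)) Fₚ.≟ f y) (cong f x-qsⱼ≡y)) ⟩
        δ (f (x -ₙ scale q (s j)))                        ≈⟨ ≈-sym (sumZ-≈ d _ j (λ i i≢j → ≈-reflexive (δ-other i i≢j))) ⟩
        sumZ d (λ i → δ (f (x -ₙ scale q (s i))))         ≈⟨ ≈-sym (adjacency-^-prime-≈ pq s (δ ∘ f) x) ⟩
        apply (adjacency s ^ˢ q) (δ ∘ f) x                ≡⟨ adjacency-^-transport s-distinct t-distinct f-sends f⁻¹-sends q δ x ⟩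
        apply (adjacency t ^ˢ q) δ (f x)                  ≈⟨ adjacency-^-prime-≈ pq t δ (f x) ⟩
        sumZ d (λ i → δ (f x -ₙ scale q (t i)))           ≈⟨ sumZ-≈0 d _ (λ i → ≈-reflexive
                                                               (indicator-no (_ Fₚ.≟ f y) λ eq → ¬found (i , x-y≡z⇒x-z≡y eq))) ⟩
        + 0                                               ∎

-- Rigidity of isomorphisms

module _ {n : ℕ} .{{_ : NonZero n}} where

  module _ (f f⁻¹ : Fin n → Fin n) (f∘f⁻¹ : ∀ x → f (f⁻¹ x) ≡ x) (f⁻¹∘f : ∀ x → f⁻¹ (f x) ≡ x)
           {d} {s t : Fin d → Fin n}
           (s-differences : ∀ i j → i ≢ j → Invertible n (val (s i) - val (s j)))
           (t-differences : ∀ i j → i ≢ j → Invertible n (val (t i) - val (t j))) where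
    private
      -- `m (r i - r j) = 0` with a unit difference forces `n ∣ m`, so nothing collapses even when
      -- `m` and `n` share factors.
      scaled-distinct : ∀ {r : Fin d → Fin n} → (∀ i j → i ≢ j → Invertible n (val (r i) - val (r j))) →
                        ∀ m → ¬ + m ≈ + 0 [mod n ] → Distinct (scale m ∘ r)
      scaled-distinct {r} r-differences m m≉0 i j eq with i Fₚ.≟ j
      ... | yes i≡j = i≡j
      ... | no i≢j = contradiction (*-cancelˡ-≈ (r-differences i j i≢j) (begin
        (val (r i) - val (r j)) * + m            ≡⟨ lem (val (r i)) (val (r j)) (+ m) ⟩
        + m * val (r i) - + m * val (r j)        ≈⟨ ≈⇒-≈0 (to-≈ (val-scale m (r i)) (val-scale m (r j)) eq) ⟩
        + 0                                      ≡⟨ sym (ℤₚ.*-zeroʳ (val (r i) - val (r j))) ⟩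
        (val (r i) - val (r j)) * + 0            ∎)) m≉0
        where
        open ≈-Reasoning n
        lem : ∀ a b m → (a - b) * m ≡ m * a - m * b
        lem = solve-∀

    -- Induction over the prime factors; both directions are carried along because each prime step
    -- uses the inverse map too. A partial product is nonzero modulo `n` because it divides the full
    -- one.
    sends-multiple-product : Sends f s t → Sends f⁻¹ t s → ∀ {qs} → All.All Prime qs →
      ¬ + ListAction.product qs ≈ + 0 [mod n ] →
      Sends f (scale (ListAction.product qs) ∘ s) (scale (ListAction.product qs) ∘ t) ×
      Sends f⁻¹ (scale (ListAction.product qs) ∘ t) (scale (ListAction.product qs) ∘ s)
    sends-multiple-product f-sends f⁻¹-sends All.[] _ =
      (λ (j , eq) → let i , eq′ = f-sends (j , trans eq (scale-1 (s j))) in i , trans eq′ (sym (scale-1 (t i)))) ,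
      (λ (j , eq) → let i , eq′ = f⁻¹-sends (j , trans eq (scale-1 (t j))) in i , trans eq′ (sym (scale-1 (s i))))
    sends-multiple-product f-sends f⁻¹-sends {q ∷ qs} (pq All.∷ pqs) qm≉0 =
      relabel f s t (sends-prime-multiple f f⁻¹ f∘f⁻¹ f⁻¹∘f pq (scaled-distinct s-differences m m≉0) (scaled-distinct t-differences m m≉0)
        (rescaled-distinct s-differences) (proj₁ ih) (proj₂ ih)) ,
      relabel f⁻¹ t s (sends-prime-multiple f⁻¹ f f⁻¹∘f f∘f⁻¹ pq (scaled-distinct t-differences m m≉0) (scaled-distinct s-differences m m≉0)
        (rescaled-distinct t-differences) (proj₂ ih) (proj₁ ih))
      where
      m = ListAction.product qs
      m≉0 : ¬ + m ≈ + 0 [mod n ]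
      m≉0 m≈0 = qm≉0 (≈-trans (≈-reflexive (ℤₚ.pos-* q m)) (*-zeroʳ (+ q) m≈0))
      ih = sends-multiple-product f-sends f⁻¹-sends pqs m≉0
      rescaled-distinct : ∀ {r : Fin d → Fin n} → (∀ i j → i ≢ j → Invertible n (val (r i) - val (r j))) →
                          Distinct (scale q ∘ scale m ∘ r)
      rescaled-distinct {r} r-differences i j eq = scaled-distinct r-differences (q ℕ.* m) qm≉0 i j
        (trans (sym (scale-scale q m (r i))) (trans eq (scale-scale q m (r j))))
      relabel : ∀ g (s t : Fin d → Fin n) → Sends g (scale q ∘ scale m ∘ s) (scale q ∘ scale m ∘ t) →
                Sends g (scale (q ℕ.* m) ∘ s) (scale (q ℕ.* m) ∘ t)
      relabel g s t sends (j , eq) =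
        let i , eq′ = sends (j , trans eq (sym (scale-scale q m (s j)))) in i , trans eq′ (scale-scale q m (t i))

    sends-multiple : Sends f s t → Sends f⁻¹ t s → ∀ m → ¬ + m ≈ + 0 [mod n ] → Sends f (scale m ∘ s) (scale m ∘ t)
    sends-multiple f-sends f⁻¹-sends zero m≉0 = contradiction ≈-refl m≉0
    sends-multiple f-sends f⁻¹-sends m@(suc _) m≉0 {x} {y} = subst (λ k → (∃ λ j → x -ₙ y ≡ scale k (s j)) → ∃ λ j → f x -ₙ f y ≡ scale k (t j))
      (sym isFactorisation) (proj₁ (sends-multiple-product f-sends f⁻¹-sends factorsPrime (subst (λ k → ¬ + k ≈ + 0 [mod n ]) isFactorisation m≉0)))
      where open PrimeFactorisation (factorise m)

-- Modulo a factor `m > 1` the rotor still has order exactly `d`, so reducing modulo `m` does not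
-- identify distinct powers.
rotor-cong : ∀ {m n d g} → 1 < m → 1 < n → 0 < d → m ∣ n → Rotor n d g → ∀ i j →
             g ^ᶻ i ≈ g ^ᶻ j [mod m ] → g ^ᶻ i ≈ g ^ᶻ j [mod n ]
rotor-cong {m} {n} {d} {g} 1<m 1<n 0<d m∣n rotor i j eq = begin
  g ^ᶻ i             ≈⟨ ^-% d (proj₁ rotor) i ⟩
  g ^ᶻ (i ℕ.% d)     ≡⟨ cong (g ^ᶻ_) (^-injective (rotor-hasOrder 1<m 0<d rotor-m) (ℕ÷.m%n<n i d) (ℕ÷.m%n<n j d)
                          (≈-trans (≈-sym (^-% d (proj₁ rotor-m) i)) (≈-trans eq (^-% d (proj₁ rotor-m) j)))) ⟩
  g ^ᶻ (j ℕ.% d)     ≈⟨ ≈-sym (^-% d (proj₁ rotor) j) ⟩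
  g ^ᶻ j             ∎
  where
  open ≈-Reasoning n
  instance _ = ℕ.>-nonZero 0<d
  rotor-m : Rotor m d g
  rotor-m = ≈-weaken m∣n (proj₁ rotor) , λ k 0<k k<d → invertible-weaken m∣n (proj₂ rotor k 0<k k<d)

rotor-differences-< : ∀ {n d g} → 1 < n → 0 < d → Rotor n d g → ∀ {i j} → i < j → j < d → Invertible n (g ^ᶻ j - g ^ᶻ i)
rotor-differences-< {g = g} 1<n 0<d rotor {i} {j} i<j j<d = invertible-resp (≈-reflexive eq)
  (invertible-* (invertible-^ i (rotor-invertible 1<n 0<d rotor))
    (proj₂ rotor (j ∸ i) (ℕₚ.m<n⇒0<n∸m i<j) (ℕₚ.≤-<-trans (ℕₚ.m∸n≤m j i) j<d)))
  where
  lem : ∀ a b → a * (b - + 1) ≡ a * b - a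
  lem = solve-∀
  eq : g ^ᶻ i * (g ^ᶻ (j ∸ i) - + 1) ≡ g ^ᶻ j - g ^ᶻ i
  eq = trans (lem (g ^ᶻ i) (g ^ᶻ (j ∸ i))) (cong (λ t → t - g ^ᶻ i)
    (trans (sym (ℤₚ.^-distribˡ-+-* g i (j ∸ i))) (cong (g ^ᶻ_) (ℕₚ.m+[n∸m]≡n (ℕₚ.<⇒≤ i<j)))))

rotor-differences : ∀ {n d g} → 1 < n → 0 < d → Rotor n d g → ∀ {i j} → i < d → j < d → i ≢ j →
                    Invertible n (g ^ᶻ i - g ^ᶻ j)
rotor-differences {n} {d} {g} 1<n 0<d rotor {i} {j} i<d j<d i≢j with ℕₚ.<-cmp i j
... | tri≈ _ i≡j _ = contradiction i≡j i≢j
... | tri< i<j _ _ = invertible-resp (≈-reflexive eq) (invertible-* (- (+ 1) , ≈-refl) (rotor-differences-< 1<n 0<d rotor i<j j<d))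
  where
  lem : ∀ a b → - (+ 1) * (b - a) ≡ a - b
  lem = solve-∀
  eq = lem (g ^ᶻ i) (g ^ᶻ j)
... | tri> _ _ j<i = rotor-differences-< 1<n 0<d rotor j<i i<d

crt-pair : ∀ {m n} → Coprime m n → ∀ a b → ∃ λ y → y ≈ a [mod m ] × y ≈ b [mod n ]
crt-pair {m} {n} c a b with coprime⇒invertible-pos c
... | u , um≈1 = a + (b - a) * (u * + m) ,
  ≈-trans (+-cong (≈-refl {a = a}) (*-zeroʳ (b - a) (*-zeroʳ u n≈0))) (≈-reflexive (ℤₚ.+-identityʳ a)) ,
  ≈-trans (+-cong (≈-refl {a = a}) (*-cong (≈-refl {a = b - a}) um≈1)) (≈-reflexive (lem a b))
  where
  lem : ∀ a b → a + (b - a) * + 1 ≡ b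
  lem = solve-∀

module Rigidity {n d q r : ℕ} .{{_ : NonZero n}} (1<n : 1 < n) (0<d : 0 < d)
                (q∣n : q ∣ n) (r∣n : r ∣ n) (1<q : 1 < q) (1<r : 1 < r) (q⊥r : Coprime q r)
                {g h : Fin n} (g-rotor : Rotor n d (val g)) (h-rotor : Rotor n d (val h))
                {S T : Subset n} (S-cyclic : IsCyclicSubgroupOf S g) (T-cyclic : IsCyclicSubgroupOf T h) where
  private
    instance
      d≢0 : NonZero d
      d≢0 = ℕ.>-nonZero 0<d
    G = val g
    H = val h

    power : Fin n → Fin d → Fin n
    power g j = g ^ₙ toℕ j

    power-differences : ∀ {g : Fin n} → Rotor n d (val g) → ∀ i j → i ≢ j → Invertible n (val (power g i) - val (power g j))
    power-differences {g} rotor i j i≢j = invertible-resp (minus-cong (≈-sym (val-^ g (toℕ i))) (≈-sym (val-^ g (toℕ j))))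
      (rotor-differences 1<n 0<d rotor (Fₚ.toℕ<n i) (Fₚ.toℕ<n j) (i≢j ∘ Fₚ.toℕ-injective))

    power⇒∈ : ∀ {U : Subset n} {g} → IsCyclicSubgroupOf U g → ∀ {x} → (∃ λ j → x ≡ power g j) → x ∈ U
    power⇒∈ cyclic (j , refl) = Equivalence.from (cyclic _) (toℕ j , refl)

    ∈⇒power : ∀ {U : Subset n} {g} → IsCyclicSubgroupOf U g → Rotor n d (val g) → ∀ {x} → x ∈ U → ∃ λ j → x ≡ power g j
    ∈⇒power {g = g} cyclic rotor x∈U with Equivalence.to (cyclic _) x∈U
    ... | k , refl = fromℕ< (ℕ÷.m%n<n k d) , from-≈ (val-^ g k) (val-^ g (toℕ (fromℕ< (ℕ÷.m%n<n k d))))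
      (≈-trans (^-% d (proj₁ rotor) k) (≈-reflexive (cong (val g ^ᶻ_) (sym (Fₚ.toℕ-fromℕ< (ℕ÷.m%n<n k d))))))

  module _ (iso : CayIso S T) where
    private
      f = proj₁ iso
      f-injective = proj₁ (proj₁ (proj₂ iso))
      f-surjective = proj₂ (proj₁ (proj₂ iso))
      f-iso = proj₂ (proj₂ iso)

      f⁻¹ : Fin n → Fin n
      f⁻¹ y = proj₁ (f-surjective y)
      f∘f⁻¹ : ∀ y → f (f⁻¹ y) ≡ y
      f∘f⁻¹ y = proj₂ (f-surjective y) refl
      f⁻¹∘f : ∀ x → f⁻¹ (f x) ≡ x
      f⁻¹∘f x = f-injective (f∘f⁻¹ (f x))

      f-sends : Sends f (power g) (power h)
      f-sends x-y∈S = ∈⇒power T-cyclic h-rotor (Equivalence.to (f-iso _ _) (power⇒∈ S-cyclic x-y∈S))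
      f⁻¹-sends : Sends f⁻¹ (power h) (power g)
      f⁻¹-sends {x} {y} x-y∈T = ∈⇒power S-cyclic g-rotor (Equivalence.from (f-iso _ _)
        (subst (_∈ T) (cong₂ _-ₙ_ (sym (f∘f⁻¹ x)) (sym (f∘f⁻¹ y))) (power⇒∈ T-cyclic x-y∈T)))

      difference : ∀ x y → ∃ λ k → val (f x) - val (f y) ≈ (val x - val y) * H ^ᶻ k [mod n ]
      difference x y with x Fₚ.≟ y
      ... | yes refl = 0 , ≈-reflexive (lem (val (f x)) (val x))
        where
        lem : ∀ a b → a - a ≡ (b - b) * + 1
        lem = solve-∀
      -- Take `m = x - y`: then `x - y = m g^0` is an arc of Cay(Z_n, m S), and `m` is nonzero
      -- because `x ≢ y`.
      ... | no x≢y with sends-multiple f f⁻¹ f∘f⁻¹ f⁻¹∘f (power-differences g-rotor) (power-differences h-rotor)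
                          f-sends f⁻¹-sends (toℕ (x -ₙ y)) x-y≉0 {x} {y} (fromℕ< 0<d , x-y≡)
        where
        x-y≉0 : ¬ val (x -ₙ y) ≈ + 0 [mod n ]
        x-y≉0 eq = x≢y (val-injective (-≈0⇒≈ (≈-trans (≈-sym (val-minus x y)) eq)))
        x-y≡ : x -ₙ y ≡ scale (toℕ (x -ₙ y)) (power g (fromℕ< 0<d))
        x-y≡ = from-≈ ≈-refl (≈-trans (val-scale (toℕ (x -ₙ y)) (power g (fromℕ< 0<d)))
          (*-cong (≈-refl {a = val (x -ₙ y)}) (≈-trans (≈-reflexive (cong (λ k → val (g ^ₙ k)) (Fₚ.toℕ-fromℕ< 0<d))) (val-[] 1))))
          (≈-reflexive (sym (ℤₚ.*-identityʳ (val (x -ₙ y)))))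
      ...   | i , eq = toℕ i , to-≈ (val-minus (f x) (f y))
        (≈-trans (val-scale (toℕ (x -ₙ y)) (power h i)) (*-cong (val-minus x y) (val-^ h (toℕ i)))) eq

      φ : Fin n → ℤ
      φ x = val (f x) - val (f [ 0 ])

      φ-multiple : ∀ x → ∃ λ k → φ x ≈ val x * H ^ᶻ k [mod n ]
      φ-multiple x with difference x [ 0 ]
      ... | k , eq = k , ≈-trans eq (*-cong (≈-trans (+-cong (≈-refl {a = val x}) (-‿cong (val-[] 0))) (≈-reflexive (ℤₚ.+-identityʳ (val x)))) ≈-refl)

      φ-cong : ∀ {m x y} → m ∣ n → val x ≈ val y [mod m ] → φ x ≈ φ y [mod m ]
      φ-cong {m} {x} {y} m∣n x≈y with difference x y
      ... | k , eq = -≈0⇒≈ (begin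
        φ x - φ y                          ≡⟨ lem (val (f x)) (val (f y)) (val (f [ 0 ])) ⟩
        val (f x) - val (f y)              ≈⟨ ≈-weaken m∣n eq ⟩
        (val x - val y) * H ^ᶻ k           ≈⟨ *-cong (≈⇒-≈0 x≈y) ≈-refl ⟩
        + 0 * H ^ᶻ k                       ≡⟨ ℤₚ.*-zeroˡ (H ^ᶻ k) ⟩
        + 0                                ∎)
        where
        open ≈-Reasoning m
        lem : ∀ a b c → (a - c) - (b - c) ≡ a - b
        lem = solve-∀

      -- The multiplier of φ at x is visible modulo any factor m > 1 of n where x is a unit.
      multiplier-cong : ∀ {m x y} → 1 < m → m ∣ n → Invertible m (val x) → val x ≈ val y [mod m ] → ∀ {i j} →
        φ x ≈ val x * H ^ᶻ i [mod n ] → φ y ≈ val y * H ^ᶻ j [mod n ] → H ^ᶻ i ≈ H ^ᶻ j [mod n ]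
      multiplier-cong {m} {x} {y} 1<m m∣n x-inv x≈y {i} {j} φx φy = rotor-cong 1<m 1<n 0<d m∣n h-rotor i j (*-cancelˡ-≈ x-inv (begin
        val x * H ^ᶻ i    ≈⟨ ≈-sym (≈-weaken m∣n φx) ⟩
        φ x               ≈⟨ φ-cong {x = x} {y} m∣n x≈y ⟩
        φ y               ≈⟨ ≈-weaken m∣n φy ⟩
        val y * H ^ᶻ j    ≈⟨ *-cong (≈-sym x≈y) ≈-refl ⟩
        val x * H ^ᶻ j    ∎))
        where open ≈-Reasoning m

    -- A point y ≡ 1 (mod q), y ≡ g (mod r) forces φ to have the same multiplier at 1 and at g.
    isomorphic⇒power : ∃ λ k → G ≈ H ^ᶻ k [mod n ]
    isomorphic⇒power = j ℕ.+ k₁ ℕ.* (d ∸ 1) , (begin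
      G                                        ≡⟨ sym (ℤₚ.*-identityʳ G) ⟩
      G * + 1                                  ≈⟨ *-cong (≈-refl {a = G}) (≈-sym (rotor-inverse 1<n 0<d h-rotor k₁)) ⟩
      G * (H ^ᶻ k₁ * H ^ᶻ (k₁ ℕ.* (d ∸ 1)))    ≡⟨ sym (ℤₚ.*-assoc G (H ^ᶻ k₁) _) ⟩
      G * H ^ᶻ k₁ * H ^ᶻ (k₁ ℕ.* (d ∸ 1))      ≈⟨ *-cong (≈-trans (*-cong (≈-refl {a = G}) (≈-sym same-multiplier)) (≈-sym φg)) ≈-refl ⟩
      φ g * H ^ᶻ (k₁ ℕ.* (d ∸ 1))              ≈⟨ *-cong φg∈T ≈-refl ⟩
      H ^ᶻ j * H ^ᶻ (k₁ ℕ.* (d ∸ 1))           ≡⟨ sym (ℤₚ.^-distribˡ-+-* H j (k₁ ℕ.* (d ∸ 1))) ⟩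
      H ^ᶻ (j ℕ.+ k₁ ℕ.* (d ∸ 1))              ∎)
      where
      open ≈-Reasoning n
      crt = crt-pair q⊥r (+ 1) G
      y : Fin n
      y = [ proj₁ crt ]ᶻ
      y≈1 : val y ≈ + 1 [mod q ]
      y≈1 = ≈-trans (≈-weaken q∣n (val-[]ᶻ (proj₁ crt))) (proj₁ (proj₂ crt))
      y≈g : val y ≈ G [mod r ]
      y≈g = ≈-trans (≈-weaken r∣n (val-[]ᶻ (proj₁ crt))) (proj₂ (proj₂ crt))
      k₁ = proj₁ (φ-multiple [ 1 ])
      φ1 = proj₂ (φ-multiple [ 1 ])
      φy = proj₂ (φ-multiple y)
      φg = proj₂ (φ-multiple g)
      same-multiplier : H ^ᶻ proj₁ (φ-multiple g) ≈ H ^ᶻ k₁ [mod n ]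
      same-multiplier = ≈-trans
        (multiplier-cong {x = g} {y} 1<r r∣n (invertible-weaken r∣n (rotor-invertible 1<n 0<d g-rotor)) (≈-sym y≈g) {i = proj₁ (φ-multiple g)} {j = proj₁ (φ-multiple y)} φg φy)
        (multiplier-cong {x = y} {[ 1 ]} 1<q q∣n (invertible-resp (≈-sym y≈1) invertible-1) (≈-trans y≈1 (≈-weaken q∣n (≈-sym (val-[] 1)))) {i = proj₁ (φ-multiple y)} {j = k₁} φy φ1)
      -- Second expression for `φ g`: the arc from `g` to 0 goes to an arc, so `φ g` is itself a
      -- power of `H`. Equating it with `G * H ^ᶻ k₁` isolates `G`.
      g-0∈S : (g -ₙ [ 0 ]) ∈ S
      g-0∈S = proj₂ (IsCyclicSubgroupOf⇔ S-cyclic) 1 (≈-trans (val-minus g [ 0 ])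
        (≈-trans (+-cong (≈-refl {a = G}) (-‿cong (val-[] 0))) (≈-reflexive (lem G))))
        where
        lem : ∀ a → a - + 0 ≡ a * + 1
        lem = solve-∀
      image = proj₁ (IsCyclicSubgroupOf⇔ T-cyclic) (Equivalence.to (f-iso g [ 0 ]) g-0∈S)
      j = proj₁ image
      φg∈T : φ g ≈ H ^ᶻ j [mod n ]
      φg∈T = ≈-trans (≈-sym (val-minus (f g) (f [ 0 ]))) (proj₂ image)

-- Residues coprime to d

lookup-injective : ∀ {A : Set} {xs : List A} → Unique xs → ∀ i j → lookup xs i ≡ lookup xs j → i ≡ j
lookup-injective (_ AllPairs.∷ _) F.zero F.zero _ = refl
lookup-injective (x≢ AllPairs.∷ _) F.zero (F.suc j) eq = contradiction eq (All.lookup x≢ (List∈ₚ.∈-lookup j))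
lookup-injective (x≢ AllPairs.∷ _) (F.suc i) F.zero eq = contradiction (sym eq) (All.lookup x≢ (List∈ₚ.∈-lookup i))
lookup-injective (_ AllPairs.∷ u) (F.suc i) (F.suc j) eq = cong F.suc (lookup-injective u i j eq)

module CoprimeResidues (d : ℕ) (0<d : 0 < d) where
  private
    instance
      d≢0 : NonZero d
      d≢0 = ℕ.>-nonZero 0<d
    coprime-d? : ∀ k → Dec (Coprime k d)
    coprime-d? k = coprime? k d
    lookup∈ : ∀ i → lookup (filter coprime-d? (upTo d)) i List∈.∈ upTo d × Coprime (lookup (filter coprime-d? (upTo d)) i) d
    lookup∈ i = List∈ₚ.∈-filter⁻ coprime-d? {xs = upTo d} (List∈ₚ.∈-lookup {xs = filter coprime-d? (upTo d)} i)

  -- The same filtered list whose length defines `totient d`, so its positions are `Fin (totient d)`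
  -- by definition.
  coprimeResidue : Fin (totient d) → ℕ
  coprimeResidue = lookup (filter coprime-d? (upTo d))

  coprimeResidue-< : ∀ i → coprimeResidue i < d
  coprimeResidue-< i = List∈ₚ.∈-upTo⁻ (proj₁ (lookup∈ i))

  coprimeResidue-coprime : ∀ i → Coprime (coprimeResidue i) d
  coprimeResidue-coprime i = proj₂ (lookup∈ i)

  coprimeResidue-injective : ∀ i j → coprimeResidue i ≡ coprimeResidue j → i ≡ j
  coprimeResidue-injective = lookup-injective (Uniqueₚ.filter⁺ coprime-d? (Uniqueₚ.upTo⁺ d))

  coprimeResidue-surjective : ∀ {m} → Coprime m d → ∃ λ i → + coprimeResidue i ≈ + m [mod d ]
  coprimeResidue-surjective {m} m⊥d = index m%d∈ , ≈-trans (≈-reflexive (cong +_ (sym (lookup-index m%d∈)))) (≈-sym m≈m%d)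
    where
    m≈m%d : + m ≈ + (m ℕ.% d) [mod d ]
    m≈m%d = proj₂ (proj₂ (residue d (+ m)))
    m%d∈ : m ℕ.% d List∈.∈ filter coprime-d? (upTo d)
    m%d∈ = List∈ₚ.∈-filter⁺ coprime-d? (List∈ₚ.∈-upTo⁺ (ℕ÷.m%n<n m d))
      (invertible⇒coprime (+ (m ℕ.% d)) (invertible-resp m≈m%d (coprime⇒invertible (+ m) m⊥d)))

^-exponent-cong : ∀ {n d a j k} → 0 < d → a ^ᶻ d ≈ + 1 [mod n ] → + j ≈ + k [mod d ] → a ^ᶻ j ≈ a ^ᶻ k [mod n ]
^-exponent-cong {n} {d} {a} {j} {k} 0<d a^d≈1 j≈k = begin
  a ^ᶻ j           ≈⟨ ^-% d a^d≈1 j ⟩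
  a ^ᶻ (j ℕ.% d)   ≡⟨ cong (a ^ᶻ_) (pos-cong (≈-trans (≈-sym (%-≈ j)) (≈-trans j≈k (%-≈ k))) (ℕ÷.m%n<n j d) (ℕ÷.m%n<n k d)) ⟩
  a ^ᶻ (k ℕ.% d)   ≈⟨ ≈-sym (^-% d a^d≈1 k) ⟩
  a ^ᶻ k           ∎
  where
  open ≈-Reasoning n
  instance _ = ℕ.>-nonZero 0<d
  %-≈ : ∀ j → + j ≈ + (j ℕ.% d) [mod d ]
  %-≈ j = proj₂ (proj₂ (residue d (+ j)))

coprime-inverse : ∀ {d m} → 0 < d → Coprime m d → ∃ λ k → Coprime k d × + (m ℕ.* k) ≈ + 1 [mod d ]
coprime-inverse {d} {m} 0<d m⊥d with coprime⇒invertible (+ m) m⊥d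
... | u , um≈1 with residue d {{ℕ.>-nonZero 0<d}} u
...   | k , _ , u≈k = k , invertible⇒coprime (+ k) (+ m , mk≈1) , ≈-trans (≈-reflexive (ℤₚ.pos-* m k)) mk≈1
  where
  mk≈1 : + m * + k ≈ + 1 [mod d ]
  mk≈1 = ≈-trans (*-cong (≈-refl {a = + m}) (≈-sym u≈k)) (≈-trans (≈-reflexive (ℤₚ.*-comm (+ m) u)) um≈1)

module _ {n : ℕ} .{{_ : NonZero n}} where

  powers : ℕ → Fin n → Subset n
  powers d g = comprehension (λ x → Fₚ.any? (λ (j : Fin d) → x Fₚ.≟ g ^ₙ toℕ j))

  powers-cyclic : ∀ {d g} → 0 < d → val g ^ᶻ d ≈ + 1 [mod n ] → IsCyclicSubgroupOf (powers d g) g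
  powers-cyclic {d} {g} 0<d g^d≈1 x = mk⇔
    (λ x∈ → let j , eq = ∈-comprehension⁻ (λ x → Fₚ.any? (λ (j : Fin d) → x Fₚ.≟ g ^ₙ toℕ j)) x∈ in toℕ j , eq)
    (λ (k , x≡) → ∈-comprehension⁺ (λ x → Fₚ.any? (λ (j : Fin d) → x Fₚ.≟ g ^ₙ toℕ j))
      (fromℕ< (ℕ÷.m%n<n k d) , trans x≡ (from-≈ (val-^ g k) (val-^ g (toℕ (fromℕ< (ℕ÷.m%n<n k d))))
        (≈-trans (^-% d g^d≈1 k) (≈-reflexive (cong (val g ^ᶻ_) (sym (Fₚ.toℕ-fromℕ< (ℕ÷.m%n<n k d)))))))))
    where instance _ = ℕ.>-nonZero 0<d

  -- Multiplication by the inverse `u` of the representative carries `s⟨g⟩` to `⟨g⟩`.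
  rotorCoset-CayIso : ∀ {d} {S T : Subset n} (coset : RotorCoset d S) → IsCyclicSubgroupOf T (RotorCoset.generator coset) → CayIso S T
  rotorCoset-CayIso {S = S} {T} coset cyclic = f , (f-injective , λ y → y *ₙ s , λ { refl → f-surjective y }) ,
    λ x y → mk⇔ (λ x-y∈S → let k , _ , eq = ∈⇒coset x-y∈S in T⁺ k (f-difference x y k eq))
                (λ fx-fy∈T → let k , eq = T⁻ fx-fy∈T in coset⇒∈ k (f-difference⁻ x y k eq))
    where
    open RotorCoset coset renaming (generator to g; representative to s)
    open ≈-Reasoning n
    T⁻ : ∀ {x} → x ∈ T → ∃ λ k → val x ≈ val g ^ᶻ k [mod n ]
    T⁻ = proj₁ (IsCyclicSubgroupOf⇔ cyclic)
    T⁺ : ∀ {x} k → val x ≈ val g ^ᶻ k [mod n ] → x ∈ T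
    T⁺ = proj₂ (IsCyclicSubgroupOf⇔ cyclic)
    u = proj₁ representative-invertible
    us≈1 : u * val s ≈ + 1 [mod n ]
    us≈1 = proj₂ representative-invertible
    f : Fin n → Fin n
    f x = x *ₙ [ u ]ᶻ
    val-f : ∀ x → val (f x) ≈ val x * u [mod n ]
    val-f x = ≈-trans (val-* x [ u ]ᶻ) (*-cong (≈-refl {a = val x}) (val-[]ᶻ u))
    s-f : ∀ x → val s * val (f x) ≈ val x [mod n ]
    s-f x = begin
      val s * val (f x)      ≈⟨ *-cong (≈-refl {a = val s}) (val-f x) ⟩
      val s * (val x * u)    ≡⟨ lem (val s) (val x) u ⟩
      val x * (u * val s)    ≈⟨ *-cong (≈-refl {a = val x}) us≈1 ⟩
      val x * + 1            ≡⟨ ℤₚ.*-identityʳ (val x) ⟩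
      val x                  ∎
      where
      lem : ∀ s x u → s * (x * u) ≡ x * (u * s)
      lem = solve-∀
    f-injective : ∀ {x y} → f x ≡ f y → x ≡ y
    f-injective {x} {y} eq = val-injective (≈-trans (≈-sym (s-f x)) (≈-trans (≈-reflexive (cong (λ t → val s * val t) eq)) (s-f y)))
    f-surjective : ∀ y → f (y *ₙ s) ≡ y
    f-surjective y = from-≈ (≈-trans (val-f (y *ₙ s)) (*-cong (val-* y s) ≈-refl)) ≈-refl (begin
      val y * val s * u     ≡⟨ lem (val y) (val s) u ⟩
      val y * (u * val s)   ≈⟨ *-cong (≈-refl {a = val y}) us≈1 ⟩
      val y * + 1           ≡⟨ ℤₚ.*-identityʳ (val y) ⟩
      val y                 ∎)
      where
      lem : ∀ y s u → y * s * u ≡ y * (u * s)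
      lem = solve-∀
    s-f-difference : ∀ x y → val s * val (f x -ₙ f y) ≈ val (x -ₙ y) [mod n ]
    s-f-difference x y = begin
      val s * val (f x -ₙ f y)                 ≈⟨ *-cong (≈-refl {a = val s}) (val-minus (f x) (f y)) ⟩
      val s * (val (f x) - val (f y))          ≡⟨ lem (val s) (val (f x)) (val (f y)) ⟩
      val s * val (f x) - val s * val (f y)    ≈⟨ minus-cong (s-f x) (s-f y) ⟩
      val x - val y                            ≈⟨ ≈-sym (val-minus x y) ⟩
      val (x -ₙ y)                             ∎
      where
      lem : ∀ s a b → s * (a - b) ≡ s * a - s * b
      lem = solve-∀
    f-difference : ∀ x y k → val (x -ₙ y) ≈ val s * val g ^ᶻ k [mod n ] → val (f x -ₙ f y) ≈ val g ^ᶻ k [mod n ]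
    f-difference x y k eq = *-cancelˡ-≈ representative-invertible (≈-trans (s-f-difference x y) eq)
    f-difference⁻ : ∀ x y k → val (f x -ₙ f y) ≈ val g ^ᶻ k [mod n ] → val (x -ₙ y) ≈ val s * val g ^ᶻ k [mod n ]
    f-difference⁻ x y k eq = ≈-trans (≈-sym (s-f-difference x y)) (*-cong (≈-refl {a = val s}) eq)

  cyclic-generator : ∀ {T : Subset n} {g h : Fin n} → IsCyclicSubgroupOf T h →
    (∃ λ k → val h ≈ val g ^ᶻ k [mod n ]) → (∃ λ k → val g ≈ val h ^ᶻ k [mod n ]) → IsCyclicSubgroupOf T g
  cyclic-generator {T} {g} {h} cyclic (j , h≈g^j) (k , g≈h^k) x = mk⇔
    (λ x∈T → let i , eq = proj₁ (IsCyclicSubgroupOf⇔ cyclic) x∈T in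
      j ℕ.* i , from-≈ eq (val-^ g (j ℕ.* i)) (≈-trans (^-cong i h≈g^j) (≈-reflexive (ℤₚ.^-*-assoc (val g) j i))))
    (λ (i , x≡) → proj₂ (IsCyclicSubgroupOf⇔ cyclic) (k ℕ.* i)
      (≈-trans (≈-reflexive (cong val x≡)) (≈-trans (val-^ g i)
        (≈-trans (^-cong i g≈h^k) (≈-reflexive (ℤₚ.^-*-assoc (val h) k i))))))

-- Factorisation of n

module Factorised {n : ℕ} .{{_ : NonZero n}} (3≤n : 3 ≤ n) {l : ℕ} {p e : Fin l → ℕ}
         (p-prime : ∀ i → Prime (p i)) (1≤e : ∀ i → 1 ≤ e i) (p-increasing : ∀ i j → i <ᶠ j → p i < p j)
         (n≡prodF : n ≡ prodF l (λ i → p i ^ e i)) where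
  q : Fin l → ℕ
  q i = p i ^ e i

  1<n : 1 < n
  1<n = ℕₚ.<-trans (s≤s (s≤s z≤n)) 3≤n

  1<p : ∀ i → 1 < p i
  1<p i = ℕ.nonTrivial⇒n>1 (p i) {{prime⇒nonTrivial (p-prime i)}}

  p∣q : ∀ i → p i ∣ q i
  p∣q i with e i | 1≤e i
  ... | suc k | _ = ℕ∣.m∣m*n (p i ^ k)

  q≢0 : ∀ i → NonZero (q i)
  q≢0 i = ℕₚ.m^n≢0 (p i) (e i) {{prime⇒nonZero (p-prime i)}}

  1<q : ∀ i → 1 < q i
  1<q i = ℕₚ.<-≤-trans (1<p i) (ℕ∣.∣⇒≤ {{q≢0 i}} (p∣q i))

  q∣n : ∀ i → q i ∣ n
  q∣n i = subst (q i ∣_) (sym n≡prodF) (∣prodF l q i)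

  p∣n : ∀ i → p i ∣ n
  p∣n i = ℕ∣.∣-trans (p∣q i) (q∣n i)

  p-coprime : ∀ i j → i ≢ j → Coprime (p i) (p j)
  p-coprime i j i≢j with Fₚ.<-cmp i j
  ... | tri< i<j _ _ = Coprimality.sym (Coprimality.prime⇒coprime (p-prime j) {{prime⇒nonZero (p-prime i)}} (p-increasing i j i<j))
  ... | tri≈ _ i≡j _ = contradiction i≡j i≢j
  ... | tri> _ _ j<i = Coprimality.prime⇒coprime (p-prime i) {{prime⇒nonZero (p-prime j)}} (p-increasing j i j<i)

  q-coprime : ∀ i j → i ≢ j → Coprime (q i) (q j)
  q-coprime i j i≢j = coprime-^ʳ (e j) (Coprimality.sym (coprime-^ʳ (e i) (Coprimality.sym (p-coprime i j i≢j))))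

  ≈-crt-n : ∀ {a b} → (∀ i → a ≈ b [mod q i ]) → a ≈ b [mod n ]
  ≈-crt-n {a} {b} eqs = subst (a ≈ b [mod_]) (sym n≡prodF) (≈-crt-prodF l q q-coprime eqs)

  divN-cofactor : ∀ {a c} m → .{{NonZero m}} → a ≡ m ℕ.* c → divN a m ≡ c
  divN-cofactor {c = c} m@(suc _) refl = trans (cong (ℕ._/ m) (ℕₚ.*-comm m c)) (ℕ÷.m*n/n≡m c m)

  n/q : ∀ i → (∀ j → j ≢ i → q j ∣ divN n (q i)) × Coprime (divN n (q i)) (q i)
  n/q i with prodF-cofactor l q i
  ... | c , prodF≡qc , others , coprime rewrite divN-cofactor (q i) {{q≢0 i}} (trans n≡prodF prodF≡qc) =
    others , Coprimality.sym (coprime (λ j j≢i → q-coprime i j (j≢i ∘ sym)))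

  CofactorInverse : (Fin l → ℤ) → Set
  CofactorInverse b = ∀ i → b i * + divN n (q i) ≈ + 1 [mod q i ]

  -- `b i * (n / q i)` is 1 modulo `q i`, and every other summand carries a factor `n / q j`
  -- divisible by `q i`.
  hSum-≈ : ∀ {b hh} → CofactorInverse b → ∀ i → hSum n l q b hh ≈ hh i [mod q i ]
  hSum-≈ {b} {hh} b-inverse i = begin
    hSum n l q b hh                   ≈⟨ sumZ-≈ l _ i (λ j j≢i → ≈-trans (≈-reflexive (lem (+ divN n (q j)) (b j) (hh j)))
                                           (*-zeroʳ (hh j) (*-zeroʳ (b j) (pos-∣⇒≈0 (proj₁ (n/q j) i (j≢i ∘ sym)))))) ⟩
    + divN n (q i) * b i * hh i       ≡⟨ cong (_* hh i) (ℤₚ.*-comm (+ divN n (q i)) (b i)) ⟩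
    b i * + divN n (q i) * hh i       ≈⟨ *-cong (b-inverse i) ≈-refl ⟩
    + 1 * hh i                        ≡⟨ ℤₚ.*-identityˡ (hh i) ⟩
    hh i                              ∎
    where
    open ≈-Reasoning (q i)
    lem : ∀ c b h → c * b * h ≡ h * (b * c)
    lem = solve-∀

  cofactor-inverse : ∃ CofactorInverse
  cofactor-inverse = (λ i → proj₁ (inverse i)) , (λ i → proj₂ (inverse i))
    where
    inverse : ∀ i → Invertible (q i) (+ divN n (q i))
    inverse i = coprime⇒invertible-pos (proj₂ (n/q i))

  abstract
    chinese : ∀ (a : Fin l → ℤ) → ∃ λ x → ∀ i → val {n} x ≈ a i [mod q i ]
    chinese a = [ hSum n l q (proj₁ cofactor-inverse) a ]ᶻ ,
      λ i → ≈-trans (≈-weaken (q∣n i) (val-[]ᶻ _)) (hSum-≈ {hh = a} (proj₂ cofactor-inverse) i)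

  module _ {d : ℕ} (0<d : 0 < d) where

    localise : ∀ {g} → Rotor n d g → ∀ i → g ^ᶻ d ≈ + 1 [mod q i ] × HasOrder (p i) g d
    localise rotor i = ≈-weaken (q∣n i) (proj₁ rotor) ,
      rotor-hasOrder (1<p i) 0<d (≈-weaken (p∣n i) (proj₁ rotor) , λ k 0<k k<d → invertible-weaken (p∣n i) (proj₂ rotor k 0<k k<d))

    -- `g^k - 1` is a unit modulo `n` as soon as no `p i` divides it, which for `0 < k < d` is what
    -- order `d` modulo each `p i` says.
    globalise : ∀ {g} → (∀ i → g ^ᶻ d ≈ + 1 [mod q i ] × HasOrder (p i) g d) → Rotor n d g
    globalise {g} local = ≈-crt-n (proj₁ ∘ local) , λ k 0<k k<d → coprime⇒invertible (g ^ᶻ k - + 1)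
      (subst (Coprime ℤ.∣ g ^ᶻ k - + 1 ∣) (sym n≡prodF) (coprime-prodF l q λ i → coprime-^ʳ (e i)
        (prime∤⇒coprime (p-prime i) λ p∣ → hasOrder-minimal (proj₂ (local i)) k 0<k k<d (-≈0⇒≈ (∣⇒≈0 p∣)))))

    order-divides : ∀ {g} → Rotor n d g → d ∣ gcdF l (λ i → p i ∸ 1)
    order-divides {g} rotor = gcdF-greatest l _ λ i → proj₂ (proj₂ (localise rotor i)) (p i ∸ 1)
      (fermat-unit (p-prime i) (0-not-invertible (1<p i) (invertible-weaken (p∣n i) (rotor-invertible 1<n 0<d rotor))))

    module _ (d∣p-1 : ∀ i → d ∣ p i ∸ 1) where

      -- Modulo `p i`, `g` is one of the powers of `z`, and equality of orders makes the exponent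
      -- coprime to `d`; uniqueness of lifts carries the congruence up to `q i`.
      local-power : ∀ {z g : ℤ} i → z ^ᶻ d ≈ + 1 [mod q i ] → HasOrder (p i) z d → g ^ᶻ d ≈ + 1 [mod q i ] → HasOrder (p i) g d →
                    ∃ λ m → Coprime m d × g ≈ z ^ᶻ m [mod q i ]
      local-power {z} {g} i z^d≈1 z-order g^d≈1 g-order
        with root-of-unity-power (p-prime i) 0<d z-order (proj₁ g-order)
      ... | m , _ , g≈z^m = m , hasOrder-^⇒coprime 0<d (proj₁ z-order) (hasOrder-resp g≈z^m g-order) ,
        root-of-unity-lift-unique (p-prime i) 0<d (d∣p-1 i) (1≤e i) g^d≈1
          (≈-trans (≈-reflexive (ℤₚ.^-*-assoc z m d)) (^-*≈1ʳ d m z^d≈1)) g≈z^m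

      module PrimitiveRoots {η : Fin l → ℤ} (η-primitive : ∀ i → PrimitiveRoot (q i) (η i)) where

        d∣totient : ∀ i → d ∣ totient (q i)
        d∣totient i = subst (d ∣_) (sym (totient-prime-power (p-prime i) (1≤e i))) (ℕ∣.∣-trans (d∣p-1 i) (ℕ∣.n∣m*n (p i ^ (e i ∸ 1))))

        0<totient : ∀ i → 0 < totient (q i)
        0<totient i = subst (0 <_) (sym (totient-prime-power (p-prime i) (1≤e i)))
          (ℕₚ.*-mono-< {0} (ℕ.>-nonZero⁻¹ _ {{ℕₚ.m^n≢0 (p i) (e i ∸ 1) {{prime⇒nonZero (p-prime i)}}}}) (ℕₚ.m<n⇒0<n∸m (1<p i)))

        w : Fin l → ℕ
        w i = ℕ∣.quotient (d∣totient i)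

        totient≡wd : ∀ i → totient (q i) ≡ w i ℕ.* d
        totient≡wd i = ℕ∣._∣_.equality (d∣totient i)

        0<w : ∀ i → 0 < w i
        0<w i = ℕₚ.n≢0⇒n>0 λ w≡0 → ℕₚ.<⇒≢ (0<totient i) (sym (trans (totient≡wd i) (cong (ℕ._* d) w≡0)))

        -- The exponents `m φ(q) / d` of the theorem become plain powers `ζ^m` of an element of
        -- order `d`.
        ζ : Fin l → ℤ
        ζ i = η i ^ᶻ w i

        ζ-order-q : ∀ i → HasOrder (q i) (ζ i) d
        ζ-order-q i = ≈-trans (≈-reflexive (trans (ℤₚ.^-*-assoc (η i) (w i) d) (cong (η i ^ᶻ_) (sym (totient≡wd i))))) (proj₁ η-order) ,
          λ k ζ^k≈1 → ℕ∣.*-cancelˡ-∣ (w i) {{ℕ.>-nonZero (0<w i)}} (subst (_∣ w i ℕ.* k) (totient≡wd i)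
            (proj₂ η-order (w i ℕ.* k) (≈-trans (≈-reflexive (sym (ℤₚ.^-*-assoc (η i) (w i) k))) ζ^k≈1)))
          where
          η-order : HasOrder (q i) (η i) (totient (q i))
          η-order = hasOrder (totient (q i)) (0<totient i) (CongZ⇒≈ (proj₁ (η-primitive i)))
            λ k 0<k k<φ → proj₂ (η-primitive i) k 0<k k<φ ∘ ≈⇒CongZ

        ζ-order : ∀ i → HasOrder (p i) (ζ i) d
        ζ-order i = hasOrder-prime-power⇒prime (p-prime i) 0<d (d∣p-1 i) (1≤e i) (ζ-order-q i)

        η-power : ∀ i m → η i ^ᶻ divN (m ℕ.* totient (q i)) d ≡ ζ i ^ᶻ m
        η-power i m = trans (cong (η i ^ᶻ_) (divN-cofactor d {{ℕ.>-nonZero 0<d}} (trans (cong (m ℕ.*_) (totient≡wd i)) (lem m (w i) d))))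
          (sym (ℤₚ.^-*-assoc (η i) (w i) m))
          where
          lem : ∀ m w d → m ℕ.* (w ℕ.* d) ≡ d ℕ.* (w ℕ.* m)
          lem m w d = trans (sym (ℕₚ.*-assoc m w d)) (trans (ℕₚ.*-comm (m ℕ.* w) d) (cong (d ℕ.*_) (ℕₚ.*-comm m w)))

        module _ {b hh : Fin l → ℤ} {m : Fin l → ℕ} (valid : ValidHData n l q d η b hh m) where

          hSum-≈-ζ : ∀ i → hSum n l q b hh ≈ ζ i ^ᶻ m i [mod q i ]
          hSum-≈-ζ i = ≈-trans (hSum-≈ {b} {hh} (λ i → CongZ⇒≈ (proj₁ (valid i))) i)
            (≈-trans (CongZ⇒≈ (proj₁ (proj₂ (valid i)))) (≈-reflexive (η-power i (m i))))

          hSum-rotor : Rotor n d (val {n} [ hSum n l q b hh ]ᶻ)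
          hSum-rotor = rotor-resp (≈-sym (val-[]ᶻ (hSum n l q b hh))) (globalise λ i →
            ≈-trans (^-cong d (hSum-≈-ζ i)) (≈-trans (≈-reflexive (ℤₚ.^-*-assoc (ζ i) (m i) d)) (^-*≈1ʳ d (m i) (proj₁ (ζ-order-q i)))) ,
            hasOrder-resp (≈-sym (≈-weaken (p∣q i) (hSum-≈-ζ i))) (hasOrder-^ (ζ-order i) (proj₂ (proj₂ (valid i)))))

        -- The coset's own generator already has the required shape: Chinese remaindering recovers
        -- it from the exponents `m i` that `local-power` reads off in each coordinate.
        rotorCoset⇒hSum : ∀ {S : Subset n} → RotorCoset d S →
          ∃ λ (b : Fin l → ℤ) → ∃ λ (hh : Fin l → ℤ) → ∃ λ (m : Fin l → ℕ) →
            ValidHData n l q d η b hh m × IsUnit {n} [ hSum n l q b hh ]ᶻ ×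
            ∃ λ (T : Subset n) → IsCyclicSubgroupOf T [ hSum n l q b hh ]ᶻ × CayIso S T
        rotorCoset⇒hSum {S} coset = b , hh , m , valid ,
          subst IsUnit g≡ (invertible⇒coprime (val generator) (rotor-invertible 1<n 0<d rotor)) ,
          powers d generator , subst (IsCyclicSubgroupOf (powers d generator)) g≡ cyclic , rotorCoset-CayIso coset cyclic
          where
          open RotorCoset coset hiding (0<d)
          cyclic = powers-cyclic 0<d (proj₁ rotor)
          exponent : ∀ i → ∃ λ m → Coprime m d × val generator ≈ ζ i ^ᶻ m [mod q i ]
          exponent i = local-power i (proj₁ (ζ-order-q i)) (ζ-order i) (proj₁ (localise rotor i)) (proj₂ (localise rotor i))
          m : Fin l → ℕ
          m i = proj₁ (exponent i)
          b hh : Fin l → ℤ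
          b = proj₁ cofactor-inverse
          hh i = η i ^ᶻ divN (m i ℕ.* totient (q i)) d
          valid : ValidHData n l q d η b hh m
          valid i = ≈⇒CongZ (proj₂ cofactor-inverse i) , ≈⇒CongZ (≈-refl {a = hh i}) , proj₁ (proj₂ (exponent i))
          g≡ : generator ≡ [ hSum n l q b hh ]ᶻ
          g≡ = from-≈ ≈-refl (val-[]ᶻ (hSum n l q b hh))
            (≈-crt-n λ i → ≈-trans (proj₂ (proj₂ (exponent i))) (≈-sym (hSum-≈-ζ {b} {hh} valid i)))

-- Isomorphism classes

module Classes {n : ℕ} .{{_ : NonZero n}} (3≤n : 3 ≤ n) {l : ℕ} {p e : Fin (suc l) → ℕ}
         (p-prime : ∀ i → Prime (p i)) (1≤e : ∀ i → 1 ≤ e i) (p-increasing : ∀ i j → i <ᶠ j → p i < p j)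
         (n≡prodF : n ≡ prodF (suc l) (λ i → p i ^ e i))
         {d : ℕ} (0<d : 0 < d) (2∣d : 2 ∣ d) (d∣p-1 : ∀ i → d ∣ p i ∸ 1) where
  open Factorised 3≤n p-prime 1≤e p-increasing n≡prodF
  open CoprimeResidues d 0<d

  z : Fin (suc l) → ℤ
  z i = proj₁ (∃-order-lift (p-prime i) 0<d (d∣p-1 i) (1≤e i))

  z^d≈1 : ∀ i → z i ^ᶻ d ≈ + 1 [mod q i ]
  z^d≈1 i = proj₁ (proj₂ (∃-order-lift (p-prime i) 0<d (d∣p-1 i) (1≤e i)))

  z-order : ∀ i → HasOrder (p i) (z i) d
  z-order i = proj₂ (proj₂ (∃-order-lift (p-prime i) 0<d (d∣p-1 i) (1≤e i)))

  -- Each class has exactly one generator whose residue modulo q 0F is z 0F.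
  exponent : Fin (totient d ^ l) → Fin (suc l) → ℕ
  exponent c F.zero    = 1
  exponent c (F.suc i) = coprimeResidue (finToFun c i)

  exponent-coprime : ∀ c i → Coprime (exponent c i) d
  exponent-coprime c F.zero    (k∣1 , _) = ℕ∣.∣1⇒≡1 k∣1
  exponent-coprime c (F.suc i) = coprimeResidue-coprime (finToFun c i)

  generator : Fin (totient d ^ l) → Fin n
  generator c = proj₁ (chinese (λ i → z i ^ᶻ exponent c i))

  generator-≈ : ∀ c i → val (generator c) ≈ z i ^ᶻ exponent c i [mod q i ]
  generator-≈ c = proj₂ (chinese (λ i → z i ^ᶻ exponent c i))

  generator-rotor : ∀ c → Rotor n d (val (generator c))
  generator-rotor c = globalise 0<d λ i →
    ≈-trans (^-cong d (generator-≈ c i)) (≈-trans (≈-reflexive (ℤₚ.^-*-assoc (z i) (exponent c i) d)) (^-*≈1ʳ d (exponent c i) (z^d≈1 i))) ,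
    hasOrder-resp (≈-sym (≈-weaken (p∣q i) (generator-≈ c i))) (hasOrder-^ (z-order i) (exponent-coprime c i))

  class : Fin (totient d ^ l) → Subset n
  class c = powers d (generator c)

  class-cyclic : ∀ c → IsCyclicSubgroupOf (class c) (generator c)
  class-cyclic c = powers-cyclic 0<d (proj₁ (generator-rotor c))

  class-RFFC : ∀ c → IsRFFC d (class c)
  class-RFFC c = RotorSubgroup.isRFFC 3≤n 0<d 2∣d (generator-rotor c) (class-cyclic c)

  -- The differing coordinate `t` does double duty: it is where equal generators would be
  -- contradicted, and it supplies the second prime factor for rigidity.
  finToFun-distinct : ∀ {k m} (c c′ : Fin (k ^ m)) → c ≢ c′ → ∃ λ t → finToFun {k} {m} c t ≢ finToFun c′ t
  finToFun-distinct {k} {m} c c′ c≢c′ = Fₚ.¬∀⟶∃¬ m _ (λ t → finToFun c t Fₚ.≟ finToFun c′ t) λ same →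
    c≢c′ (trans (sym (Fₚ.funToFin-finToFin {m} {k} c)) (trans (funToFin-cong same) (Fₚ.funToFin-finToFin {m} {k} c′)))
    where
    funToFin-cong : ∀ {m} {f g : Fin m → Fin k} → (∀ t → f t ≡ g t) → funToFin f ≡ funToFin g
    funToFin-cong {zero} _ = refl
    funToFin-cong {suc m} eq = cong₂ F.combine (eq F.zero) (funToFin-cong (eq ∘ F.suc))

  -- By rigidity the first generator is a power of the second; both are `z 0F` modulo `q 0F`, and
  -- `rotor-cong` lifts the agreement of that power with the first power to the modulus `n`.
  isomorphic⇒same-generator : ∀ c c′ → Fin l → CayIso (class c) (class c′) → val (generator c) ≈ val (generator c′) [mod n ]
  isomorphic⇒same-generator c c′ t iso = ≈-trans (proj₂ power) (≈-trans
    (rotor-cong (1<q F.zero) 1<n 0<d (q∣n F.zero) (generator-rotor c′) (proj₁ power) 1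
      (≈-trans (≈-weaken (q∣n F.zero) (≈-sym (proj₂ power))) (≈-trans (generator-≈ c F.zero)
        (≈-trans (≈-sym (generator-≈ c′ F.zero)) (≈-reflexive (sym (ℤₚ.^-identityʳ (val (generator c′)))))))))
    (≈-reflexive (ℤₚ.^-identityʳ (val (generator c′)))))
    where
    i = F.suc t
    power : ∃ λ k → val (generator c) ≈ val (generator c′) ^ᶻ k [mod n ]
    power = Rigidity.isomorphic⇒power 1<n 0<d (q∣n F.zero) (q∣n i) (1<q F.zero) (1<q i) (q-coprime F.zero i λ ())
              {generator c} {generator c′} (generator-rotor c) (generator-rotor c′) {class c} {class c′} (class-cyclic c) (class-cyclic c′) iso

  same-generator⇒≡ : ∀ c c′ → val (generator c) ≈ val (generator c′) [mod n ] → ∀ t → finToFun {totient d} {l} c t ≡ finToFun c′ t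
  same-generator⇒≡ c c′ same t = coprimeResidue-injective (finToFun c t) (finToFun c′ t)
    (^-injective (z-order i) (coprimeResidue-< (finToFun c t)) (coprimeResidue-< (finToFun c′ t)) (begin
      z i ^ᶻ exponent c i        ≈⟨ ≈-sym (≈-weaken (p∣q i) (generator-≈ c i)) ⟩
      val (generator c)          ≈⟨ ≈-weaken (p∣n i) same ⟩
      val (generator c′)         ≈⟨ ≈-weaken (p∣q i) (generator-≈ c′ i) ⟩
      z i ^ᶻ exponent c′ i       ∎))
    where
    i = F.suc t
    open ≈-Reasoning (p i)

  class-distinct : ∀ c c′ → c ≢ c′ → ¬ CayIso (class c) (class c′)
  class-distinct c c′ c≢c′ iso =
    let t , differ = finToFun-distinct {totient d} {l} c c′ c≢c′
    in differ (same-generator⇒≡ c c′ (isomorphic⇒same-generator c c′ t iso) t)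

  -- With `k` inverse to `m 0F` modulo `d`, `g^k` generates the same group and has exponents
  -- `m i k`, the first of them 1 modulo `d`; reducing the others modulo `d` gives the tuple `c`.
  class-complete : ∀ {S} → IsRFFC d S → ∃ λ c → CayIso S (class c)
  class-complete {S} S-RFFC = c , rotorCoset-CayIso coset (cyclic-generator (class-cyclic c) (k , c≈g^k) (m F.zero , g≈c^m))
    where
    coset = RFFC⇒rotorCoset 3≤n S-RFFC
    open RotorCoset coset using (rotor) renaming (generator to g)
    local : ∀ i → ∃ λ m → Coprime m d × val g ≈ z i ^ᶻ m [mod q i ]
    local i = local-power 0<d d∣p-1 i (z^d≈1 i) (z-order i) (proj₁ (localise 0<d rotor i)) (proj₂ (localise 0<d rotor i))
    m : Fin (suc l) → ℕ
    m i = proj₁ (local i)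
    g≈z^m : ∀ i → val g ≈ z i ^ᶻ m i [mod q i ]
    g≈z^m i = proj₂ (proj₂ (local i))
    inverse = coprime-inverse 0<d (proj₁ (proj₂ (local F.zero)))
    k = proj₁ inverse
    mk≈1 : + (m F.zero ℕ.* k) ≈ + 1 [mod d ]
    mk≈1 = proj₂ (proj₂ inverse)
    normalised : ∀ i → ∃ λ r → + coprimeResidue r ≈ + (m i ℕ.* k) [mod d ]
    normalised i = coprimeResidue-surjective
      (Coprimality.sym (coprime-*ʳ (Coprimality.sym (proj₁ (proj₂ (local i)))) (Coprimality.sym (proj₁ (proj₂ inverse)))))
    c : Fin (totient d ^ l)
    c = funToFin (λ i → proj₁ (normalised (F.suc i)))
    exponent-c : ∀ i → + exponent c i ≈ + (m i ℕ.* k) [mod d ]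
    exponent-c F.zero = ≈-sym mk≈1
    exponent-c (F.suc i) = ≈-trans (≈-reflexive (cong (+_ ∘ coprimeResidue) (Fₚ.finToFun-funToFin (λ i → proj₁ (normalised (F.suc i))) i)))
      (proj₂ (normalised (F.suc i)))
    c≈g^k : val (generator c) ≈ val g ^ᶻ k [mod n ]
    c≈g^k = ≈-crt-n λ i → ≈-trans (generator-≈ c i) (≈-trans (^-exponent-cong 0<d (z^d≈1 i) (exponent-c i))
      (≈-trans (≈-reflexive (sym (ℤₚ.^-*-assoc (z i) (m i) k))) (^-cong k (≈-sym (g≈z^m i)))))
    g≈c^m : val g ≈ val (generator c) ^ᶻ m F.zero [mod n ]
    g≈c^m = begin
      val g                                ≡⟨ sym (ℤₚ.^-identityʳ (val g)) ⟩
      val g ^ᶻ 1                           ≈⟨ ^-exponent-cong 0<d (proj₁ rotor) (≈-sym mk≈1) ⟩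
      val g ^ᶻ (m F.zero ℕ.* k)            ≡⟨ trans (cong (val g ^ᶻ_) (ℕₚ.*-comm (m F.zero) k)) (sym (ℤₚ.^-*-assoc (val g) k (m F.zero))) ⟩
      (val g ^ᶻ k) ^ᶻ m F.zero             ≈⟨ ^-cong (m F.zero) (≈-sym c≈g^k) ⟩
      val (generator c) ^ᶻ m F.zero        ∎
      where open ≈-Reasoning n

  classes : ExactlyRFFCClasses {n} d (totient d ^ l)
  classes = class , class-RFFC , class-distinct , λ S S-RFFC → class-complete S-RFFC

  -- All exponents are 1. This witnesses existence directly, where an index in `Fin (totient d ^ l)`
  -- would first have to be exhibited.
  trivial-class : Subset n
  trivial-class = powers d (proj₁ (chinese z))

  trivial-class-RFFC : IsRFFC d trivial-class
  trivial-class-RFFC = RotorSubgroup.isRFFC 3≤n 0<d 2∣d rotor (powers-cyclic 0<d (proj₁ rotor))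
    where
    rotor : Rotor n d (val (proj₁ (chinese z)))
    rotor = globalise 0<d λ i → ≈-trans (^-cong d (proj₂ (chinese z) i)) (z^d≈1 i) ,
      hasOrder-resp (≈-sym (≈-weaken (p∣q i) (proj₂ (chinese z) i))) (z-order i)

theorem2p7 : (n : ℕ) .{{_ : NonZero n}} → 3 ≤ n →
    (l : ℕ) (p e : Fin l → ℕ) →
    (∀ i → Prime (p i)) → (∀ i → 1 ≤ e i) → (∀ i j → i <ᶠ j → p i < p j) →
    n ≡ prodF l (λ i → p i ^ e i) →
    (∀ d → (∃ λ (S : Subset n) → IsRFFC d S)
    ⇔ (¬ (2 ∣ n) × (2 ∣ d) × (d ∣ gcdF l (λ i → p i ∸ 1))))
    ×
    (∀ d → ¬ (2 ∣ n) → (2 ∣ d) → (d ∣ gcdF l (λ i → p i ∸ 1)) →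
    ExactlyRFFCClasses {n} d (totient d ^ (l ∸ 1))
    ×
    (∀ (η : Fin l → ℤ) → (∀ i → PrimitiveRoot (p i ^ e i) (η i)) →
    ∀ (S : Subset n) → IsRFFC d S →
    ∃ λ (b : Fin l → ℤ) → ∃ λ (hh : Fin l → ℤ) → ∃ λ (m : Fin l → ℕ) →
    ValidHData n l (λ i → p i ^ e i) d η b hh m ×
    IsUnit {n} [ hSum n l (λ i → p i ^ e i) b hh ]ᶻ ×
    ∃ λ (T : Subset n) →
    IsCyclicSubgroupOf T [ hSum n l (λ i → p i ^ e i) b hh ]ᶻ × CayIso S T)
    ×
    (∀ (η : Fin l → ℤ) → (∀ i → PrimitiveRoot (p i ^ e i) (η i)) →
    ∀ (b hh : Fin l → ℤ) (m : Fin l → ℕ) →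
    ValidHData n l (λ i → p i ^ e i) d η b hh m →
    ∀ (T : Subset n) →
    IsCyclicSubgroupOf T [ hSum n l (λ i → p i ^ e i) b hh ]ᶻ →
    IsFirstKindFrobenius T T × ∣ T ∣ ≡ d ×
    IsAutomorphism (λ x → x *ₙ [ hSum n l (λ i → p i ^ e i) b hh ]ᶻ) ×
    IsCompleteRotation (λ x → x *ₙ [ hSum n l (λ i → p i ^ e i) b hh ]ᶻ) T))
theorem2p7 n 3≤n zero p e _ _ _ refl = contradiction 3≤n λ { (s≤s ()) }
theorem2p7 n 3≤n (suc l) p e p-prime 1≤e p-increasing n≡prodF = existence , λ d _ 2∣d d∣gcd →
    Classes.classes 3≤n p-prime 1≤e p-increasing n≡prodF (0<d d∣gcd) 2∣d (d∣p-1 d∣gcd) ,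
    (λ η η-primitive S S-RFFC → PrimitiveRoots.rotorCoset⇒hSum (0<d d∣gcd) (d∣p-1 d∣gcd) η-primitive (RFFC⇒rotorCoset 3≤n S-RFFC)) ,
    λ η η-primitive b hh m valid T cyclic →
      let module R = RotorSubgroup 3≤n (0<d d∣gcd) 2∣d (PrimitiveRoots.hSum-rotor (0<d d∣gcd) (d∣p-1 d∣gcd) η-primitive {b} {hh} valid) cyclic
      in R.isFirstKindFrobenius , R.∣T∣≡d , R.isAutomorphism , R.isCompleteRotation
  where
  open Factorised 3≤n p-prime 1≤e p-increasing n≡prodF
  d∣p-1 : ∀ {d} → d ∣ gcdF (suc l) (λ i → p i ∸ 1) → ∀ i → d ∣ p i ∸ 1
  d∣p-1 d∣gcd i = ℕ∣.∣-trans d∣gcd (gcdF-∣ (suc l) (λ i → p i ∸ 1) i)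
  0<d : ∀ {d} → d ∣ gcdF (suc l) (λ i → p i ∸ 1) → 0 < d
  -- `d = 0` would force `p 0F - 1 = 0`; the gcd is positive because there is at least one prime.
  0<d {zero} d∣gcd = contradiction (ℕ∣.0∣⇒≡0 (d∣p-1 d∣gcd F.zero)) (ℕₚ.m>n⇒m∸n≢0 (1<p F.zero))
  0<d {suc d} _ = s≤s z≤n
  existence : ∀ d → (∃ λ (S : Subset n) → IsRFFC d S) ⇔ (¬ (2 ∣ n) × (2 ∣ d) × (d ∣ gcdF (suc l) (λ i → p i ∸ 1)))
  existence d = mk⇔
    (λ (S , S-RFFC) → let open RotorCoset (RFFC⇒rotorCoset 3≤n S-RFFC) renaming (0<d to 0<d′) in 2∤n , 2∣d , order-divides 0<d′ rotor)
    (λ (_ , 2∣d , d∣gcd) → _ , Classes.trivial-class-RFFC 3≤n p-prime 1≤e p-increasing n≡prodF (0<d d∣gcd) 2∣d (d∣p-1 d∣gcd))
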